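{- Let $K$ be a non-Archimedean real closed field which admits an integer part whose non-negative cone is a model of Peano Arithmetic. Then $K$ admits left exponentiation, and the value group $G=v(K^\times)$ of $K$ (with respect to the natural valuation $v$) is an exponential group in the additive ordered group $(\overline{K},+,0,<)$ of the residue field $\overline{K}$ of $K$.
   Context: Integer part: an integer part of an ordered field $R$ is a discretely ordered subring $Z\subseteq R$ such that for every $r\in R$ there is $z\in Z$ with $z\le r<z+1$. Its non-negative cone is $Z^{\ge 0}$, regarded as a structure in the language $\{+,\cdot,0,1,<\}$. Peano Arithmetic (PA) is the theory of non-negative cones of discretely ordered commutative rings with $1$ together with the induction axiom for every first-order formula of $\{+,\cdot,0,1,<\}$. Natural valuation on a divisible ordered abelian group $(G,+,0,<)$: for non-zero $x,y\in G$ put $x\sim y$ if there is $n\in\mathbb{N}$ with $n|x|\ge|y|$ and $n|y|\ge|x|$, and write $x\ll y$ if $n|x|<|y|$ for all $n\in\mathbb{N}$. Let $[x]$ be the $\sim$-class of $x$ and $\Gamma=\{[x]:x\in G\setminus\{0\}\}$, totally ordered by $[y]<[x]$ iff $x\ll y$. $\Gamma$ is called the rank of $G$, and $v(x)=[x]$ for $x\ne0$, $v(0)=\infty$, is the natural valuation. For $\gamma\in\Gamma$, the Archimedean component $B_\gamma$ is a maximal Archimedean subgroup of $G$ containing some chosen $x\in\gamma$ (up to isomorphism of ordered groups, $\{x: v(x)\ge\gamma\}/\{x:v(x)>\gamma\}$). Natural valuation on a real closed field $K$: the natural valuation $v$ of the ordered group $(K,+,0,<)$. The value set $v(K^\times)$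 with addition $v(x)+v(y)=v(xy)$ is a divisible ordered abelian group, called the value group. Put $R_v=\{a\in K:v(a)\ge0\}$, $\mu_v=\{a\in K:v(a)>0\}$, $\mathcal{U}_v^{>0}=\{a\in K^{>0}:v(a)=0\}$, and $\overline{K}=R_v/\mu_v$ (the residue field, an Archimedean ordered field). Left exponentiation: the ordered groups $(K,+,0,<)$ and $(K^{>0},\cdot,1,<)$ are divisible, i.e. ordered $\mathbb{Q}$-vector spaces. $K$ admits left exponentiation if there is an order preserving group isomorphism from some ($\mathbb{Q}$-vector space) complement $A$ of $R_v$ in $(K,+,0,<)$ onto some ($\mathbb{Q}$-vector space) complement $B$ of $\mathcal{U}_v^{>0}$ in $(K^{>0},\cdot,1,<)$. Exponential group: an ordered abelian group $G$ with rank $\Gamma$ and Archimedean components $\{B_\gamma:\gamma\in\Gamma\}$ is an exponential group in an Archimedean ordered group $C$ if $\Gamma$ is isomorphic as a linear order to the negative cone $G^{<0}$ and each $B_\gamma$ is isomorphic to $C$ as an ordered group. -}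

module Defs where

open import Level using (Setω) renaming (suc to lsuc)
open import Axiom.ExcludedMiddle using (ExcludedMiddle)
open import Algebra.Bundles
  using (AbelianGroup; CommutativeMonoid; CommutativeRing; RawGroup; RawRing; RawSemiring)
open import Algebra.Morphism.Structures
  using (module GroupMorphisms; module RingMorphisms)
import Algebra.Morphism.GroupMonomorphism as GroupMono
import Algebra.Morphism.RingMonomorphism as RingMono
import Algebra.Definitions.RawMonoid as RawMult
import Algebra.Properties.Monoid.Mult as MonoidMult
import Algebra.Properties.Semiring.Mult as SemiringMult
import Algebra.Properties.CommutativeSemigroup as CommSemigroup
import Algebra.Properties.AbelianGroup as AbGroup
import Algebra.Properties.Ring as RingProps
open import Data.Empty using (⊥)
open import Data.Fin using (Fin)
open import Data.Integer using (ℤ; +_; -[1+_])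
open import Data.Nat as ℕ using (ℕ; zero; suc)
import Data.Nat.Properties as ℕₚ
open import Data.Product using (Σ; ∃; ∃₂; _×_; _,_; proj₁; proj₂)
open import Data.Rational using (ℚ; ↥_; ↧ₙ_)
open import Data.Sum using (_⊎_; inj₁; inj₂)
open import Data.Vec using (Vec; _∷_; lookup; last; foldr′)
open import Function using (_∘_; flip)
open import Relation.Binary
  using (Rel; IsEquivalence; IsStrictTotalOrder; StrictTotalOrder;
         Tri; tri<; tri≈; tri>; Trichotomous)
import Relation.Binary.Construct.On as On
import Relation.Binary.Construct.Add.Supremum.Equality as SupremumEquality
import Relation.Binary.Construct.Add.Supremum.NonStrict as SupremumNonStrict
import Relation.Binary.Construct.Add.Supremum.Strict as SupremumStrict
open import Relation.Binary.Morphism.Structures using (IsOrderIsomorphism)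
import Relation.Binary.Properties.StrictTotalOrder as STO
import Relation.Binary.Reasoning.StrictPartialOrder as SPO-Reasoning
open import Relation.Binary.PropositionalEquality as ≡ using (_≡_)
open import Relation.Nullary using (¬_; Dec; yes; no; contradiction)
open import Relation.Nullary.Construct.Add.Supremum using (_⁺; ⊤⁺; [_])
open import Relation.Unary using (Pred; _∈_; _⊆_)

-- The axiom of choice: every equivalence relation has a system of
-- representatives (type-theoretic choice from Σ-types is not extensional, so
-- it does not suffice to choose, say, a Hamel basis in a setoid).
RepresentativeChoice : ∀ a ℓ → Set (lsuc (a Level.⊔ ℓ))
RepresentativeChoice a ℓ =
  {A : Set a} {_≈_ : Rel A ℓ} → IsEquivalence _≈_ →
  ∃ λ (rep : A → A) → (∀ x → rep x ≈ x) × (∀ {x y} → x ≈ y → rep x ≡ rep y)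

-- The mathematics is that of ZFC; both principles are hypotheses here because
-- Agda has neither.
record Classical : Setω where
  field
    excluded-middle : ∀ {ℓ} → ExcludedMiddle ℓ
    choice          : ∀ {a ℓ} → RepresentativeChoice a ℓ

record OrderedAbelianGroup ℓ : Set (lsuc ℓ) where
  infix 4 _<_
  field
    abelianGroup       : AbelianGroup ℓ ℓ
  open AbelianGroup abelianGroup public hiding (_-_)
  field
    _<_                : Rel Carrier ℓ
    isStrictTotalOrder : IsStrictTotalOrder _≈_ _<_
    ∙-monoˡ-<          : ∀ z {x y} → x < y → (x ∙ z) < (y ∙ z)

  strictTotalOrder : StrictTotalOrder ℓ ℓ ℓ
  strictTotalOrder = record { isStrictTotalOrder = isStrictTotalOrder }

  open IsStrictTotalOrder isStrictTotalOrder public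
    using (compare; _≟_; irrefl; asym; <-resp-≈; <-respʳ-≈; <-respˡ-≈)
    renaming (trans to <-trans)
  open STO strictTotalOrder public
    using (_≤_)
    renaming (refl to ≤-refl; trans to ≤-trans; total to ≤-total; reflexive to ≤-reflexive; ≤-resp-≈ to ≤-resp-≈)

  open RawMult rawMonoid public renaming (_×_ to infixr 8 _·_) using ()

  ∣_∣ : Carrier → Carrier
  ∣ x ∣ with compare x ε
  ... | tri< _ _ _ = x ⁻¹
  ... | tri≈ _ _ _ = x
  ... | tri> _ _ _ = x

  infix 4 _∼_ _≪_

  _∼_ : Rel Carrier ℓ
  x ∼ y = ∃ λ n → ∣ y ∣ ≤ n · ∣ x ∣ × ∣ x ∣ ≤ n · ∣ y ∣

  _≪_ : Rel Carrier ℓ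
  x ≪ y = ∀ n → n · ∣ x ∣ < ∣ y ∣

  NonZero : Carrier → Set ℓ
  NonZero x = ¬ x ≈ ε

IsArchimedean : ∀ {ℓ} → OrderedAbelianGroup ℓ → Set ℓ
IsArchimedean G = ∀ {x y} → NonZero x → NonZero y → x ∼ y
  where open OrderedAbelianGroup G

module OrderedGroupProperties {ℓ} (G : OrderedAbelianGroup ℓ) where
  open OrderedAbelianGroup G
  open SPO-Reasoning (StrictTotalOrder.strictPartialOrder strictTotalOrder) public
  open MonoidMult monoid using (×-homo-+; ×-assocˡ; ×-congʳ; ×-congˡ; ×-homo-1) public
  open AbGroup abelianGroup using (⁻¹-involutive; ε⁻¹≈ε; ⁻¹-∙-comm; ⁻¹-injective) public

  <⇒≤ : ∀ {x y} → x < y → x ≤ y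
  <⇒≤ = inj₁

  ≈⇒≤ : ∀ {x y} → x ≈ y → x ≤ y
  ≈⇒≤ = inj₂

  <-irrefl : ∀ {x} → ¬ x < x
  <-irrefl = irrefl refl

  ≮⇒≥ : ∀ {x y} → ¬ x < y → y ≤ x
  ≮⇒≥ {x} {y} x≮y with compare x y
  ... | tri< p _ _ = contradiction p x≮y
  ... | tri≈ _ p _ = inj₂ (sym p)
  ... | tri> _ _ p = inj₁ p

  <⇒≱ : ∀ {x y} → x < y → ¬ y ≤ x
  <⇒≱ p (inj₁ q) = asym p q
  <⇒≱ p (inj₂ q) = irrefl (sym q) p

  <-≤-trans : ∀ {x y z} → x < y → y ≤ z → x < z
  <-≤-trans p (inj₁ q) = <-trans p q
  <-≤-trans p (inj₂ q) = <-respʳ-≈ q p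

  ≤-<-trans : ∀ {x y z} → x ≤ y → y < z → x < z
  ≤-<-trans (inj₁ p) q = <-trans p q
  ≤-<-trans (inj₂ p) q = <-respˡ-≈ (sym p) q

  ∙-monoʳ-< : ∀ z {x y} → x < y → (z ∙ x) < (z ∙ y)
  ∙-monoʳ-< z {x} {y} p = begin-strict
    z ∙ x ≈⟨ comm z x ⟩
    x ∙ z <⟨ ∙-monoˡ-< z p ⟩
    y ∙ z ≈⟨ comm y z ⟩
    z ∙ y ∎

  ∙-monoˡ-≤ : ∀ z {x y} → x ≤ y → (x ∙ z) ≤ (y ∙ z)
  ∙-monoˡ-≤ z (inj₁ p) = inj₁ (∙-monoˡ-< z p)
  ∙-monoˡ-≤ z (inj₂ p) = inj₂ (∙-congʳ p)

  ∙-monoʳ-≤ : ∀ z {x y} → x ≤ y → (z ∙ x) ≤ (z ∙ y)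
  ∙-monoʳ-≤ z (inj₁ p) = inj₁ (∙-monoʳ-< z p)
  ∙-monoʳ-≤ z (inj₂ p) = inj₂ (∙-congˡ p)

  ∙-mono-≤ : ∀ {x y u v} → x ≤ y → u ≤ v → (x ∙ u) ≤ (y ∙ v)
  ∙-mono-≤ p q = ≤-trans (∙-monoˡ-≤ _ p) (∙-monoʳ-≤ _ q)

  ∙-mono-<-≤ : ∀ {x y u v} → x < y → u ≤ v → (x ∙ u) < (y ∙ v)
  ∙-mono-<-≤ p q = <-≤-trans (∙-monoˡ-< _ p) (∙-monoʳ-≤ _ q)

  ·-mono-≤ : ∀ n {x y} → x ≤ y → n · x ≤ n · y
  ·-mono-≤ zero    p = ≤-refl
  ·-mono-≤ (suc n) p = ∙-mono-≤ p (·-mono-≤ n p)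

  ε≤· : ∀ n {x} → ε ≤ x → ε ≤ n · x
  ε≤· zero    p = ≤-refl
  ε≤· (suc n) {x} p = begin
    ε          ≈⟨ identityˡ ε ⟨
    ε ∙ ε      ≤⟨ ∙-mono-≤ p (ε≤· n p) ⟩
    x ∙ n · x  ∎

  ·-monoˡ-≤ : ∀ {m n x} → m ℕ.≤ n → ε ≤ x → m · x ≤ n · x
  ·-monoˡ-≤ {n = n} ℕ.z≤n p = ε≤· n p
  ·-monoˡ-≤ (ℕ.s≤s m≤n) p = ∙-monoʳ-≤ _ (·-monoˡ-≤ m≤n p)

  ·-cancel-< : ∀ n {x y} → n · x < n · y → x < y
  ·-cancel-< n {x} {y} p with compare x y
  ... | tri< q _ _ = q
  ... | tri≈ _ q _ = contradiction (·-mono-≤ n (inj₂ (sym q))) (<⇒≱ p)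
  ... | tri> _ _ q = contradiction (·-mono-≤ n (inj₁ q)) (<⇒≱ p)

  ⁻¹-anti-< : ∀ {x y} → x < y → y ⁻¹ < x ⁻¹
  ⁻¹-anti-< {x} {y} p = begin-strict
    y ⁻¹              ≈⟨ identityˡ _ ⟨
    ε ∙ y ⁻¹          ≈⟨ ∙-congʳ (inverseˡ x) ⟨
    (x ⁻¹ ∙ x) ∙ y ⁻¹ <⟨ ∙-monoˡ-< _ (∙-monoʳ-< _ p) ⟩
    (x ⁻¹ ∙ y) ∙ y ⁻¹ ≈⟨ assoc _ _ _ ⟩
    x ⁻¹ ∙ (y ∙ y ⁻¹) ≈⟨ ∙-congˡ (inverseʳ y) ⟩
    x ⁻¹ ∙ ε          ≈⟨ identityʳ _ ⟩
    x ⁻¹              ∎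

  <ε⇒ε<⁻¹ : ∀ {x} → x < ε → ε < x ⁻¹
  <ε⇒ε<⁻¹ p = <-respˡ-≈ ε⁻¹≈ε (⁻¹-anti-< p)

  ε<⇒⁻¹<ε : ∀ {x} → ε < x → x ⁻¹ < ε
  ε<⇒⁻¹<ε p = <-respʳ-≈ ε⁻¹≈ε (⁻¹-anti-< p)

  ∣∣-nonneg : ∀ {x} → ε ≤ x → ∣ x ∣ ≈ x
  ∣∣-nonneg {x} p with compare x ε
  ... | tri< q _ _ = contradiction p (<⇒≱ q)
  ... | tri≈ _ _ _ = refl
  ... | tri> _ _ _ = refl

  ∣∣-neg : ∀ {x} → x < ε → ∣ x ∣ ≈ x ⁻¹
  ∣∣-neg {x} p with compare x ε
  ... | tri< _ _ _ = refl
  ... | tri≈ q _ _ = contradiction p q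
  ... | tri> q _ _ = contradiction p q

  ∣∣-cong : ∀ {x y} → x ≈ y → ∣ x ∣ ≈ ∣ y ∣
  ∣∣-cong {x} {y} x≈y with compare x ε
  ... | tri< p _ _ = trans (⁻¹-cong x≈y) (sym (∣∣-neg (<-respˡ-≈ x≈y p)))
  ... | tri≈ _ p _ = trans x≈y (sym (∣∣-nonneg (inj₂ (trans (sym p) x≈y))))
  ... | tri> _ _ p = trans x≈y (sym (∣∣-nonneg (inj₁ (<-respʳ-≈ x≈y p))))

  ε≤∣∣ : ∀ x → ε ≤ ∣ x ∣
  ε≤∣∣ x with compare x ε
  ... | tri< p _ _ = inj₁ (<ε⇒ε<⁻¹ p)
  ... | tri≈ _ p _ = inj₂ (sym p)
  ... | tri> _ _ p = inj₁ p

  x≤∣x∣ : ∀ x → x ≤ ∣ x ∣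
  x≤∣x∣ x with compare x ε
  ... | tri< p _ _ = inj₁ (<-trans p (<ε⇒ε<⁻¹ p))
  ... | tri≈ _ p _ = ≤-refl
  ... | tri> _ _ p = ≤-refl

  x⁻¹≤∣x∣ : ∀ x → x ⁻¹ ≤ ∣ x ∣
  x⁻¹≤∣x∣ x with compare x ε
  ... | tri< p _ _ = ≤-refl
  ... | tri≈ _ p _ = inj₂ (trans (⁻¹-cong p) (trans ε⁻¹≈ε (sym p)))
  ... | tri> _ _ p = inj₁ (<-trans (ε<⇒⁻¹<ε p) p)

  ∣∣-lub : ∀ {x z} → x ≤ z → x ⁻¹ ≤ z → ∣ x ∣ ≤ z
  ∣∣-lub {x} p q with compare x ε
  ... | tri< _ _ _ = q
  ... | tri≈ _ _ _ = p
  ... | tri> _ _ _ = p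

  ∣⁻¹∣ : ∀ x → ∣ x ⁻¹ ∣ ≈ ∣ x ∣
  ∣⁻¹∣ x with compare x ε
  ... | tri< p _ _ = ∣∣-nonneg (inj₁ (<ε⇒ε<⁻¹ p))
  ... | tri≈ _ p _ = trans (∣∣-cong (trans (⁻¹-cong p) (trans ε⁻¹≈ε (sym p))))
                           (∣∣-nonneg (inj₂ (sym p)))
  ... | tri> _ _ p = trans (∣∣-neg (ε<⇒⁻¹<ε p)) (⁻¹-involutive x)

  ∣∣-triangle : ∀ x y → ∣ x ∙ y ∣ ≤ ∣ x ∣ ∙ ∣ y ∣
  ∣∣-triangle x y = ∣∣-lub (∙-mono-≤ (x≤∣x∣ x) (x≤∣x∣ y))
    (begin
      (x ∙ y) ⁻¹    ≈⟨ ⁻¹-∙-comm x y ⟨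
      x ⁻¹ ∙ y ⁻¹   ≤⟨ ∙-mono-≤ (x⁻¹≤∣x∣ x) (x⁻¹≤∣x∣ y) ⟩
      ∣ x ∣ ∙ ∣ y ∣ ∎)

  ε<∣∣ : ∀ {x} → NonZero x → ε < ∣ x ∣
  ε<∣∣ {x} x≉ε with compare x ε
  ... | tri< p _ _ = <ε⇒ε<⁻¹ p
  ... | tri≈ _ p _ = contradiction p x≉ε
  ... | tri> _ _ p = p

  ≤1· : ∀ {x y} → x ≤ y → x ≤ 1 · y
  ≤1· p = ≤-trans p (inj₂ (sym (×-homo-1 _)))

  ≤··-trans : ∀ m n {x y z} → z ≤ m · y → y ≤ n · x → z ≤ (m ℕ.* n) · x
  ≤··-trans m n {x} {y} {z} p q = begin
    z               ≤⟨ p ⟩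
    m · y           ≤⟨ ·-mono-≤ m q ⟩
    m · (n · x)     ≈⟨ ×-assocˡ x m n ⟩
    (m ℕ.* n) · x   ∎

  ≈⇒∼ : ∀ {x y} → x ≈ y → x ∼ y
  ≈⇒∼ x≈y = 1 , ≤1· (inj₂ (∣∣-cong (sym x≈y))) , ≤1· (inj₂ (∣∣-cong x≈y))

  ∼-refl : ∀ {x} → x ∼ x
  ∼-refl = ≈⇒∼ refl

  ∼-sym : ∀ {x y} → x ∼ y → y ∼ x
  ∼-sym (n , p , q) = n , q , p

  ∼-trans : ∀ {x y z} → x ∼ y → y ∼ z → x ∼ z
  ∼-trans {x} {y} {z} (n , y≤nx , x≤ny) (m , z≤my , y≤mz) =
    m ℕ.* n , ≤··-trans m n z≤my y≤nx ,
    ≡.subst (λ k → ∣ x ∣ ≤ k · ∣ z ∣) (ℕₚ.*-comm n m) (≤··-trans n m x≤ny y≤mz)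

  ∼-isEquivalence : IsEquivalence _∼_
  ∼-isEquivalence = record { refl = ∼-refl ; sym = ∼-sym ; trans = ∼-trans }

  ≪⇒∣∣<∣∣ : ∀ {x y} → x ≪ y → ∣ x ∣ < ∣ y ∣
  ≪⇒∣∣<∣∣ x≪y = <-respˡ-≈ (×-homo-1 _) (x≪y 1)

  ≪-trans : ∀ {x y z} → x ≪ y → y ≪ z → x ≪ z
  ≪-trans x≪y y≪z n = <-trans (x≪y n) (≪⇒∣∣<∣∣ y≪z)

  ≪⇒≁ : ∀ {x y} → x ≪ y → ¬ x ∼ y
  ≪⇒≁ x≪y (n , y≤nx , _) = <⇒≱ (x≪y n) y≤nx

  ≪-irrefl : ∀ {x} → ¬ x ≪ x
  ≪-irrefl x≪x = ≪⇒≁ x≪x ∼-refl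

  ∼-≪-trans : ∀ {x y z} → x ∼ y → y ≪ z → x ≪ z
  ∼-≪-trans {x} {y} {z} (n , _ , x≤ny) y≪z m = begin-strict
    m · ∣ x ∣          ≤⟨ ·-mono-≤ m x≤ny ⟩
    m · n · ∣ y ∣      ≈⟨ ×-assocˡ _ m n ⟩
    (m ℕ.* n) · ∣ y ∣  <⟨ y≪z (m ℕ.* n) ⟩
    ∣ z ∣              ∎

  ≪-∼-trans : ∀ {x y z} → x ≪ y → y ∼ z → x ≪ z
  ≪-∼-trans {x} {y} {z} x≪y (n , _ , y≤nz) m = ·-cancel-< n (begin-strict
    n · m · ∣ x ∣      ≈⟨ ×-assocˡ _ n m ⟩
    (n ℕ.* m) · ∣ x ∣  <⟨ x≪y (n ℕ.* m) ⟩
    ∣ y ∣              ≤⟨ y≤nz ⟩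
    n · ∣ z ∣          ∎)

  module _ (em : ExcludedMiddle ℓ) where

    ¬≪⇒≤ : ∀ {x y} → ¬ x ≪ y → ∃ λ n → ∣ y ∣ ≤ n · ∣ x ∣
    ¬≪⇒≤ {x} {y} ¬x≪y with em {∃ λ n → ∣ y ∣ ≤ n · ∣ x ∣}
    ... | yes p = p
    ... | no ¬p = contradiction (λ n → x≪y n) ¬x≪y
      where
      x≪y : x ≪ y
      x≪y n with compare (n · ∣ x ∣) ∣ y ∣
      ... | tri< p _ _ = p
      ... | tri≈ _ p _ = contradiction (n , inj₂ (sym p)) ¬p
      ... | tri> _ _ p = contradiction (n , inj₁ p) ¬p

    ≪-compare : Trichotomous _∼_ (flip _≪_)
    ≪-compare x y with em {y ≪ x} | em {x ≪ y}
    ... | yes y≪x | _       =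
      tri< y≪x (≪⇒≁ y≪x ∘ ∼-sym) (λ x≪y → ≪-irrefl (≪-trans x≪y y≪x))
    ... | no y≪̸x  | yes x≪y = tri> y≪̸x (≪⇒≁ x≪y) x≪y
    ... | no y≪̸x  | no x≪̸y  = tri≈ y≪̸x x∼y x≪̸y
      where
      n m : ℕ
      n = proj₁ (¬≪⇒≤ x≪̸y)
      m = proj₁ (¬≪⇒≤ y≪̸x)
      x∼y : x ∼ y
      x∼y = n ℕ.+ m
          , ≤-trans (proj₂ (¬≪⇒≤ x≪̸y)) (·-monoˡ-≤ (ℕₚ.m≤m+n n m) (ε≤∣∣ x))
          , ≤-trans (proj₂ (¬≪⇒≤ y≪̸x)) (·-monoˡ-≤ (ℕₚ.m≤n+m m n) (ε≤∣∣ y))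

    ≫-isStrictTotalOrder : IsStrictTotalOrder _∼_ (flip _≪_)
    ≫-isStrictTotalOrder = record
      { isStrictPartialOrder = record
        { isEquivalence = ∼-isEquivalence
        ; irrefl        = λ x∼y y≪x → ≪⇒≁ y≪x (∼-sym x∼y)
        ; trans         = flip ≪-trans
        ; <-resp-≈      = (λ x∼y z → ∼-≪-trans (∼-sym x∼y) z)
                        , (λ x∼y z → ≪-∼-trans z x∼y)
        }
      ; compare = ≪-compare
      }

-- The order of the rank is reversed: [y] < [x] iff x ≪ y.
rank : ∀ {ℓ} → ExcludedMiddle ℓ → OrderedAbelianGroup ℓ → StrictTotalOrder ℓ ℓ ℓ
rank em G = On.strictTotalOrder
  (record { isStrictTotalOrder = OrderedGroupProperties.≫-isStrictTotalOrder G em })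
  (proj₁ {B = NonZero})
  where open OrderedAbelianGroup G

module NaturalValuation {ℓ} (G : OrderedAbelianGroup ℓ) where
  open OrderedAbelianGroup G

  -- The top element is ∞; [ x ] stands for the class of x in the rank.
  v : Carrier → (Σ Carrier NonZero) ⁺
  v x with x ≟ ε
  ... | yes _  = ⊤⁺
  ... | no x≉ε = [ x , x≉ε ]

record _≅ᵒ_ {ℓ} (A B : StrictTotalOrder ℓ ℓ ℓ) : Set ℓ where
  private
    module A = StrictTotalOrder A
    module B = StrictTotalOrder B
  field
    to                 : A.Carrier → B.Carrier
    isOrderIsomorphism : IsOrderIsomorphism A._≈_ B._≈_ A._<_ B._<_ to

record _≅ᵍ_ {ℓ} (G H : OrderedAbelianGroup ℓ) : Set ℓ where
  private
    module G = OrderedAbelianGroup G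
    module H = OrderedAbelianGroup H
  field
    to                 : G.Carrier → H.Carrier
    isGroupIsomorphism : GroupMorphisms.IsGroupIsomorphism G.rawGroup H.rawGroup to
    isOrderIsomorphism : IsOrderIsomorphism G._≈_ H._≈_ G._<_ H._<_ to

record Subgroup {ℓ} (G : OrderedAbelianGroup ℓ) : Set (lsuc ℓ) where
  open OrderedAbelianGroup G
  field
    member  : Pred Carrier ℓ
    resp    : ∀ {x y} → x ≈ y → member x → member y
    ε∈      : member ε
    ∙-closed  : ∀ {x y} → member x → member y → member (x ∙ y)
    ⁻¹-closed : ∀ {x} → member x → member (x ⁻¹)

  orderedAbelianGroup : OrderedAbelianGroup ℓ
  orderedAbelianGroup = record
    { abelianGroup       = record { isAbelianGroup = GroupMono.isAbelianGroup mono isAbelianGroup }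
    ; _<_                = λ x y → proj₁ x < proj₁ y
    ; isStrictTotalOrder = On.isStrictTotalOrder proj₁ isStrictTotalOrder
    ; ∙-monoˡ-<          = λ z → ∙-monoˡ-< (proj₁ z)
    }
    where
    raw : RawGroup ℓ ℓ
    raw = record
      { Carrier = Σ Carrier member
      ; _≈_     = λ x y → proj₁ x ≈ proj₁ y
      ; _∙_     = λ x y → proj₁ x ∙ proj₁ y , ∙-closed (proj₂ x) (proj₂ y)
      ; ε       = ε , ε∈
      ; _⁻¹     = λ x → proj₁ x ⁻¹ , ⁻¹-closed (proj₂ x)
      }
    mono : GroupMorphisms.IsGroupMonomorphism raw rawGroup proj₁
    mono = record
      { isGroupHomomorphism = record
        { isMonoidHomomorphism = record
          { isMagmaHomomorphism = record
            { isRelHomomorphism = record { cong = λ p → p }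
            ; homo = λ _ _ → refl
            }
          ; ε-homo = refl
          }
        ; ⁻¹-homo = λ _ → refl
        }
      ; injective = λ p → p
      }

module _ {ℓ} (G : OrderedAbelianGroup ℓ) where
  open OrderedAbelianGroup G

  _·ℤ_ : ℤ → Carrier → Carrier
  (+ n)    ·ℤ x = n · x
  -[1+ n ] ·ℤ x = (suc n · x) ⁻¹

  -- y = q x in the ℚ-vector space structure of a divisible ordered group.
  -- Ordered groups are torsion-free, so there is at most one such y.
  IsScalarMultiple : ℚ → Carrier → Carrier → Set ℓ
  IsScalarMultiple q x y = (↧ₙ q) · y ≈ (↥ q) ·ℤ x

  IsℚSubspace : Subgroup G → Set ℓ
  IsℚSubspace A = ∀ q {x y} → member x → IsScalarMultiple q x y → member y
    where open Subgroup A

  record Complement (S : Pred Carrier ℓ) : Set (lsuc ℓ) where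
    field
      subgroup    : Subgroup G
      isℚSubspace : IsℚSubspace subgroup
    open Subgroup subgroup public
    field
      disjoint : ∀ {x} → member x → x ∈ S → x ≈ ε
      spanning : ∀ x → ∃₂ λ a s → member a × s ∈ S × x ≈ a ∙ s

module _ {ℓ} (em : ExcludedMiddle ℓ) (G : OrderedAbelianGroup ℓ) where
  open OrderedAbelianGroup G
  private module Γ = StrictTotalOrder (rank em G)

  record ArchimedeanComponent (γ : Γ.Carrier) : Set (lsuc ℓ) where
    field
      subgroup      : Subgroup G
      isArchimedean : IsArchimedean (Subgroup.orderedAbelianGroup subgroup)
      maximal       : ∀ (B : Subgroup G) → IsArchimedean (Subgroup.orderedAbelianGroup B) →
                      Subgroup.member subgroup ⊆ Subgroup.member B →
                      Subgroup.member B ⊆ Subgroup.member subgroup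
      element       : Γ.Carrier
      element∈γ     : element Γ.≈ γ
      element∈B     : Subgroup.member subgroup (proj₁ element)
    open Subgroup subgroup public using (orderedAbelianGroup)

  negativeCone : StrictTotalOrder ℓ ℓ ℓ
  negativeCone = On.strictTotalOrder strictTotalOrder (proj₁ {B = _< ε})

  -- A component is determined only up to isomorphism, so all of them are
  -- required to be isomorphic to C; that there is one is part of the
  -- definition, so that this requirement is never vacuous.
  record IsExponentialGroupIn (C : OrderedAbelianGroup ℓ) : Set (lsuc ℓ) where
    field
      C-isArchimedean : IsArchimedean C
      rank≅G<0        : rank em G ≅ᵒ negativeCone
      component       : ∀ γ → ArchimedeanComponent γ
      component≅C     : ∀ {γ} (B : ArchimedeanComponent γ) →
                        ArchimedeanComponent.orderedAbelianGroup B ≅ᵍ C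

record OrderedRing ℓ : Set (lsuc ℓ) where
  infix 4 _<_
  field
    commutativeRing    : CommutativeRing ℓ ℓ
  open CommutativeRing commutativeRing public hiding (_-_)
  field
    _<_                : Rel Carrier ℓ
    isStrictTotalOrder : IsStrictTotalOrder _≈_ _<_
    +-monoˡ-<          : ∀ z {x y} → x < y → (x + z) < (y + z)
    *-pos              : ∀ {x y} → 0# < x → 0# < y → 0# < x * y
    0<1                : 0# < 1#

  additiveGroup : OrderedAbelianGroup ℓ
  additiveGroup = record
    { abelianGroup       = +-abelianGroup
    ; _<_                = _<_
    ; isStrictTotalOrder = isStrictTotalOrder
    ; ∙-monoˡ-<          = +-monoˡ-<
    }

  open OrderedAbelianGroup additiveGroup public
    using ( strictTotalOrder; compare; _≟_; irrefl; asym; <-resp-≈; <-respʳ-≈; <-respˡ-≈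
          ; <-trans; _≤_; ≤-refl; ≤-trans; _·_; ∣_∣; _∼_; _≪_; NonZero)

  1≉0 : NonZero 1#
  1≉0 1≈0 = irrefl (sym 1≈0) 0<1

IsDiscrete : ∀ {ℓ} → OrderedRing ℓ → Set ℓ
IsDiscrete R = ∀ x → ¬ (0# < x × x < 1#)
  where open OrderedRing R

record OrderedField ℓ : Set (lsuc ℓ) where
  field
    orderedRing : OrderedRing ℓ
  open OrderedRing orderedRing public
  field
    invertible  : ∀ {x} → NonZero x → ∃ λ y → x * y ≈ 1#

  -- Coefficients are listed by increasing degree.
  eval : ∀ {n} → Vec Carrier n → Carrier → Carrier
  eval p x = foldr′ (λ a r → a + x * r) 0# p

record IsRealClosed {ℓ} (K : OrderedField ℓ) : Set ℓ where
  open OrderedField K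
  field
    sqrt     : ∀ {x} → 0# < x → ∃ λ y → y * y ≈ x
    -- a polynomial of degree 2k + 1 has 2k + 2 coefficients
    odd-root : ∀ k (p : Vec Carrier (suc (suc (2 ℕ.* k)))) → NonZero (last p) →
               ∃ λ x → eval p x ≈ 0#

IsNonArchimedean : ∀ {ℓ} → OrderedField ℓ → Set ℓ
IsNonArchimedean K = ¬ IsArchimedean (OrderedField.additiveGroup K)

module OrderedRingProperties {ℓ} (R : OrderedRing ℓ) where
  open OrderedRing R
  open OrderedGroupProperties additiveGroup public
    renaming (⁻¹-involutive to -‿involutive; ε⁻¹≈ε to -0≈0)
  open RingProps ring using (-‿distribˡ-*; -‿distribʳ-*) public
  open SemiringMult semiring using (×-assoc-*; ×-comm-*) public

  x<y⇒0<y-x : ∀ {x y} → x < y → 0# < y + - x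
  x<y⇒0<y-x {x} p = <-respˡ-≈ (-‿inverseʳ x) (+-monoˡ-< (- x) p)

  -+-cancel : ∀ x y → (y + - x) + x ≈ y
  -+-cancel x y = trans (+-assoc _ _ _) (trans (+-congˡ (-‿inverseˡ x)) (+-identityʳ y))

  0<y-x⇒x<y : ∀ {x y} → 0# < y + - x → x < y
  0<y-x⇒x<y {x} {y} p = <-respˡ-≈ (+-identityˡ x) (<-respʳ-≈ (-+-cancel x y) (+-monoˡ-< x p))

  *-monoˡ-< : ∀ {z} → 0# < z → ∀ {x y} → x < y → x * z < y * z
  *-monoˡ-< {z} 0<z {x} {y} p = 0<y-x⇒x<y (<-respʳ-≈
    (trans (distribʳ z y (- x)) (+-congˡ (sym (-‿distribˡ-* x z))))
    (*-pos (x<y⇒0<y-x p) 0<z))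

  *-monoˡ-≤ : ∀ {z} → 0# ≤ z → ∀ {x y} → x ≤ y → x * z ≤ y * z
  *-monoˡ-≤ _          (inj₂ p) = inj₂ (*-congʳ p)
  *-monoˡ-≤ (inj₁ 0<z) (inj₁ p) = inj₁ (*-monoˡ-< 0<z p)
  *-monoˡ-≤ (inj₂ 0≈z) (inj₁ p) = inj₂ (trans (zero' _) (sym (zero' _)))
    where
    zero' : ∀ x → x * _ ≈ 0#
    zero' x = trans (*-congˡ (sym 0≈z)) (zeroʳ x)

  *-monoʳ-≤ : ∀ {z} → 0# ≤ z → ∀ {x y} → x ≤ y → z * x ≤ z * y
  *-monoʳ-≤ {z} 0≤z {x} {y} p = begin
    z * x ≈⟨ *-comm z x ⟩
    x * z ≤⟨ *-monoˡ-≤ 0≤z p ⟩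
    y * z ≈⟨ *-comm y z ⟩
    z * y ∎

  *-nonneg : ∀ {x y} → 0# ≤ x → 0# ≤ y → 0# ≤ x * y
  *-nonneg {x} {y} p q = begin
    0#     ≈⟨ zeroˡ y ⟨
    0# * y ≤⟨ *-monoˡ-≤ q p ⟩
    x * y  ∎

  +-nonneg : ∀ {x y} → 0# ≤ x → 0# ≤ y → 0# ≤ x + y
  +-nonneg {x} {y} p q = begin
    0#      ≈⟨ +-identityˡ 0# ⟨
    0# + 0# ≤⟨ ∙-mono-≤ p q ⟩
    x + y   ∎

  ∣*∣ : ∀ x y → ∣ x * y ∣ ≈ ∣ x ∣ * ∣ y ∣
  ∣*∣ x y with ≤-or-> x | ≤-or-> y
    where
    ≤-or-> : ∀ z → (0# ≤ z) ⊎ (z < 0#)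
    ≤-or-> z with compare z 0#
    ... | tri< p _ _ = inj₂ p
    ... | tri≈ _ p _ = inj₁ (inj₂ (sym p))
    ... | tri> _ _ p = inj₁ (inj₁ p)
  ... | inj₁ p | inj₁ q = trans (∣∣-nonneg (*-nonneg p q)) (sym (*-cong (∣∣-nonneg p) (∣∣-nonneg q)))
  ... | inj₁ p | inj₂ q = sym (begin-equality
      ∣ x ∣ * ∣ y ∣  ≈⟨ *-cong (∣∣-nonneg p) (∣∣-neg q) ⟩
      x * - y        ≈⟨ ∣∣-nonneg (*-nonneg p (inj₁ (<ε⇒ε<⁻¹ q))) ⟨
      ∣ x * - y ∣    ≈⟨ ∣∣-cong (-‿distribʳ-* x y) ⟨
      ∣ - (x * y) ∣  ≈⟨ ∣⁻¹∣ _ ⟩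
      ∣ x * y ∣      ∎)
  ... | inj₂ p | inj₁ q = sym (begin-equality
      ∣ x ∣ * ∣ y ∣  ≈⟨ *-cong (∣∣-neg p) (∣∣-nonneg q) ⟩
      - x * y        ≈⟨ ∣∣-nonneg (*-nonneg (inj₁ (<ε⇒ε<⁻¹ p)) q) ⟨
      ∣ - x * y ∣    ≈⟨ ∣∣-cong (-‿distribˡ-* x y) ⟨
      ∣ - (x * y) ∣  ≈⟨ ∣⁻¹∣ _ ⟩
      ∣ x * y ∣      ∎)
  ... | inj₂ p | inj₂ q = sym (begin-equality
      ∣ x ∣ * ∣ y ∣    ≈⟨ *-cong (∣∣-neg p) (∣∣-neg q) ⟩
      - x * - y        ≈⟨ ∣∣-nonneg (*-nonneg (inj₁ (<ε⇒ε<⁻¹ p)) (inj₁ (<ε⇒ε<⁻¹ q))) ⟨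
      ∣ - x * - y ∣    ≈⟨ ∣∣-cong (-‿distribˡ-* x (- y)) ⟨
      ∣ - (x * - y) ∣  ≈⟨ ∣⁻¹∣ _ ⟩
      ∣ x * - y ∣      ≈⟨ ∣∣-cong (-‿distribʳ-* x y) ⟨
      ∣ - (x * y) ∣    ≈⟨ ∣⁻¹∣ _ ⟩
      ∣ x * y ∣        ∎)

  ∣1∣ : ∣ 1# ∣ ≈ 1#
  ∣1∣ = ∣∣-nonneg (inj₁ 0<1)

  ·*· : ∀ m n x y → (m · x) * (n · y) ≈ (m ℕ.* n) · (x * y)
  ·*· m n x y = begin-equality
    (m · x) * (n · y)    ≈⟨ ×-assoc-* m x (n · y) ⟩
    m · (x * (n · y))    ≈⟨ ×-congʳ m (×-comm-* n x y) ⟩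
    m · (n · (x * y))    ≈⟨ ×-assocˡ (x * y) m n ⟩
    (m ℕ.* n) · (x * y)  ∎

  *-cong-≤ : ∀ m n {x x′ y y′} → ∣ x′ ∣ ≤ m · ∣ x ∣ → ∣ y′ ∣ ≤ n · ∣ y ∣ →
             ∣ x′ * y′ ∣ ≤ (m ℕ.* n) · ∣ x * y ∣
  *-cong-≤ m n {x} {x′} {y} {y′} p q = begin
    ∣ x′ * y′ ∣                  ≈⟨ ∣*∣ x′ y′ ⟩
    ∣ x′ ∣ * ∣ y′ ∣              ≤⟨ *-monoˡ-≤ (ε≤∣∣ y′) p ⟩
    (m · ∣ x ∣) * ∣ y′ ∣         ≤⟨ *-monoʳ-≤ (ε≤· m (ε≤∣∣ x)) q ⟩
    (m · ∣ x ∣) * (n · ∣ y ∣)    ≈⟨ ·*· m n ∣ x ∣ ∣ y ∣ ⟩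
    (m ℕ.* n) · (∣ x ∣ * ∣ y ∣)  ≈⟨ ×-congʳ (m ℕ.* n) (∣*∣ x y) ⟨
    (m ℕ.* n) · ∣ x * y ∣        ∎

  *-cong-∼ : ∀ {x x′ y y′} → x ∼ x′ → y ∼ y′ → x * y ∼ x′ * y′
  *-cong-∼ (m , p , p′) (n , q , q′) = m ℕ.* n , *-cong-≤ m n p q , *-cong-≤ m n p′ q′

  *-mono-≪ : ∀ {x y z} → NonZero z → x ≪ y → x * z ≪ y * z
  *-mono-≪ {x} {y} {z} z≉0 x≪y n = begin-strict
    n · ∣ x * z ∣          ≈⟨ ×-congʳ n (∣*∣ x z) ⟩
    n · (∣ x ∣ * ∣ z ∣)    ≈⟨ ×-assoc-* n ∣ x ∣ ∣ z ∣ ⟨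
    (n · ∣ x ∣) * ∣ z ∣    <⟨ *-monoˡ-< (ε<∣∣ z≉0) (x≪y n) ⟩
    ∣ y ∣ * ∣ z ∣          ≈⟨ ∣*∣ y z ⟨
    ∣ y * z ∣              ∎

infixl 6 _`+_
infixl 7 _`*_
infix  5 _`≈_ _`<_
infixr 4 _`∧_
infixr 3 _`∨_
infixr 2 _`⇒_

-- The index is the number of free (de Bruijn) variables.
data Term (n : ℕ) : Set where
  var       : Fin n → Term n
  `0 `1     : Term n
  _`+_ _`*_ : Term n → Term n → Term n

data Formula (n : ℕ) : Set where
  _`≈_ _`<_       : Term n → Term n → Formula n
  `⊥              : Formula n
  _`∧_ _`∨_ _`⇒_  : Formula n → Formula n → Formula n
  `∀ `∃           : Formula (suc n) → Formula n

record Structure ℓ : Set (lsuc ℓ) where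
  field
    rawSemiring : RawSemiring ℓ ℓ
  open RawSemiring rawSemiring public
  field
    _<_ : Rel Carrier ℓ

module _ {ℓ} (M : Structure ℓ) where
  open Structure M

  ⟦_⟧ᵗ : ∀ {n} → Term n → Vec Carrier n → Carrier
  ⟦ var i  ⟧ᵗ ρ = lookup ρ i
  ⟦ `0     ⟧ᵗ ρ = 0#
  ⟦ `1     ⟧ᵗ ρ = 1#
  ⟦ s `+ t ⟧ᵗ ρ = ⟦ s ⟧ᵗ ρ + ⟦ t ⟧ᵗ ρ
  ⟦ s `* t ⟧ᵗ ρ = ⟦ s ⟧ᵗ ρ * ⟦ t ⟧ᵗ ρ

  ⟦_⟧ : ∀ {n} → Formula n → Vec Carrier n → Set ℓ
  ⟦ s `≈ t ⟧ ρ = ⟦ s ⟧ᵗ ρ ≈ ⟦ t ⟧ᵗ ρ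
  ⟦ s `< t ⟧ ρ = ⟦ s ⟧ᵗ ρ < ⟦ t ⟧ᵗ ρ
  ⟦ `⊥     ⟧ ρ = Level.Lift ℓ ⊥
  ⟦ φ `∧ ψ ⟧ ρ = ⟦ φ ⟧ ρ × ⟦ ψ ⟧ ρ
  ⟦ φ `∨ ψ ⟧ ρ = ⟦ φ ⟧ ρ ⊎ ⟦ ψ ⟧ ρ
  ⟦ φ `⇒ ψ ⟧ ρ = ⟦ φ ⟧ ρ → ⟦ ψ ⟧ ρ
  ⟦ `∀ φ   ⟧ ρ = ∀ x → ⟦ φ ⟧ (x ∷ ρ)
  ⟦ `∃ φ   ⟧ ρ = ∃ λ x → ⟦ φ ⟧ (x ∷ ρ)

  -- Induction on the variable 0 of φ; the other variables are parameters.
  SatisfiesInduction : ∀ {n} → Formula (suc n) → Set ℓ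
  SatisfiesInduction {n} φ = ∀ (ρ : Vec Carrier n) →
    ⟦ φ ⟧ (0# ∷ ρ) →
    (∀ x → ⟦ φ ⟧ (x ∷ ρ) → ⟦ φ ⟧ (x + 1# ∷ ρ)) →
    ∀ x → ⟦ φ ⟧ (x ∷ ρ)

nonNegativeCone : ∀ {ℓ} → OrderedRing ℓ → Structure ℓ
nonNegativeCone R = record
  { rawSemiring = record
    { Carrier = Σ Carrier (0# ≤_)
    ; _≈_     = λ x y → proj₁ x ≈ proj₁ y
    ; _+_     = λ x y → proj₁ x + proj₁ y , +-nonneg (proj₂ x) (proj₂ y)
    ; _*_     = λ x y → proj₁ x * proj₁ y , *-nonneg (proj₂ x) (proj₂ y)
    ; 0#      = 0# , ≤-refl
    ; 1#      = 1# , inj₁ 0<1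
    }
  ; _<_ = λ x y → proj₁ x < proj₁ y
  }
  where
  open OrderedRing R
  open OrderedRingProperties R

-- PA is the theory of non-negative cones of discretely ordered commutative
-- rings together with induction for every formula.
record ConeModelsPA {ℓ} (Z : OrderedRing ℓ) : Set ℓ where
  field
    isDiscrete : IsDiscrete Z
    induction  : ∀ {n} (φ : Formula (suc n)) → SatisfiesInduction (nonNegativeCone Z) φ

record Subring {ℓ} (R : OrderedRing ℓ) : Set (lsuc ℓ) where
  open OrderedRing R
  field
    member   : Pred Carrier ℓ
    resp     : ∀ {x y} → x ≈ y → member x → member y
    0∈       : member 0#
    1∈       : member 1#
    +-closed : ∀ {x y} → member x → member y → member (x + y)
    *-closed : ∀ {x y} → member x → member y → member (x * y)
    neg-closed : ∀ {x} → member x → member (- x)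

  orderedRing : OrderedRing ℓ
  orderedRing = record
    { commutativeRing    = record
      { isCommutativeRing = RingMono.isCommutativeRing mono isCommutativeRing }
    ; _<_                = λ x y → proj₁ x < proj₁ y
    ; isStrictTotalOrder = On.isStrictTotalOrder proj₁ isStrictTotalOrder
    ; +-monoˡ-<          = λ z → +-monoˡ-< (proj₁ z)
    ; *-pos              = *-pos
    ; 0<1                = 0<1
    }
    where
    raw : RawRing ℓ ℓ
    raw = record
      { Carrier = Σ Carrier member
      ; _≈_     = λ x y → proj₁ x ≈ proj₁ y
      ; _+_     = λ x y → proj₁ x + proj₁ y , +-closed (proj₂ x) (proj₂ y)
      ; _*_     = λ x y → proj₁ x * proj₁ y , *-closed (proj₂ x) (proj₂ y)
      ; -_      = λ x → - proj₁ x , neg-closed (proj₂ x)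
      ; 0#      = 0# , 0∈
      ; 1#      = 1# , 1∈
      }
    mono : RingMorphisms.IsRingMonomorphism raw rawRing proj₁
    mono = record
      { isRingHomomorphism = record
        { isSemiringHomomorphism = record
          { isNearSemiringHomomorphism = record
            { +-isMonoidHomomorphism = record
              { isMagmaHomomorphism = record
                { isRelHomomorphism = record { cong = λ p → p }
                ; homo = λ _ _ → refl
                }
              ; ε-homo = refl
              }
            ; *-homo = λ _ _ → refl
            }
          ; 1#-homo = refl
          }
        ; -‿homo = λ _ → refl
        }
      ; injective = λ p → p
      }

record IntegerPart {ℓ} (K : OrderedField ℓ) : Set (lsuc ℓ) where
  open OrderedField K using (Carrier; _≤_; _<_; _+_; 1#)
  field
    subring : Subring (OrderedField.orderedRing K)
  open Subring subring public
  field
    isDiscrete : IsDiscrete orderedRing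
    floor      : ∀ r → ∃ λ z → member z × z ≤ r × r < z + 1#

module OrderedFieldProperties {ℓ} (K : OrderedField ℓ) where
  open OrderedField K
  open OrderedRingProperties orderedRing public

  *-nonZero : ∀ {x y} → NonZero x → NonZero y → NonZero (x * y)
  *-nonZero {x} {y} x≉0 y≉0 xy≈0 with invertible y≉0
  ... | y⁻¹ , yy⁻¹≈1 = x≉0 (begin-equality
    x               ≈⟨ *-identityʳ x ⟨
    x * 1#          ≈⟨ *-congˡ yy⁻¹≈1 ⟨
    x * (y * y⁻¹)   ≈⟨ *-assoc x y y⁻¹ ⟨
    (x * y) * y⁻¹   ≈⟨ *-congʳ xy≈0 ⟩
    0# * y⁻¹        ≈⟨ zeroˡ y⁻¹ ⟩
    0#              ∎)

  recip : ∀ {x} → NonZero x → Carrier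
  recip = proj₁ ∘ invertible

  *-recipʳ : ∀ {x} (x≉0 : NonZero x) → x * recip x≉0 ≈ 1#
  *-recipʳ = proj₂ ∘ invertible

  *-recipˡ : ∀ {x} (x≉0 : NonZero x) → recip x≉0 * x ≈ 1#
  *-recipˡ x≉0 = trans (*-comm _ _) (*-recipʳ x≉0)

  recip-nonZero : ∀ {x} (x≉0 : NonZero x) → NonZero (recip x≉0)
  recip-nonZero {x} x≉0 r≈0 =
    1≉0 (trans (sym (*-recipʳ x≉0)) (trans (*-congˡ r≈0) (zeroʳ x)))

  0<⇒nonZero : ∀ {x} → 0# < x → NonZero x
  0<⇒nonZero 0<x x≈0 = irrefl (sym x≈0) 0<x

  *-cancelʳ-pos : ∀ {x y} → 0# < x → 0# < x * y → 0# < y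
  *-cancelʳ-pos {x} {y} 0<x 0<xy with compare y 0#
  ... | tri> _ _ p = p
  ... | tri≈ _ p _ = contradiction 0<xy (irrefl (sym (trans (*-congˡ p) (zeroʳ x))))
  ... | tri< p _ _ = contradiction (*-monoʳ-≤ (inj₁ 0<x) (inj₁ p))
                       (<⇒≱ (<-respˡ-≈ (sym (zeroʳ x)) 0<xy))

  recip-pos : ∀ {x} (0<x : 0# < x) → 0# < recip (0<⇒nonZero 0<x)
  recip-pos 0<x = *-cancelʳ-pos 0<x (<-respʳ-≈ (sym (*-recipʳ _)) 0<1)

  recip-cong : ∀ {x y} (x≉0 : NonZero x) (y≉0 : NonZero y) → x ≈ y → recip x≉0 ≈ recip y≉0
  recip-cong {x} {y} x≉0 y≉0 x≈y = begin-equality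
    x⁻¹               ≈⟨ *-identityʳ _ ⟨
    x⁻¹ * 1#          ≈⟨ *-congˡ (*-recipʳ y≉0) ⟨
    x⁻¹ * (y * y⁻¹)   ≈⟨ *-assoc _ _ _ ⟨
    (x⁻¹ * y) * y⁻¹   ≈⟨ *-congʳ (*-congˡ x≈y) ⟨
    (x⁻¹ * x) * y⁻¹   ≈⟨ *-congʳ (*-recipˡ x≉0) ⟩
    1# * y⁻¹          ≈⟨ *-identityˡ _ ⟩
    y⁻¹               ∎
    where
    x⁻¹ y⁻¹ : Carrier
    x⁻¹ = recip x≉0
    y⁻¹ = recip y≉0

  Bounded Infinitesimal : Pred Carrier ℓ
  Bounded       x = ∃ λ n → ∣ x ∣ ≤ n · ∣ 1# ∣
  Infinitesimal x = x ≪ 1#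

  +-bounded : ∀ {x y} → Bounded x → Bounded y → Bounded (x + y)
  +-bounded {x} {y} (m , p) (n , q) = m ℕ.+ n , (begin
    ∣ x + y ∣                  ≤⟨ ∣∣-triangle x y ⟩
    ∣ x ∣ + ∣ y ∣              ≤⟨ ∙-mono-≤ p q ⟩
    m · ∣ 1# ∣ + n · ∣ 1# ∣    ≈⟨ ×-homo-+ _ m n ⟨
    (m ℕ.+ n) · ∣ 1# ∣         ∎)

  neg-bounded : ∀ {x} → Bounded x → Bounded (- x)
  neg-bounded {x} (n , p) = n , ≤-trans (inj₂ (∣⁻¹∣ x)) p

  *-bounded : ∀ {x y} → Bounded x → Bounded y → Bounded (x * y)
  *-bounded (m , p) (n , q) = m ℕ.* n , ≤-trans (*-cong-≤ m n p q)
    (inj₂ (×-congʳ (m ℕ.* n) (∣∣-cong (*-identityʳ 1#))))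

  0-bounded : Bounded 0#
  0-bounded = 0 , inj₂ (∣∣-nonneg ≤-refl)

  1-bounded : Bounded 1#
  1-bounded = 1 , ≤1· ≤-refl

  infinitesimal-resp-≈ : ∀ {x y} → x ≈ y → Infinitesimal x → Infinitesimal y
  infinitesimal-resp-≈ x≈y = ∼-≪-trans (≈⇒∼ (sym x≈y))

  infinitesimal-convex : ∀ {x y} → ∣ x ∣ ≤ ∣ y ∣ → Infinitesimal y → Infinitesimal x
  infinitesimal-convex p i n = ≤-<-trans (·-mono-≤ n p) (i n)

  0-infinitesimal : Infinitesimal 0#
  0-infinitesimal n = begin-strict
    n · ∣ 0# ∣     ≈⟨ ×-congʳ n (∣∣-nonneg ≤-refl) ⟩
    n · 0#         ≈⟨ ×-congʳ n (zeroˡ 0#) ⟨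
    n · (0# * 0#)  ≈⟨ ×-comm-* n 0# 0# ⟨
    0# * (n · 0#)  ≈⟨ zeroˡ _ ⟩
    0#             <⟨ ε<∣∣ 1≉0 ⟩
    ∣ 1# ∣         ∎

  ≈0-infinitesimal : ∀ {x} → x ≈ 0# → Infinitesimal x
  ≈0-infinitesimal x≈0 = infinitesimal-resp-≈ (sym x≈0) 0-infinitesimal

  neg-infinitesimal : ∀ {x} → Infinitesimal x → Infinitesimal (- x)
  neg-infinitesimal {x} = infinitesimal-convex (inj₂ (∣⁻¹∣ x))

  double-infinitesimal : ∀ {x y} → ∣ x ∣ ≤ ∣ y ∣ + ∣ y ∣ → Infinitesimal y → Infinitesimal x
  double-infinitesimal {x} {y} p i n = begin-strict
    n · ∣ x ∣            ≤⟨ ·-mono-≤ n p ⟩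
    n · (∣ y ∣ + ∣ y ∣)  ≈⟨ ×-congʳ n (+-congˡ (×-homo-1 _)) ⟨
    n · (2 · ∣ y ∣)      ≈⟨ ×-assocˡ _ n 2 ⟩
    (n ℕ.* 2) · ∣ y ∣    <⟨ i (n ℕ.* 2) ⟩
    ∣ 1# ∣               ∎

  +-infinitesimal : ∀ {x y} → Infinitesimal x → Infinitesimal y → Infinitesimal (x + y)
  +-infinitesimal {x} {y} i j with OrderedAbelianGroup.≤-total additiveGroup ∣ x ∣ ∣ y ∣
  ... | inj₁ p = double-infinitesimal (≤-trans (∣∣-triangle x y) (∙-monoˡ-≤ ∣ y ∣ p)) j
  ... | inj₂ p = double-infinitesimal (≤-trans (∣∣-triangle x y) (∙-monoʳ-≤ ∣ x ∣ p)) i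

  *-infinitesimalˡ : ∀ {x y} → Infinitesimal x → Bounded y → Infinitesimal (x * y)
  *-infinitesimalˡ {x} {y} i (m , q) n = begin-strict
    n · ∣ x * y ∣              ≤⟨ ·-mono-≤ n (*-cong-≤ 1 m (≤1· ≤-refl) q) ⟩
    n · (k · ∣ x * 1# ∣)       ≈⟨ ×-assocˡ _ n k ⟩
    (n ℕ.* k) · ∣ x * 1# ∣     ≈⟨ ×-congʳ (n ℕ.* k) (∣∣-cong (*-identityʳ x)) ⟩
    (n ℕ.* k) · ∣ x ∣          <⟨ i (n ℕ.* k) ⟩
    ∣ 1# ∣                     ∎
    where
    k : ℕ
    k = 1 ℕ.* m

  *-infinitesimalʳ : ∀ {x y} → Bounded x → Infinitesimal y → Infinitesimal (x * y)
  *-infinitesimalʳ {x} {y} b i = infinitesimal-resp-≈ (*-comm y x) (*-infinitesimalˡ i b)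

  infix 4 _≈ᵣ_ _<ᵣ_

  _≈ᵣ_ _<ᵣ_ : Rel Carrier ℓ
  x ≈ᵣ y = Infinitesimal (x + - y)
  x <ᵣ y = x < y × ¬ x ≈ᵣ y

  ≈⇒≈ᵣ : ∀ {x y} → x ≈ y → x ≈ᵣ y
  ≈⇒≈ᵣ {x} {y} x≈y = ≈0-infinitesimal (trans (+-congʳ x≈y) (-‿inverseʳ y))

  neg-minus : ∀ x y → - (x + - y) ≈ y + - x
  neg-minus x y = begin-equality
    - (x + - y)    ≈⟨ ⁻¹-∙-comm x (- y) ⟨
    - x + - - y    ≈⟨ +-comm _ _ ⟩
    - - y + - x    ≈⟨ +-congʳ (-‿involutive y) ⟩
    y + - x        ∎

  minus-trans : ∀ x y z → (x + - y) + (y + - z) ≈ x + - z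
  minus-trans x y z = begin-equality
    (x + - y) + (y + - z)   ≈⟨ +-assoc _ _ _ ⟨
    ((x + - y) + y) + - z   ≈⟨ +-congʳ (-+-cancel y x) ⟩
    x + - z                 ∎

  minus-+ : ∀ x y u w → (x + - y) + (u + - w) ≈ (x + u) + - (y + w)
  minus-+ x y u w = begin-equality
    (x + - y) + (u + - w)   ≈⟨ interchange _ _ _ _ ⟩
    (x + u) + (- y + - w)   ≈⟨ +-congˡ (⁻¹-∙-comm y w) ⟩
    (x + u) + - (y + w)     ∎
    where
    open CommSemigroup (CommutativeMonoid.commutativeSemigroup +-commutativeMonoid)
      using (interchange)

  minus-*ʳ : ∀ x y u → (x + - y) * u ≈ x * u + - (y * u)
  minus-*ʳ x y u = trans (distribʳ u x (- y)) (+-congˡ (sym (-‿distribˡ-* y u)))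

  minus-*ˡ : ∀ x y u → u * (x + - y) ≈ u * x + - (u * y)
  minus-*ˡ x y u = trans (distribˡ u x (- y)) (+-congˡ (sym (-‿distribʳ-* u y)))

  ≈ᵣ-refl : ∀ {x} → x ≈ᵣ x
  ≈ᵣ-refl = ≈⇒≈ᵣ refl

  ≈ᵣ-sym : ∀ {x y} → x ≈ᵣ y → y ≈ᵣ x
  ≈ᵣ-sym {x} {y} i = infinitesimal-resp-≈ (neg-minus x y) (neg-infinitesimal i)

  ≈ᵣ-trans : ∀ {x y z} → x ≈ᵣ y → y ≈ᵣ z → x ≈ᵣ z
  ≈ᵣ-trans {x} {y} {z} i j = infinitesimal-resp-≈ (minus-trans x y z) (+-infinitesimal i j)

  ≈ᵣ-+-cong : ∀ {x y u w} → x ≈ᵣ y → u ≈ᵣ w → x + u ≈ᵣ y + w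
  ≈ᵣ-+-cong i j = infinitesimal-resp-≈ (minus-+ _ _ _ _) (+-infinitesimal i j)

  ≈ᵣ-*-cong : ∀ {x y u w} → Bounded u → Bounded y → x ≈ᵣ y → u ≈ᵣ w → x * u ≈ᵣ y * w
  ≈ᵣ-*-cong {x} {y} {u} {w} bu by i j = ≈ᵣ-trans
    (infinitesimal-resp-≈ (minus-*ʳ x y u) (*-infinitesimalˡ i bu))
    (infinitesimal-resp-≈ (minus-*ˡ u w y) (*-infinitesimalʳ by j))

  ≈ᵣ-neg-cong : ∀ {x y} → x ≈ᵣ y → - x ≈ᵣ - y
  ≈ᵣ-neg-cong {x} {y} i = infinitesimal-resp-≈ (sym (⁻¹-∙-comm x (- y))) (neg-infinitesimal i)

  minus-mono : ∀ {x y z} → x ≤ y → y ≤ z → ∣ y + - x ∣ ≤ ∣ z + - x ∣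
  minus-mono {x} {y} {z} x≤y y≤z = begin
    ∣ y + - x ∣   ≈⟨ ∣∣-nonneg (begin
                       0#       ≈⟨ -‿inverseʳ x ⟨
                       x + - x  ≤⟨ ∙-monoˡ-≤ (- x) x≤y ⟩
                       y + - x  ∎) ⟩
    y + - x       ≤⟨ ∙-monoˡ-≤ (- x) y≤z ⟩
    z + - x       ≤⟨ x≤∣x∣ _ ⟩
    ∣ z + - x ∣   ∎

  <ᵣ-respʳ : ∀ {x y z} → y ≈ᵣ z → x <ᵣ y → x <ᵣ z
  <ᵣ-respʳ {x} {y} {z} y≈z (x<y , x≉y) = x<z , λ x≈z → x≉y (≈ᵣ-trans x≈z (≈ᵣ-sym y≈z))
    where
    z≤x⇒y≈x : z ≤ x → x ≈ᵣ y
    z≤x⇒y≈x z≤x = ≈ᵣ-trans (infinitesimal-convex (minus-mono z≤x (inj₁ x<y)) y≈z) (≈ᵣ-sym y≈z)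
    x<z : x < z
    x<z with compare x z
    ... | tri< p _ _ = p
    ... | tri≈ _ p _ = contradiction (z≤x⇒y≈x (inj₂ (sym p))) x≉y
    ... | tri> _ _ p = contradiction (z≤x⇒y≈x (inj₁ p)) x≉y

  <ᵣ-neg : ∀ {x y} → x <ᵣ y → - y <ᵣ - x
  <ᵣ-neg {x} {y} (p , q) = ⁻¹-anti-< p , λ e → q (≈ᵣ-sym
    (≈ᵣ-trans (≈⇒≈ᵣ (sym (-‿involutive y))) (≈ᵣ-trans (≈ᵣ-neg-cong e) (≈⇒≈ᵣ (-‿involutive x)))))

  <ᵣ-neg⁻¹ : ∀ {x y} → - y <ᵣ - x → x <ᵣ y
  <ᵣ-neg⁻¹ {x} {y} (p , q) =
    <-respˡ-≈ (-‿involutive x) (<-respʳ-≈ (-‿involutive y) (⁻¹-anti-< p)) ,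
    λ e → q (≈ᵣ-sym (≈ᵣ-neg-cong e))

  <ᵣ-respˡ : ∀ {x y z} → y ≈ᵣ z → y <ᵣ x → z <ᵣ x
  <ᵣ-respˡ y≈z p = <ᵣ-neg⁻¹ (<ᵣ-respʳ (≈ᵣ-neg-cong y≈z) (<ᵣ-neg p))

  <ᵣ-trans : ∀ {x y z} → x <ᵣ y → y <ᵣ z → x <ᵣ z
  <ᵣ-trans {x} {y} {z} (x<y , x≉y) (y<z , _) =
    <-trans x<y y<z ,
    λ x≈z → x≉y (≈ᵣ-sym (infinitesimal-convex (minus-mono (inj₁ x<y) (inj₁ y<z)) (≈ᵣ-sym x≈z)))

  <ᵣ-+-monoˡ : ∀ z {x y} → x <ᵣ y → x + z <ᵣ y + z
  <ᵣ-+-monoˡ z {x} {y} (p , q) = +-monoˡ-< z p , λ i → q (≈ᵣ-trans (≈⇒≈ᵣ (sym (cancel x)))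
    (≈ᵣ-trans (≈ᵣ-+-cong i ≈ᵣ-refl) (≈⇒≈ᵣ (cancel y))))
    where
    cancel : ∀ u → (u + z) + - z ≈ u
    cancel u = trans (+-assoc u z (- z)) (trans (+-congˡ (-‿inverseʳ z)) (+-identityʳ u))

  x-0≈x : ∀ x → x + - 0# ≈ x
  x-0≈x x = trans (+-congˡ -0≈0) (+-identityʳ x)

  infinitesimal⇒≈ᵣ0 : ∀ {x} → Infinitesimal x → x ≈ᵣ 0#
  infinitesimal⇒≈ᵣ0 {x} = infinitesimal-resp-≈ (sym (x-0≈x x))

  ≈ᵣ0⇒infinitesimal : ∀ {x} → x ≈ᵣ 0# → Infinitesimal x
  ≈ᵣ0⇒infinitesimal {x} = infinitesimal-resp-≈ (x-0≈x x)

  module _ (em : ExcludedMiddle ℓ) where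

    recip-bounded : ∀ {x} (x≉0 : NonZero x) → ¬ Infinitesimal x → Bounded (recip x≉0)
    recip-bounded {x} x≉0 ¬i with ¬≪⇒≤ em ¬i
    ... | n , 1≤nx = n ℕ.* 1 , (begin
      ∣ recip x≉0 ∣                      ≈⟨ ∣∣-cong (*-identityˡ _) ⟨
      ∣ 1# * recip x≉0 ∣                 ≤⟨ *-cong-≤ n 1 1≤nx (≤1· ≤-refl) ⟩
      (n ℕ.* 1) · ∣ x * recip x≉0 ∣      ≈⟨ ×-congʳ (n ℕ.* 1) (∣∣-cong (*-recipʳ x≉0)) ⟩
      (n ℕ.* 1) · ∣ 1# ∣                 ∎)

    <ᵣ-compare : Trichotomous _≈ᵣ_ _<ᵣ_
    <ᵣ-compare x y with em {x ≈ᵣ y}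
    ... | yes p = tri≈ (λ q → proj₂ q p) p (λ q → proj₂ q (≈ᵣ-sym p))
    ... | no ¬p with compare x y
    ...   | tri< q _ r = tri< (q , ¬p) ¬p (r ∘ proj₁)
    ...   | tri≈ _ q _ = contradiction (≈⇒≈ᵣ q) ¬p
    ...   | tri> r _ q = tri> (r ∘ proj₁) ¬p (q , ¬p ∘ ≈ᵣ-sym)

    <ᵣ-*-pos : ∀ {x y} → Bounded x → Bounded y → 0# <ᵣ x → 0# <ᵣ y → 0# <ᵣ x * y
    <ᵣ-*-pos {x} {y} bx by (0<x , 0≉x) (0<y , 0≉y) = *-pos 0<x 0<y , λ 0≈xy →
      0≉y (≈ᵣ-trans (≈⇒≈ᵣ (sym (zeroˡ x⁻¹)))
        (≈ᵣ-trans (≈ᵣ-*-cong bx⁻¹ (*-bounded bx by) 0≈xy ≈ᵣ-refl) (≈⇒≈ᵣ cancel)))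
      where
      x≉0 : NonZero x
      x≉0 = 0<⇒nonZero 0<x
      x⁻¹ : Carrier
      x⁻¹ = recip x≉0
      bx⁻¹ : Bounded x⁻¹
      bx⁻¹ = recip-bounded x≉0 (λ i → 0≉x (≈ᵣ-sym (infinitesimal⇒≈ᵣ0 i)))
      cancel : (x * y) * x⁻¹ ≈ y
      cancel = begin-equality
        (x * y) * x⁻¹  ≈⟨ *-congʳ (*-comm x y) ⟩
        (y * x) * x⁻¹  ≈⟨ *-assoc y x x⁻¹ ⟩
        y * (x * x⁻¹)  ≈⟨ *-congˡ (*-recipʳ x≉0) ⟩
        y * 1#         ≈⟨ *-identityʳ y ⟩
        y              ∎

module _ {ℓ} (em : ExcludedMiddle ℓ) (K : OrderedField ℓ) where
  open OrderedField K
  open OrderedFieldProperties K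
  open NaturalValuation additiveGroup using (v)

  valueGroup : OrderedAbelianGroup ℓ
  valueGroup = record
    { abelianGroup = record
      { Carrier        = Σ Carrier NonZero
      ; _≈_            = λ x y → proj₁ x ∼ proj₁ y
      ; _∙_            = λ (x , x≉0) (y , y≉0) → x * y , *-nonZero x≉0 y≉0
      ; ε              = 1# , 1≉0
      ; _⁻¹            = λ (x , x≉0) → recip x≉0 , recip-nonZero x≉0
      ; isAbelianGroup = record
        { isGroup = record
          { isMonoid = record
            { isSemigroup = record
              { isMagma = record
                { isEquivalence = On.isEquivalence proj₁ ∼-isEquivalence
                ; ∙-cong        = *-cong-∼
                }
              ; assoc = λ _ _ _ → ≈⇒∼ (*-assoc _ _ _)
              }
            ; identity = (λ _ → ≈⇒∼ (*-identityˡ _)) , (λ _ → ≈⇒∼ (*-identityʳ _))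
            }
          ; inverse = (λ x → ≈⇒∼ (*-recipˡ (proj₂ x))) , (λ x → ≈⇒∼ (*-recipʳ (proj₂ x)))
          ; ⁻¹-cong = λ {x} {y} → recip-cong-∼ (proj₂ x) (proj₂ y)
          }
        ; comm = λ _ _ → ≈⇒∼ (*-comm _ _)
        }
      }
    ; _<_                = Γ._<_
    ; isStrictTotalOrder = Γ.isStrictTotalOrder
    ; ∙-monoˡ-<          = λ z → *-mono-≪ (proj₂ z)
    }
    where
    module Γ = StrictTotalOrder (rank em additiveGroup)
    recip-cong-∼ : ∀ {x y} (x≉0 : NonZero x) (y≉0 : NonZero y) → x ∼ y → recip x≉0 ∼ recip y≉0
    recip-cong-∼ {x} {y} x≉0 y≉0 x∼y =
      ∼-sym (∼-trans (≈⇒∼ eq₁) (∼-trans (*-cong-∼ x∼y ∼-refl) (≈⇒∼ eq₂)))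
      where
      x⁻¹ y⁻¹ : Carrier
      x⁻¹ = recip x≉0
      y⁻¹ = recip y≉0
      eq₁ : y⁻¹ ≈ x * (x⁻¹ * y⁻¹)
      eq₁ = sym (trans (sym (*-assoc _ _ _)) (trans (*-congʳ (*-recipʳ x≉0)) (*-identityˡ _)))
      eq₂ : y * (x⁻¹ * y⁻¹) ≈ x⁻¹
      eq₂ = trans (*-congˡ (*-comm _ _)) (trans (sym (*-assoc _ _ _))
              (trans (*-congʳ (*-recipʳ y≉0)) (*-identityˡ _)))

  private
    module G = OrderedAbelianGroup valueGroup
    v0 : G.Carrier ⁺
    v0 = [ G.ε ]
  open SupremumEquality G._≈_ using (_≈⁺_; [_])
  open SupremumNonStrict G._≤_ using (_≤⁺_; [_]; _≤⊤⁺)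
  open SupremumStrict G._<_ using (_<⁺_; [_]; [_]<⊤⁺)

  valuationRing maximalIdeal : Pred Carrier ℓ
  valuationRing a = v0 ≤⁺ v a
  maximalIdeal  a = v0 <⁺ v a

  valuationRing⇒bounded : ∀ {a} → a ∈ valuationRing → Bounded a
  valuationRing⇒bounded {a} p with a ≟ 0# | p
  ... | yes a≈0 | _                    = 0 , inj₂ (trans (∣∣-cong a≈0) (∣∣-nonneg ≤-refl))
  ... | no _    | [ inj₁ a≪1 ]         = 1 , inj₁ (<-respʳ-≈ (sym (×-homo-1 _)) (≪⇒∣∣<∣∣ a≪1))
  ... | no _    | [ inj₂ (n , q , _) ] = n , q

  bounded⇒valuationRing : ∀ {a} → Bounded a → a ∈ valuationRing
  bounded⇒valuationRing {a} (n , p) with a ≟ 0#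
  ... | yes _ = _ ≤⊤⁺
  ... | no a≉0 with ≪-compare em 1# a
  ...   | tri< a≪1 _ _ = [ inj₁ a≪1 ]
  ...   | tri≈ _ 1∼a _ = [ inj₂ 1∼a ]
  ...   | tri> _ _ 1≪a = contradiction p (<⇒≱ (1≪a n))

  maximalIdeal⇒infinitesimal : ∀ {a} → a ∈ maximalIdeal → Infinitesimal a
  maximalIdeal⇒infinitesimal {a} p with a ≟ 0# | p
  ... | yes a≈0 | _       = ≈0-infinitesimal a≈0
  ... | no _    | [ a≪1 ] = a≪1

  infinitesimal⇒maximalIdeal : ∀ {a} → Infinitesimal a → a ∈ maximalIdeal
  infinitesimal⇒maximalIdeal {a} a≪1 with a ≟ 0#
  ... | yes _ = [ _ ]<⊤⁺
  ... | no _  = [ a≪1 ]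

  -- The order of the quotient by a convex ideal: x̄ < ȳ iff x < y and x̄ ≠ ȳ.
  residueField : OrderedField ℓ
  residueField = record
    { orderedRing = record
      { commutativeRing    = record
        { Carrier             = Σ Carrier valuationRing
        ; _≈_                 = λ x y → proj₁ x + - proj₁ y ∈ maximalIdeal
        ; _+_                 = λ x y → proj₁ x + proj₁ y , lift₂ +-bounded x y
        ; _*_                 = λ x y → proj₁ x * proj₁ y , lift₂ *-bounded x y
        ; -_                  = λ x → - proj₁ x , in-R (neg-bounded (bd x))
        ; 0#                  = 0# , in-R 0-bounded
        ; 1#                  = 1# , in-R 1-bounded
        ; isCommutativeRing   = record
          { isRing = record
            { +-isAbelianGroup = record
              { isGroup = record
                { isMonoid = record
                  { isSemigroup = record
                    { isMagma = record
                      { isEquivalence = record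
                        { refl  = in-μ ≈ᵣ-refl
                        ; sym   = λ p → in-μ (≈ᵣ-sym (μ-in p))
                        ; trans = λ p q → in-μ (≈ᵣ-trans (μ-in p) (μ-in q))
                        }
                      ; ∙-cong = λ p q → in-μ (≈ᵣ-+-cong (μ-in p) (μ-in q))
                      }
                    ; assoc = λ _ _ _ → eq (+-assoc _ _ _)
                    }
                  ; identity = (λ _ → eq (+-identityˡ _)) , (λ _ → eq (+-identityʳ _))
                  }
                ; inverse = (λ _ → eq (-‿inverseˡ _)) , (λ _ → eq (-‿inverseʳ _))
                ; ⁻¹-cong = λ p → in-μ (≈ᵣ-neg-cong (μ-in p))
                }
              ; comm = λ _ _ → eq (+-comm _ _)
              }
            ; *-cong     = λ {x} {y} {u} {w} p q →
                             in-μ (≈ᵣ-*-cong (bd u) (bd y) (μ-in p) (μ-in q))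
            ; *-assoc    = λ _ _ _ → eq (*-assoc _ _ _)
            ; *-identity = (λ _ → eq (*-identityˡ _)) , (λ _ → eq (*-identityʳ _))
            ; distrib    = (λ _ _ _ → eq (distribˡ _ _ _)) , (λ _ _ _ → eq (distribʳ _ _ _))
            }
          ; *-comm = λ _ _ → eq (*-comm _ _)
          }
        }
      ; _<_                = λ x y → proj₁ x < proj₁ y × ¬ (proj₁ x + - proj₁ y ∈ maximalIdeal)
      ; isStrictTotalOrder = record
        { isStrictPartialOrder = record
          { isEquivalence = record
            { refl  = in-μ ≈ᵣ-refl
            ; sym   = λ p → in-μ (≈ᵣ-sym (μ-in p))
            ; trans = λ p q → in-μ (≈ᵣ-trans (μ-in p) (μ-in q))
            }
          ; irrefl   = λ p q → proj₂ q p
          ; trans    = λ p q → in-< (<ᵣ-trans (<-in p) (<-in q))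
          ; <-resp-≈ = (λ p q → in-< (<ᵣ-respʳ (μ-in p) (<-in q)))
                     , (λ p q → in-< (<ᵣ-respˡ (μ-in p) (<-in q)))
          }
        ; compare = λ x y → tri (<ᵣ-compare em (proj₁ x) (proj₁ y))
        }
      ; +-monoˡ-<          = λ z p → in-< (<ᵣ-+-monoˡ (proj₁ z) (<-in p))
      ; *-pos              = λ {x} {y} p q → in-< (<ᵣ-*-pos em (bd x) (bd y) (<-in p) (<-in q))
      ; 0<1                = 0<1 , λ p → ≪-irrefl (≈ᵣ0⇒infinitesimal (≈ᵣ-sym (μ-in p)))
      }
    ; invertible  = λ {x} x≉0 → invert x (λ i → x≉0 (in-μ (infinitesimal⇒≈ᵣ0 i)))
    }
    where
    in-R : ∀ {a} → Bounded a → a ∈ valuationRing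
    in-R = bounded⇒valuationRing
    bd : (x : Σ Carrier valuationRing) → Bounded (proj₁ x)
    bd x = valuationRing⇒bounded (proj₂ x)
    in-μ : ∀ {a} → Infinitesimal a → a ∈ maximalIdeal
    in-μ = infinitesimal⇒maximalIdeal
    μ-in : ∀ {a} → a ∈ maximalIdeal → Infinitesimal a
    μ-in = maximalIdeal⇒infinitesimal
    eq : ∀ {x y} → x ≈ y → x + - y ∈ maximalIdeal
    eq p = in-μ (≈⇒≈ᵣ p)
    lift₂ : ∀ {_⊛_ : Carrier → Carrier → Carrier} →
            (∀ {x y} → Bounded x → Bounded y → Bounded (x ⊛ y)) →
            ∀ (x y : Σ Carrier valuationRing) → proj₁ x ⊛ proj₁ y ∈ valuationRing
    lift₂ f x y = in-R (f (bd x) (bd y))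
    in-< : ∀ {x y} → x <ᵣ y → x < y × ¬ (x + - y ∈ maximalIdeal)
    in-< (p , q) = p , q ∘ μ-in
    <-in : ∀ {x y} → x < y × ¬ (x + - y ∈ maximalIdeal) → x <ᵣ y
    <-in (p , q) = p , q ∘ in-μ
    tri : ∀ {x y} → Tri (x <ᵣ y) (x ≈ᵣ y) (y <ᵣ x) →
          Tri (x < y × ¬ (x + - y ∈ maximalIdeal)) (x + - y ∈ maximalIdeal)
              (y < x × ¬ (y + - x ∈ maximalIdeal))
    tri (tri< a b c) = tri< (in-< a) (b ∘ μ-in) (c ∘ <-in)
    tri (tri≈ a b c) = tri≈ (a ∘ <-in) (in-μ b) (c ∘ <-in)
    tri (tri> a b c) = tri> (a ∘ <-in) (b ∘ μ-in) (in-< c)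
    invert : ∀ (x : Σ Carrier valuationRing) → ¬ Infinitesimal (proj₁ x) →
             ∃ λ (y : Σ Carrier valuationRing) → proj₁ x * proj₁ y + - 1# ∈ maximalIdeal
    invert (x , _) ¬i = (recip x≉0 , in-R (recip-bounded em x≉0 ¬i)) , eq (*-recipʳ x≉0)
      where
      x≉0 : NonZero x
      x≉0 = ¬i ∘ ≈0-infinitesimal

  positiveGroup : OrderedAbelianGroup ℓ
  positiveGroup = record
    { abelianGroup = record
      { Carrier        = Σ Carrier (0# <_)
      ; _≈_            = λ x y → proj₁ x ≈ proj₁ y
      ; _∙_            = λ (x , 0<x) (y , 0<y) → x * y , *-pos 0<x 0<y
      ; ε              = 1# , 0<1
      ; _⁻¹            = λ (x , 0<x) → recip (0<⇒nonZero 0<x) , recip-pos 0<x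
      ; isAbelianGroup = record
        { isGroup = record
          { isMonoid = record
            { isSemigroup = record
              { isMagma = record
                { isEquivalence = On.isEquivalence proj₁ isEquivalence
                ; ∙-cong        = *-cong
                }
              ; assoc = λ _ _ _ → *-assoc _ _ _
              }
            ; identity = (λ _ → *-identityˡ _) , (λ _ → *-identityʳ _)
            }
          ; inverse = (λ _ → *-recipˡ _) , (λ _ → *-recipʳ _)
          ; ⁻¹-cong = recip-cong _ _
          }
        ; comm = λ _ _ → *-comm _ _
        }
      }
    ; _<_                = λ x y → proj₁ x < proj₁ y
    ; isStrictTotalOrder = On.isStrictTotalOrder proj₁ isStrictTotalOrder
    ; ∙-monoˡ-<          = λ z → *-monoˡ-< (proj₂ z)
    }

  -- The group of positive units of the valuation ring, v a = 0.
  positiveUnits : Pred (OrderedAbelianGroup.Carrier positiveGroup) ℓ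
  positiveUnits a = v (proj₁ a) ≈⁺ v0

  record LeftExponentiation : Set (lsuc ℓ) where
    field
      A   : Complement additiveGroup valuationRing
      B   : Complement positiveGroup positiveUnits
      iso : Complement.orderedAbelianGroup A ≅ᵍ Complement.orderedAbelianGroup B

module Submission where

-- In the Peano model M = Z^{≥0} the function n ↦ 2ⁿ is definable, and every
-- y ≥ 1 of M lies within a factor 2 of a power 2ⁿ.  Through the integer part it
-- induces an order isomorphism x ↦ 2ˣ of K / R_v onto K^{>0} modulo positive
-- units, which is left exponentiation once complements A and B are chosen.
-- Composed with the valuation it turns the value group into a copy of A with
-- the order reversed, so that natural valuation theory of the value group is
-- that of K above R_v: classes of A are the negative values, and dividing by
-- a fixed element embeds an Archimedean subgroup into the residue field, onto
-- it when the subgroup is maximal.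

-- The language of `M` has no exponentiation, and in a nonstandard `M` boundedness by a standard
-- number is not definable. So the graph of 2ⁿ is given by an explicit formula, for which totality,
-- the sum law and the covering of `M` by intervals from 2ⁿ to 2ⁿ⁺¹ are inductions inside `M`,
-- whereas boundedness of 2ⁿ for bounded n is an induction over the standard naturals. This fact and
-- n < 2ⁿ are what ties exponentiation to Archimedean classes: together they say that 2ˣ is a unit
-- up to bounded factors exactly when x is bounded. No exponential function on K is formed. Rounding
-- x to an integer and y to a power of two determines x only modulo R_v and y only modulo units, so
-- a relation compatible with both is used, and complements turn it into a map. Both complements are
-- maximal subgroups that meet a given pure subgroup trivially; divisibility makes them span, and
-- for K^{>0} divisibility is the existence of n-th roots of positive elements in a real closed
-- field.

open import Defs
import Algebra.Properties.AbelianGroup as AbelianGroupProperties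
import Algebra.Properties.CommutativeMonoid.Mult as CommutativeMonoidMultiplication
import Algebra.Properties.CommutativeSemigroup as CommutativeSemigroupProperties
import Algebra.Properties.Monoid.Mult as MonoidMultiplication
import Algebra.Properties.Ring as RingProperties
import Algebra.Properties.Semiring.Mult as SemiringMultiplication
import Algebra.Solver.Ring as RingSolver
open import Algebra.Bundles using (CommutativeRing; RawRing)
open import Algebra.Solver.Ring.AlmostCommutativeRing
  using (fromCommutativeRing; _-Raw-AlmostCommutative⟶_; Induced-equivalence)
open import Axiom.ExcludedMiddle using (ExcludedMiddle)
open import Data.Bool using (Bool; true; false)
open import Data.Fin using (Fin; zero; suc)
open import Data.Integer using (+_; -[1+_])
open import Data.Maybe.Base using (Maybe; just; nothing)
open import Data.Nat as ℕ using (ℕ; zero; suc)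
open import Data.Nat.Induction using (<-rec)
import Data.Nat.Properties as ℕₚ
open import Data.Product using (Σ; ∃; ∃₂; _×_; _,_; proj₁; proj₂)
open import Data.Rational using (ℚ; ↥_)
open import Data.Sum using (_⊎_; inj₁; inj₂)
open import Data.Vec using (Vec; []; _∷_; last)
open import Function using (_∘_)
open import Level using (Level)
open import Relation.Binary using (Rel; Tri; tri<; tri≈; tri>)
import Relation.Binary.Construct.Add.Supremum.Equality as SupremumEquality
open import Relation.Binary.PropositionalEquality as ≡ using (_≡_)
open import Relation.Nullary using (¬_; yes; no; contradiction)
open import Relation.Unary using (Pred; _∈_; _⊆_)

-- Ring identities with integer coefficients.

-- A pair (a , b) of naturals is the coefficient a - b, so that the
-- normaliser decides equality of coefficients in every ring.
module DifferenceSolver {c ℓ} (R : CommutativeRing c ℓ) where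
  open CommutativeRing R
  open RingProperties ring using (-‿distribˡ-*; -‿distribʳ-*)
  open AbelianGroupProperties +-abelianGroup using (⁻¹-∙-comm; ⁻¹-involutive; ε⁻¹≈ε)
  open CommutativeSemigroupProperties +-commutativeSemigroup using (interchange)
  open SemiringMultiplication semiring renaming (_×_ to _×ₙ_)
  open import Relation.Binary.Reasoning.Setoid setoid

  private
    -- Cancelling common successors leaves at most one non-zero component, so a vanishing
    -- coefficient becomes literally `(0 , 0)`.
    reduce : ℕ → ℕ → ℕ × ℕ
    reduce (suc a) (suc b) = reduce a b
    reduce a       b       = a , b

    differences : RawRing _ _
    differences = record
      { Carrier = ℕ × ℕ
      ; _≈_     = _≡_
      ; _+_     = λ (a , b) (a′ , b′) → reduce (a ℕ.+ a′) (b ℕ.+ b′)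
      ; _*_     = λ (a , b) (a′ , b′) →
                  reduce (a ℕ.* a′ ℕ.+ b ℕ.* b′) (a ℕ.* b′ ℕ.+ b ℕ.* a′)
      ; -_      = λ (a , b) → b , a
      ; 0#      = 0 , 0
      ; 1#      = 1 , 0
      }

    nat : ℕ → Carrier
    nat n = n ×ₙ 1#

    -- 0# and 1# themselves are values, so that they can be used in goals.
    ⟦_⟧ᵈ : ℕ × ℕ → Carrier
    ⟦ 0 , 0 ⟧ᵈ = 0#
    ⟦ 1 , 0 ⟧ᵈ = 1#
    ⟦ a , b ⟧ᵈ = nat a + - nat b

    ⟦⟧≈ : ∀ p → ⟦ p ⟧ᵈ ≈ nat (proj₁ p) + - nat (proj₂ p)
    ⟦⟧≈ (0 , 0)           = sym (trans (+-congˡ ε⁻¹≈ε) (+-identityˡ _))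
    ⟦⟧≈ (1 , 0)           = sym (trans (+-congˡ ε⁻¹≈ε) (trans (+-identityʳ _) (+-identityʳ _)))
    ⟦⟧≈ (suc (suc _) , 0) = refl
    ⟦⟧≈ (0 , suc _)       = refl
    ⟦⟧≈ (1 , suc _)       = refl
    ⟦⟧≈ (suc (suc _) , suc _) = refl

    +-minus : ∀ x y z w → (x + z) + - (y + w) ≈ (x + - y) + (z + - w)
    +-minus x y z w = trans (+-congˡ (sym (⁻¹-∙-comm y w))) (interchange x z (- y) (- w))

    *-minus : ∀ x y z w → (x * z + y * w) + - (x * w + y * z) ≈ (x + - y) * (z + - w)
    *-minus x y z w = begin
      (x * z + y * w) + - (x * w + y * z)           ≈⟨ +-congˡ (⁻¹-∙-comm _ _) ⟨
      (x * z + y * w) + (- (x * w) + - (y * z))     ≈⟨ +-congˡ (+-comm _ _) ⟩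
      (x * z + y * w) + (- (y * z) + - (x * w))     ≈⟨ interchange _ _ _ _ ⟩
      (x * z + - (y * z)) + (y * w + - (x * w))     ≈⟨ +-cong
        (trans (+-congˡ (-‿distribˡ-* y z)) (sym (distribʳ z x (- y))))
        (trans (+-comm _ _) (trans (+-congˡ (sym (⁻¹-involutive _)))
          (trans (⁻¹-∙-comm _ _) (-‿cong
            (trans (+-congˡ (-‿distribˡ-* y w)) (sym (distribʳ w x (- y)))))))) ⟩
      (x + - y) * z + - ((x + - y) * w)             ≈⟨ +-congˡ (-‿distribʳ-* _ w) ⟩
      (x + - y) * z + (x + - y) * - w               ≈⟨ distribˡ _ z (- w) ⟨
      (x + - y) * (z + - w)                         ∎

    nat-reduce : ∀ a b → nat (proj₁ (reduce a b)) + - nat (proj₂ (reduce a b)) ≈ nat a + - nat b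
    nat-reduce zero    b       = refl
    nat-reduce (suc a) zero    = refl
    nat-reduce (suc a) (suc b) = trans (nat-reduce a b) (sym (trans (+-minus 1# 1# (nat a) (nat b))
      (trans (+-congʳ (-‿inverseʳ 1#)) (+-identityˡ _))))

    nat-*+* : ∀ a b c d → nat (a ℕ.* b ℕ.+ c ℕ.* d) ≈ nat a * nat b + nat c * nat d
    nat-*+* a b c d = trans (×-homo-+ 1# (a ℕ.* b) (c ℕ.* d))
      (+-cong (×1-homo-* a b) (×1-homo-* c d))

    homomorphism : differences -Raw-AlmostCommutative⟶ fromCommutativeRing R
    homomorphism = record
      { ⟦_⟧    = ⟦_⟧ᵈ
      ; +-homo = λ p@(a , b) q@(a′ , b′) → via (p +ᵈ q) (trans (nat-reduce (a ℕ.+ a′) (b ℕ.+ b′)) (trans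
          (+-cong (×-homo-+ 1# a a′) (-‿cong (×-homo-+ 1# b b′)))
          (trans (+-minus _ _ _ _) (sym (+-cong (⟦⟧≈ p) (⟦⟧≈ q))))))
      ; *-homo = λ p@(a , b) q@(a′ , b′) → via (p *ᵈ q) (trans (nat-reduce (a ℕ.* a′ ℕ.+ b ℕ.* b′) (a ℕ.* b′ ℕ.+ b ℕ.* a′)) (trans
          (+-cong (nat-*+* a a′ b b′) (-‿cong (nat-*+* a b′ b a′)))
          (trans (*-minus _ _ _ _) (sym (*-cong (⟦⟧≈ p) (⟦⟧≈ q))))))
      ; -‿homo = λ p@(a , b) → via (b , a) (trans (+-comm _ _)
          (trans (+-congˡ (sym (⁻¹-involutive _)))
            (trans (⁻¹-∙-comm _ _) (-‿cong (sym (⟦⟧≈ p))))))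
      ; 0-homo = refl
      ; 1-homo = refl
      }
      where
      open RawRing differences using () renaming (_+_ to _+ᵈ_; _*_ to _*ᵈ_)
      via : ∀ p {x} → nat (proj₁ p) + - nat (proj₂ p) ≈ x → ⟦ p ⟧ᵈ ≈ x
      via p = trans (⟦⟧≈ p)

    coeff≟ : ∀ p q → Maybe (Induced-equivalence homomorphism p q)
    coeff≟ (a , b) (a′ , b′) with a ℕ.+ b′ ℕ.≟ a′ ℕ.+ b
    ... | no  _  = nothing
    ... | yes eq = just (trans (⟦⟧≈ (a , b)) (trans (begin
      nat a + - nat b                          ≈⟨ +-identityʳ _ ⟨
      (nat a + - nat b) + 0#                   ≈⟨ +-congˡ (-‿inverseʳ _) ⟨
      (nat a + - nat b) + (nat b′ + - nat b′)  ≈⟨ +-minus _ _ _ _ ⟨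
      (nat a + nat b′) + - (nat b + nat b′)    ≈⟨ +-cong
        (trans (sym (×-homo-+ 1# a b′)) (trans (reflexive (≡.cong nat eq)) (×-homo-+ 1# a′ b)))
        (-‿cong (+-comm _ _)) ⟩
      (nat a′ + nat b) + - (nat b′ + nat b)    ≈⟨ +-minus _ _ _ _ ⟩
      (nat a′ + - nat b′) + (nat b + - nat b)  ≈⟨ +-congˡ (-‿inverseʳ _) ⟩
      (nat a′ + - nat b′) + 0#                 ≈⟨ +-identityʳ _ ⟩
      nat a′ + - nat b′                        ∎) (sym (⟦⟧≈ (a′ , b′)))))

  open RingSolver differences (fromCommutativeRing R) homomorphism coeff≟ public

  :0 :1 : ∀ {n} → Polynomial n
  :0 = con (0 , 0)
  :1 = con (1 , 0)

-- Inequalities in ordered and discretely ordered rings.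

module OrderedRingLemmas {ℓ} (R : OrderedRing ℓ) where
  open OrderedRing R hiding (zero)
  open OrderedRingProperties R
  open DifferenceSolver commutativeRing using (solve; _:=_; _:+_; :1)
  open AbelianGroupProperties +-abelianGroup using (∙-cancelʳ)

  ≤-antisym : ∀ {x y} → x ≤ y → y ≤ x → x ≈ y
  ≤-antisym (inj₁ p) q = contradiction q (<⇒≱ p)
  ≤-antisym (inj₂ p) _ = p

  pos-cancelˡ : ∀ {x y} → 0# < x → 0# < x * y → 0# < y
  pos-cancelˡ {x} {y} 0<x 0<xy with compare y 0#
  ... | tri> _ _ p = p
  ... | tri≈ _ p _ = contradiction 0<xy (irrefl (sym (trans (*-congˡ p) (zeroʳ x))))
  ... | tri< p _ _ = contradiction (*-monoʳ-≤ (inj₁ 0<x) (inj₁ p))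
                       (<⇒≱ (<-respˡ-≈ (sym (zeroʳ x)) 0<xy))

  *-cancelˡ : ∀ {x y z} → 0# < x → x * y ≈ x * z → y ≈ z
  *-cancelˡ {x} {y} {z} 0<x xy≈xz with compare y z
  ... | tri< p _ _ = contradiction (*-monoˡ-< 0<x p)
                       (irrefl (trans (*-comm _ _) (trans xy≈xz (*-comm _ _))))
  ... | tri≈ _ p _ = p
  ... | tri> _ _ p = contradiction (*-monoˡ-< 0<x p)
                       (irrefl (trans (*-comm _ _) (trans (sym xy≈xz) (*-comm _ _))))

  -- An equation l ≈ r, multiplied by t, turns x ≈ y into an identity.
  by-multiple : ∀ t {l r x y} → l ≈ r → x + t * r ≈ y + t * l → x ≈ y
  by-multiple t {l} {r} {x} {y} l≈r eq =
    ∙-cancelʳ (t * r) x y (trans eq (+-congˡ (*-congˡ l≈r)))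

  ≰⇒> : ∀ {x y} → ¬ y ≤ x → x < y
  ≰⇒> {x} {y} y≰x with compare x y
  ... | tri< p _ _ = p
  ... | tri≈ _ p _ = contradiction (inj₂ (sym p)) y≰x
  ... | tri> _ _ p = contradiction (inj₁ p) y≰x

  +1≤⇒< : ∀ {x y} → x + 1# ≤ y → x < y
  +1≤⇒< {x} p = <-≤-trans (<-respˡ-≈ (+-identityʳ x) (∙-monoʳ-< x 0<1)) p

  x<x+1 : ∀ x → x < x + 1#
  x<x+1 x = +1≤⇒< ≤-refl

  module Discrete (isDiscrete : IsDiscrete R) where

    0<⇒1≤ : ∀ {x} → 0# < x → 1# ≤ x
    0<⇒1≤ {x} 0<x = ≮⇒≥ (λ x<1 → isDiscrete x (0<x , x<1))

    <⇒+1≤ : ∀ {x y} → x < y → x + 1# ≤ y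
    <⇒+1≤ {x} {y} x<y = begin
      x + 1#         ≈⟨ +-comm x 1# ⟩
      1# + x         ≤⟨ ∙-monoˡ-≤ x (0<⇒1≤ (x<y⇒0<y-x x<y)) ⟩
      (y + - x) + x  ≈⟨ -+-cancel x y ⟩
      y              ∎

    <+1⇒≤ : ∀ {x y} → x < y + 1# → x ≤ y
    <+1⇒≤ {x} {y} x<y+1 = ≮⇒≥ (λ y<x → <⇒≱ x<y+1 (<⇒+1≤ y<x))

    -- A positive cofactor is at least 1 by discreteness; this is how divisibility is turned into
    -- inequalities below.
    *-≥ : ∀ {m u} → 0# < m → 0# < m * u → m ≤ m * u
    *-≥ {m} {u} 0<m 0<mu = begin
      m       ≈⟨ *-identityʳ m ⟨
      m * 1#  ≤⟨ *-monoʳ-≤ (inj₁ 0<m) (0<⇒1≤ (pos-cancelˡ 0<m 0<mu)) ⟩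
      m * u   ∎

    even≉odd : ∀ {x y} → ¬ x + x ≈ y + y + 1#
    even≉odd {x} {y} eq with compare y x
    ... | tri< y<x _ _ = irrefl (sym eq) (begin-strict
            y + y + 1#    <⟨ x<x+1 _ ⟩
            y + y + 1# + 1#  ≈⟨ solve 1 (λ y → y :+ y :+ :1 :+ :1 := (y :+ :1) :+ (y :+ :1)) refl y ⟩
            (y + 1#) + (y + 1#) ≤⟨ ∙-mono-≤ (<⇒+1≤ y<x) (<⇒+1≤ y<x) ⟩
            x + x         ∎)
    ... | tri≈ _ y≈x _ = irrefl (trans (+-cong y≈x y≈x) eq) (x<x+1 _)
    ... | tri> _ _ x<y = irrefl eq (begin-strict
            x + x         ≤⟨ ∙-mono-≤ (inj₁ x<y) (inj₁ x<y) ⟩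
            y + y         <⟨ x<x+1 _ ⟩
            y + y + 1#    ∎)

-- Definability of 2ⁿ in a model of Peano Arithmetic.

-- 2ⁿ is defined by way of qⁿ for all large powers of two q: with m = q - 1
-- and k = q - 2, n and 2ⁿ are the remainders of (qⁿ - 1) / m modulo m
-- and of qⁿ modulo k.
module PeanoExponential {ℓ} (R : OrderedRing ℓ) (pa : ConeModelsPA R) where
  open OrderedRing R hiding (zero)
  open OrderedRingProperties R
  open OrderedRingLemmas R
  open ConeModelsPA pa
  open Discrete isDiscrete
  open DifferenceSolver commutativeRing using (solve; _:=_; _:+_; _:*_; :-_; :1; :0)
  open Structure (nonNegativeCone R) public
    using () renaming (Carrier to M; _+_ to _+ᴹ_; _*_ to _*ᴹ_; 0# to 0ᴹ; 1# to 1ᴹ)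

  private
    v0 : ∀ {n} → Term (1 ℕ.+ n)
    v0 = var zero
    v1 : ∀ {n} → Term (2 ℕ.+ n)
    v1 = var (suc zero)
    v2 : ∀ {n} → Term (3 ℕ.+ n)
    v2 = var (suc (suc zero))

  -- Powers of two and their divisibility.

  halve : ∀ (x : M) → ∃ λ (h : M) → proj₁ x ≈ proj₁ h + proj₁ h ⊎ proj₁ x ≈ proj₁ h + proj₁ h + 1#
  halve = induction (`∃ ((v1 `≈ v0 `+ v0) `∨ (v1 `≈ v0 `+ v0 `+ `1))) []
    (0ᴹ , inj₁ (sym (+-identityˡ 0#)))
    λ { x (h , inj₁ x≈2h)   → h , inj₂ (+-congʳ x≈2h)
      ; x (h , inj₂ x≈2h+1) → h +ᴹ 1ᴹ , inj₁ (trans (+-congʳ x≈2h+1)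
          (solve 1 (λ h → h :+ h :+ :1 :+ :1 := (h :+ :1) :+ (h :+ :1)) refl (proj₁ h))) }

  -- Exponentiation is not yet available, so powers of two are singled out by their divisors: none
  -- but 1 is odd.
  PowerOfTwo : M → Set ℓ
  PowerOfTwo p = 0# < proj₁ p ×
    (∀ (d e : M) → proj₁ p ≈ proj₁ d * proj₁ e →
     proj₁ d ≈ 1# ⊎ ∃ λ (h : M) → proj₁ d ≈ proj₁ h + proj₁ h)

  -- The interpretation of this formula unfolds to `PowerOfTwo`, so `induction` applies directly to
  -- statements about the predicate. `code` and `exp` mirror `Code` and `Exp` in the same way.
  powerOfTwo : ∀ {n} → Fin n → Formula n
  powerOfTwo i = `0 `< var i `∧ `∀ (`∀ (var (suc (suc i)) `≈ v1 `* v0 `⇒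
    (v1 `≈ `1) `∨ `∃ (v2 `≈ v0 `+ v0)))

  powerOfTwo-resp : ∀ {p p′ : M} → proj₁ p ≈ proj₁ p′ → PowerOfTwo p → PowerOfTwo p′
  powerOfTwo-resp p≈p′ (0<p , f) = <-respʳ-≈ p≈p′ 0<p , λ d e eq → f d e (trans p≈p′ eq)

  powerOfTwo-1 : PowerOfTwo 1ᴹ
  powerOfTwo-1 = 0<1 , λ (d , 0≤d) (e , 0≤e) 1≈de → inj₁ (≤-antisym
    (begin
      d       ≈⟨ *-identityʳ d ⟨
      d * 1#  ≤⟨ *-monoʳ-≤ 0≤d (0<⇒1≤ (factor-pos 0≤e (trans 1≈de (*-comm d e)))) ⟩
      d * e   ≈⟨ 1≈de ⟨
      1#      ∎)
    (0<⇒1≤ (factor-pos 0≤d 1≈de)))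
    where
    factor-pos : ∀ {x y} → 0# ≤ x → 1# ≈ x * y → 0# < x
    factor-pos (inj₁ 0<x) _ = 0<x
    factor-pos (inj₂ 0≈x) 1≈xy = contradiction
      (trans 1≈xy (trans (*-congʳ (sym 0≈x)) (zeroˡ _))) 1≉0

  powerOfTwo-half : ∀ {p : M} → PowerOfTwo p →
    proj₁ p ≈ 1# ⊎ ∃ λ (h : M) → proj₁ p ≈ proj₁ h + proj₁ h × PowerOfTwo h
  powerOfTwo-half {p} (0<p , f) with f p 1ᴹ (sym (*-identityʳ _))
  ... | inj₁ p≈1 = inj₁ p≈1
  ... | inj₂ (h@(h₁ , 0≤h) , p≈2h) = inj₂ (h , p≈2h , 0<h 0≤h , λ d (e , 0≤e) h≈de →
      f d (e + e , +-nonneg 0≤e 0≤e) (trans p≈2h (trans (+-cong h≈de h≈de) (sym (distribˡ _ e e)))))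
    where
    0<h : 0# ≤ h₁ → 0# < h₁
    0<h (inj₁ q) = q
    0<h (inj₂ q) = contradiction 0<p (irrefl (sym (trans p≈2h
      (trans (+-cong (sym q) (sym q)) (+-identityˡ 0#)))))

  -- A product of odd factors is odd, so an odd divisor d of 2p has an even cofactor; hence d
  -- divides p already.
  powerOfTwo-double : ∀ {p : M} → PowerOfTwo p → PowerOfTwo (p +ᴹ p)
  powerOfTwo-double {p} (0<p , f) =
    (begin-strict
      0#                 ≈⟨ +-identityˡ 0# ⟨
      0# + 0#            <⟨ ∙-mono-<-≤ 0<p (inj₁ 0<p) ⟩
      proj₁ p + proj₁ p  ∎) , λ d e eq → even d e eq (halve d) (halve e)
    where
    even : ∀ d e → proj₁ p + proj₁ p ≈ proj₁ d * proj₁ e →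
           (∃ λ (h : M) → proj₁ d ≈ proj₁ h + proj₁ h ⊎ proj₁ d ≈ proj₁ h + proj₁ h + 1#) →
           (∃ λ (h : M) → proj₁ e ≈ proj₁ h + proj₁ h ⊎ proj₁ e ≈ proj₁ h + proj₁ h + 1#) →
           proj₁ d ≈ 1# ⊎ ∃ λ (h : M) → proj₁ d ≈ proj₁ h + proj₁ h
    even d e eq (g , inj₁ d≈2g) _ = inj₂ (g , d≈2g)
    even d e eq (g , inj₂ d≈2g+1) (h , inj₂ e≈2h+1) = contradiction
      (trans eq (trans (*-cong d≈2g+1 e≈2h+1)
        (solve 2 (λ g h → (g :+ g :+ :1) :* (h :+ h :+ :1) :=
                          (g :* h :+ g :* h :+ g :+ h) :+ (g :* h :+ g :* h :+ g :+ h) :+ :1)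
               refl (proj₁ g) (proj₁ h))))
      even≉odd
    even d e eq (g , inj₂ d≈2g+1) (h , inj₁ e≈2h) = f d h
      (≤-antisym (≮⇒≥ λ dh<p → irrefl (sym 2dh≈2p) (∙-mono-<-≤ dh<p (inj₁ dh<p)))
                 (≮⇒≥ λ p<dh → irrefl 2dh≈2p (∙-mono-<-≤ p<dh (inj₁ p<dh))))
      where
      2dh≈2p : proj₁ p + proj₁ p ≈ proj₁ d * proj₁ h + proj₁ d * proj₁ h
      2dh≈2p = trans eq (trans (*-congˡ e≈2h) (distribˡ _ _ _))

  powerOfTwo-factor : ∀ {p d e : M} → PowerOfTwo p → proj₁ p ≈ proj₁ d * proj₁ e → PowerOfTwo e
  powerOfTwo-factor {p} {d} {e , 0≤e} (0<p , f) p≈de = 0<e 0≤e , λ a b e≈ab →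
    f a (d *ᴹ b) (trans p≈de (trans (*-congˡ e≈ab)
      (solve 3 (λ d a b → d :* (a :* b) := a :* (d :* b)) refl (proj₁ d) (proj₁ a) (proj₁ b))))
    where
    0<e : 0# ≤ e → 0# < e
    0<e (inj₁ q) = q
    0<e (inj₂ q) = contradiction 0<p
      (irrefl (sym (trans p≈de (trans (*-congˡ (sym q)) (zeroʳ _)))))

  -- Halving p reduces both the product and the division to a smaller power. The bound b makes plain
  -- induction on b a course-of-values induction on p, and p′ stays quantified because the division
  -- halves it as well.
  powerOfTwo-×-÷ : ∀ (b p : M) → proj₁ p < proj₁ b → PowerOfTwo p →
    ∀ (p′ : M) → PowerOfTwo p′ →
    (∃ λ (z : M) → proj₁ z ≈ proj₁ p * proj₁ p′ × PowerOfTwo z) ×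
    (proj₁ p′ < proj₁ p ⊎ ∃ λ (r : M) → proj₁ p′ ≈ proj₁ p * proj₁ r)
  powerOfTwo-×-÷ = induction
    (`∀ ((v0 `< v1) `⇒ powerOfTwo zero `⇒ `∀ (powerOfTwo zero `⇒
      `∃ ((v0 `≈ v2 `* v1) `∧ powerOfTwo zero) `∧
      ((v0 `< v1) `∨ `∃ (v1 `≈ v2 `* v0))))) []
    (λ p p<0 → contradiction (proj₂ p) (<⇒≱ p<0))
    λ b ih p p<b+1 P p′ P′ → step b ih p p<b+1 (powerOfTwo-half {p} P) p′ P′
    where
    half-< : ∀ (h b : M) {p} → p ≈ proj₁ h + proj₁ h → PowerOfTwo h → p < proj₁ b + 1# →
             proj₁ h < proj₁ b
    half-< h b {p} p≈2h H p<b+1 = begin-strict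
      proj₁ h            ≈⟨ +-identityˡ _ ⟨
      0# + proj₁ h       <⟨ +-monoˡ-< _ (proj₁ H) ⟩
      proj₁ h + proj₁ h  ≈⟨ p≈2h ⟨
      p                  ≤⟨ <+1⇒≤ p<b+1 ⟩
      proj₁ b            ∎
    step : ∀ (b : M) → (∀ (p : M) → proj₁ p < proj₁ b → PowerOfTwo p →
      ∀ (p′ : M) → PowerOfTwo p′ →
      (∃ λ (z : M) → proj₁ z ≈ proj₁ p * proj₁ p′ × PowerOfTwo z) ×
      (proj₁ p′ < proj₁ p ⊎ ∃ λ (r : M) → proj₁ p′ ≈ proj₁ p * proj₁ r)) →
      ∀ (p : M) → proj₁ p < proj₁ b + 1# →
      (proj₁ p ≈ 1# ⊎ ∃ λ (h : M) → proj₁ p ≈ proj₁ h + proj₁ h × PowerOfTwo h) →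
      ∀ (p′ : M) → PowerOfTwo p′ →
      (∃ λ (z : M) → proj₁ z ≈ proj₁ p * proj₁ p′ × PowerOfTwo z) ×
      (proj₁ p′ < proj₁ p ⊎ ∃ λ (r : M) → proj₁ p′ ≈ proj₁ p * proj₁ r)
    step b ih p _ (inj₁ p≈1) p′ P′ = (p′ , p′≈pp′ , P′) , inj₂ (p′ , p′≈pp′)
      where
      p′≈pp′ : proj₁ p′ ≈ proj₁ p * proj₁ p′
      p′≈pp′ = sym (trans (*-congʳ p≈1) (*-identityˡ _))
    step b ih p p<b+1 (inj₂ (h , p≈2h , H)) p′ P′ with ih h (half-< h b p≈2h H p<b+1) H p′ P′ | powerOfTwo-half {p′} P′
    ... | ((z , z≈hp′ , Z) , _) | half =
      (z +ᴹ z , trans (+-cong z≈hp′ z≈hp′) (sym (trans (*-congʳ p≈2h) (distribʳ _ _ _)))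
              , powerOfTwo-double {z} Z) , divides half
      where
      divides : (proj₁ p′ ≈ 1# ⊎ ∃ λ (h : M) → proj₁ p′ ≈ proj₁ h + proj₁ h × PowerOfTwo h) →
                proj₁ p′ < proj₁ p ⊎ ∃ λ (r : M) → proj₁ p′ ≈ proj₁ p * proj₁ r
      divides (inj₁ p′≈1) = inj₁ (begin-strict
        proj₁ p′           ≈⟨ p′≈1 ⟩
        1#                 <⟨ x<x+1 1# ⟩
        1# + 1#            ≤⟨ ∙-mono-≤ (0<⇒1≤ (proj₁ H)) (0<⇒1≤ (proj₁ H)) ⟩
        proj₁ h + proj₁ h  ≈⟨ p≈2h ⟨
        proj₁ p            ∎)
      divides (inj₂ (g , p′≈2g , G)) with proj₂ (ih h (half-< h b p≈2h H p<b+1) H g G)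
      ... | inj₁ g<h = inj₁ (<-respˡ-≈ (sym p′≈2g) (<-respʳ-≈ (sym p≈2h) (∙-mono-<-≤ g<h (inj₁ g<h))))
      ... | inj₂ (r , g≈hr) = inj₂ (r , trans p′≈2g (trans (+-cong g≈hr g≈hr)
              (trans (sym (distribʳ _ _ _)) (*-congʳ (sym p≈2h)))))

  powerOfTwo-* : ∀ {p p′ : M} → PowerOfTwo p → PowerOfTwo p′ → PowerOfTwo (p *ᴹ p′)
  powerOfTwo-* {p} {p′} P P′ with proj₁ (powerOfTwo-×-÷ (p +ᴹ 1ᴹ) p (x<x+1 _) P p′ P′)
  ... | z , z≈pp′ , Z = powerOfTwo-resp {z} {p *ᴹ p′} z≈pp′ Z

  powerOfTwo-∣ : ∀ {p p′ : M} → PowerOfTwo p → PowerOfTwo p′ → proj₁ p < proj₁ p′ →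
    ∃ λ (r : M) → proj₁ p′ ≈ proj₁ p * proj₁ r × PowerOfTwo r
  powerOfTwo-∣ {p} {p′} P P′ p<p′ with proj₂ (powerOfTwo-×-÷ (p +ᴹ 1ᴹ) p (x<x+1 _) P p′ P′)
  ... | inj₁ p′<p = contradiction p′<p (asym p<p′)
  ... | inj₂ (r , p′≈pr) = r , p′≈pr , powerOfTwo-factor {p′} {p} {r} P′ p′≈pr

  powerOfTwo-unbounded : ∀ (x : M) → ∃ λ (q : M) → PowerOfTwo q × proj₁ x < proj₁ q
  powerOfTwo-unbounded = induction (`∃ (powerOfTwo zero `∧ (v1 `< v0))) []
    (1ᴹ , powerOfTwo-1 , 0<1)
    λ x (q , Q , x<q) → q +ᴹ q , powerOfTwo-double {q} Q , (begin-strict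
      proj₁ x + 1#       <⟨ +-monoˡ-< 1# x<q ⟩
      proj₁ q + 1#       ≤⟨ ∙-monoʳ-≤ (proj₁ q) (0<⇒1≤ (proj₁ Q)) ⟩
      proj₁ q + proj₁ q  ∎)

  -- The code of 2ⁿ and its uniqueness.

  -- The last clause bounds P = qⁿ by the first power q^m after 1 that is 1
  -- modulo m², up to which the remainders n are distinct.
  Code : (k p n P : M) → Set ℓ
  Code k p n P = PowerOfTwo P ×
    (∃ λ (c : M) → proj₁ P ≈ 1# + proj₁ n * m + proj₁ c * (m * m)) ×
    (∃ λ (d : M) → proj₁ P ≈ proj₁ p + proj₁ d * proj₁ k) ×
    (∀ (R s : M) → PowerOfTwo R → proj₁ R ≈ 1# + proj₁ s * (m * m) →
     proj₁ R ≈ 1# ⊎ proj₁ P < proj₁ R)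
    where
    m : Carrier
    m = proj₁ k + 1#

  code : ∀ {l} (k p n P : Fin l) → Formula l
  code k p n P = powerOfTwo P `∧
    `∃ (var (suc P) `≈ `1 `+ var (suc n) `* m (suc k) `+ v0 `* (m (suc k) `* m (suc k))) `∧
    `∃ (var (suc P) `≈ var (suc p) `+ v0 `* var (suc k)) `∧
    `∀ (`∀ (powerOfTwo (suc zero) `⇒
      v1 `≈ `1 `+ v0 `* (m (suc (suc k)) `* m (suc (suc k))) `⇒
      (v1 `≈ `1) `∨ (var (suc (suc P)) `< v1)))
    where
    m : ∀ {n} → Fin n → Term n
    m k = var k `+ `1

  opaque
    -- Exp p n says that p = 2ⁿ.
    Exp : (p n : M) → Set ℓ
    Exp p n = ∀ (k q : M) → PowerOfTwo q → proj₁ q ≈ proj₁ k + 1# + 1# →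
      proj₁ p + proj₁ n < proj₁ k → ∃ λ (P : M) → Code k p n P

  exp : ∀ {l} (p n : Fin l) → Formula l
  exp p n = `∀ (`∀ (powerOfTwo zero `⇒ v0 `≈ v1 `+ `1 `+ `1 `⇒
    var (suc (suc p)) `+ var (suc (suc n)) `< v1 `⇒
    `∃ (code (suc (suc zero)) (suc (suc (suc p))) (suc (suc (suc n))) zero)))

  opaque
    unfolding Exp
    exp-resp : ∀ {p p′ n n′ : M} → proj₁ p ≈ proj₁ p′ → proj₁ n ≈ proj₁ n′ → Exp p n → Exp p′ n′
    exp-resp p≈p′ n≈n′ E k q Q q≈k+2 p+n<k with E k q Q q≈k+2 (<-respˡ-≈ (sym (+-cong p≈p′ n≈n′)) p+n<k)
    ... | P , P2 , (c , eqc) , (d , eqd) , small =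
      P , P2 , (c , trans eqc (+-congʳ (+-congˡ (*-congʳ n≈n′)))) , (d , trans eqd (+-congʳ p≈p′)) , small

  module _ (k : M) where
    private
      m : Carrier
      m = proj₁ k + 1#
      0<m : 0# < m
      0<m = ≤-<-trans (proj₂ k) (x<x+1 _)

    -- If y < x, then x - y would be a positive multiple of k and so at least k, although x - y ≤ x
    -- < k.
    remainder-unique : ∀ {x y d e} → x < proj₁ k → 0# ≤ y → x + d * proj₁ k ≈ y + e * proj₁ k → ¬ y < x
    remainder-unique {x} {y} {d} {e} x<k 0≤y eq y<x = <⇒≱ x<k (begin
      proj₁ k            ≤⟨ *-≥ 0<k (<-respʳ-≈ x-y≈ku (x<y⇒0<y-x y<x)) ⟩
      proj₁ k * (e + - d)  ≈⟨ x-y≈ku ⟨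
      x + - y            ≤⟨ ∙-monoʳ-≤ x (≤-trans (neg-≤ 0≤y) (inj₂ -0≈0)) ⟩
      x + 0#             ≈⟨ +-identityʳ x ⟩
      x                  ∎)
      where
      neg-≤ : ∀ {x y} → x ≤ y → - y ≤ - x
      neg-≤ (inj₁ p) = inj₁ (⁻¹-anti-< p)
      neg-≤ (inj₂ p) = inj₂ (-‿cong (sym p))
      0<k : 0# < proj₁ k
      0<k = ≤-<-trans 0≤y (<-trans y<x x<k)
      x-y≈ku : x + - y ≈ proj₁ k * (e + - d)
      x-y≈ku = by-multiple 1# eq (solve 5 (λ x y d e k →
        (x :+ :- y) :+ :1 :* (y :+ e :* k) := k :* (e :+ :- d) :+ :1 :* (x :+ d :* k))
        refl x y d e (proj₁ k))

    code-unique : ∀ {p p′ n P P′ : M} → proj₁ p < proj₁ k → proj₁ p′ < proj₁ k →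
                  Code k p n P → Code k p′ n P′ → proj₁ P ≈ proj₁ P′ → proj₁ p ≈ proj₁ p′
    code-unique {p} {p′} p<k p′<k (_ , _ , (d , eqd) , _) (_ , _ , (d′ , eqd′) , _) P≈P′ = ≤-antisym
      (≮⇒≥ (remainder-unique {d = proj₁ d} {e = proj₁ d′} p<k (proj₂ p′) eq))
      (≮⇒≥ (remainder-unique {d = proj₁ d′} {e = proj₁ d} p′<k (proj₂ p) (sym eq)))
      where
      eq : proj₁ p + proj₁ d * proj₁ k ≈ proj₁ p′ + proj₁ d′ * proj₁ k
      eq = trans (sym eqd) (trans P≈P′ eqd′)

    -- If P < P′ are powers of q with the same remainder, then P′ / P > 1
    -- is a power of q that is 1 modulo m².
    code-≮ : ∀ {p p′ n P P′ : M} → Code k p n P → Code k p′ n P′ → ¬ proj₁ P < proj₁ P′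
    code-≮ {n = n′} {P} {P′} (P2 , (c′ , eqc) , _) (P2′ , (e′ , eqe) , _ , small) P<P′
      with powerOfTwo-∣ {P} {P′} P2 P2′ P<P′
    ... | r′@(r , 0≤r) , P′≈Pr , R2 = absurd (small r′ (s , inj₁ 0<s) R2 (trans r≈1+um (+-congˡ (trans (*-congʳ u≈sm) (*-assoc _ _ _)))))
      where
      n c e u s : Carrier
      n = proj₁ n′
      c = proj₁ c′
      e = proj₁ e′
      -- Solving the hypothesis for r gives r - 1 = u m; inserting this into the factor r - 1 of u
      -- gives u = s m, so r is 1 modulo m².
      u = (e + - c) * m + - ((n + c * m) * (r + - 1#))
      s = (e + - c) + - ((n + c * m) * u)
      hyp : (1# + n * m + c * (m * m)) * r ≈ 1# + n * m + e * (m * m)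
      hyp = trans (*-congʳ (sym eqc)) (trans (sym P′≈Pr) eqe)
      r≈1+um : r ≈ 1# + u * m
      r≈1+um = by-multiple 1# hyp (solve 5 (λ n m c e r →
        r :+ :1 :* (:1 :+ n :* m :+ e :* (m :* m)) :=
        (:1 :+ ((e :+ :- c) :* m :+ :- ((n :+ c :* m) :* (r :+ :- :1))) :* m) :+
        :1 :* ((:1 :+ n :* m :+ c :* (m :* m)) :* r)) refl n m c e r)
      u≈sm : u ≈ s * m
      u≈sm = by-multiple (- (n + c * m)) r≈1+um (solve 6 (λ n m c e r u →
        ((e :+ :- c) :* m :+ :- ((n :+ c :* m) :* (r :+ :- :1))) :+ :- (n :+ c :* m) :* (:1 :+ u :* m) :=
        ((e :+ :- c) :+ :- ((n :+ c :* m) :* u)) :* m :+ :- (n :+ c :* m) :* r) refl n m c e r u)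
      1≤P : 1# ≤ proj₁ P
      1≤P = 0<⇒1≤ (proj₁ P2)
      1<r : 1# < r
      1<r = ≰⇒> λ r≤1 → <⇒≱ P<P′ (begin
        proj₁ P′       ≈⟨ P′≈Pr ⟩
        proj₁ P * r    ≤⟨ *-monoʳ-≤ (inj₁ (proj₁ P2)) r≤1 ⟩
        proj₁ P * 1#   ≈⟨ *-identityʳ _ ⟩
        proj₁ P        ∎)
      0<u : 0# < u
      0<u = pos-cancelˡ 0<m (<-respʳ-≈ (by-multiple 1# r≈1+um (solve 3 (λ r u m →
        r :+ :- :1 :+ :1 :* (:1 :+ u :* m) := m :* u :+ :1 :* r) refl r u m)) (x<y⇒0<y-x 1<r))
      0<s : 0# < s
      0<s = pos-cancelˡ 0<m (<-respʳ-≈ (trans u≈sm (*-comm s m)) 0<u)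
      absurd : r ≈ 1# ⊎ proj₁ P′ < r → _
      absurd (inj₁ r≈1) = irrefl (sym r≈1) 1<r
      absurd (inj₂ P′<r) = <⇒≱ P′<r (begin
        r            ≈⟨ *-identityˡ r ⟨
        1# * r       ≤⟨ *-monoˡ-≤ 0≤r 1≤P ⟩
        proj₁ P * r  ≈⟨ P′≈Pr ⟨
        proj₁ P′     ∎)

    -- From q = 1 + m the remainder n becomes n + 1, and from q = 2 + k the remainder p doubles. For
    -- the last clause, a power of two R > P that is 1 modulo m² is P r with r > 1 and r congruent
    -- to 1 modulo m, so r ≥ q. The case r = q would make m divide n + 1, which is positive and less
    -- than m; hence q P < R.
    code-suc : ∀ {p n P : M} (q : M) → PowerOfTwo q → proj₁ q ≈ m + 1# → proj₁ n + 1# < proj₁ k →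
               Code k p n P → Code k (p +ᴹ p) (n +ᴹ 1ᴹ) (q *ᴹ P)
    code-suc {p} {n′} {P} q Q q≈m+1 n+1<k (P2 , (c′ , eqc) , (d , eqd) , small) =
      powerOfTwo-* {q} {P} Q P2 ,
      ((n′ +ᴹ c′ *ᴹ (1ᴹ +ᴹ (k +ᴹ 1ᴹ))) , qP≈) ,
      (p +ᴹ d *ᴹ q , trans (*-cong q≈m+1 eqd) (trans
        (solve 3 (λ p d k → (k :+ :1 :+ :1) :* (p :+ d :* k) :=
                            (p :+ p) :+ (p :+ d :* (k :+ :1 :+ :1)) :* k)
               refl (proj₁ p) (proj₁ d) (proj₁ k))
        (+-congˡ (*-congʳ (+-congˡ (*-congˡ (sym q≈m+1))))))) ,
      small′
      where
      n c : Carrier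
      n = proj₁ n′
      c = proj₁ c′
      qP≈ : proj₁ q * proj₁ P ≈ 1# + (n + 1#) * m + (n + c * (1# + m)) * (m * m)
      qP≈ = trans (*-cong q≈m+1 eqc) (solve 3 (λ m n c →
        (m :+ :1) :* (:1 :+ n :* m :+ c :* (m :* m)) :=
        :1 :+ (n :+ :1) :* m :+ (n :+ c :* (:1 :+ m)) :* (m :* m)) refl m n c)
      small′ : ∀ (R s : M) → PowerOfTwo R → proj₁ R ≈ 1# + proj₁ s * (m * m) →
               proj₁ R ≈ 1# ⊎ proj₁ q * proj₁ P < proj₁ R
      small′ R s R2 eqs with small R s R2 eqs
      ... | inj₁ R≈1 = inj₁ R≈1
      ... | inj₂ P<R with powerOfTwo-∣ {P} {R} P2 R2 P<R
      ...   | (r , 0≤r) , R≈Pr , _ = inj₂ qP<R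
        where
        u : Carrier
        u = proj₁ s * m + - ((n + c * m) * r)
        r-1≈mu : r + - 1# ≈ m * u
        r-1≈mu = by-multiple 1# (trans (*-congʳ (sym eqc)) (trans (sym R≈Pr) eqs))
          (solve 5 (λ n m c s r →
            (r :+ :- :1) :+ :1 :* (:1 :+ s :* (m :* m)) :=
            m :* (s :* m :+ :- ((n :+ c :* m) :* r)) :+
            :1 :* ((:1 :+ n :* m :+ c :* (m :* m)) :* r)) refl n m c (proj₁ s) r)
        1<r : 1# < r
        1<r with compare 1# r
        ... | tri< p _ _ = p
        ... | tri≈ _ p _ = contradiction P<R (irrefl (sym (trans R≈Pr (trans (*-congˡ (sym p)) (*-identityʳ _)))))
        ... | tri> _ _ p = contradiction (inj₁ P<R) (<⇒≱ (begin-strict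
          proj₁ R       ≈⟨ trans R≈Pr (*-comm _ _) ⟩
          r * proj₁ P   <⟨ *-monoˡ-< (proj₁ P2) p ⟩
          1# * proj₁ P  ≈⟨ *-identityˡ _ ⟩
          proj₁ P       ∎))
        q≤r : m + 1# ≤ r
        q≤r = begin
          m + 1#          ≤⟨ ∙-monoˡ-≤ 1# (*-≥ 0<m (<-respʳ-≈ r-1≈mu (x<y⇒0<y-x 1<r))) ⟩
          m * u + 1#      ≈⟨ +-congʳ r-1≈mu ⟨
          (r + - 1#) + 1# ≈⟨ -+-cancel 1# r ⟩
          r               ∎
        0<n+1 : 0# < n + 1#
        0<n+1 = ≤-<-trans (proj₂ n′) (x<x+1 n)
        t : Carrier
        t = proj₁ s + - (n + c * (1# + m))
        n+1≈mt : m + 1# ≈ r → n + 1# ≈ m * t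
        n+1≈mt q≈r = *-cancelˡ 0<m (by-multiple 1# hyp
          (solve 4 (λ n m c s →
            m :* (n :+ :1) :+ :1 :* (:1 :+ s :* (m :* m)) :=
            m :* (m :* (s :+ :- (n :+ c :* (:1 :+ m)))) :+
            :1 :* (:1 :+ (n :+ :1) :* m :+ (n :+ c :* (:1 :+ m)) :* (m :* m))) refl n m c (proj₁ s)))
          where
          hyp : 1# + (n + 1#) * m + (n + c * (1# + m)) * (m * m) ≈ 1# + proj₁ s * (m * m)
          hyp = begin-equality
            1# + (n + 1#) * m + (n + c * (1# + m)) * (m * m)  ≈⟨ qP≈ ⟨
            proj₁ q * proj₁ P                                 ≈⟨ *-congʳ (trans q≈m+1 q≈r) ⟩
            r * proj₁ P                                       ≈⟨ trans (*-comm _ _) (sym R≈Pr) ⟩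
            proj₁ R                                           ≈⟨ eqs ⟩
            1# + proj₁ s * (m * m)                            ∎
        qP<R : proj₁ q * proj₁ P < proj₁ R
        qP<R = qP<R′ q≤r
          where
          qP<R′ : m + 1# ≤ r → proj₁ q * proj₁ P < proj₁ R
          qP<R′ (inj₁ q<r) = begin-strict
            proj₁ q * proj₁ P  <⟨ *-monoˡ-< (proj₁ P2) (<-respˡ-≈ (sym q≈m+1) q<r) ⟩
            r * proj₁ P        ≈⟨ trans (*-comm _ _) (sym R≈Pr) ⟩
            proj₁ R            ∎
          qP<R′ (inj₂ q≈r) = contradiction (begin
            m       ≤⟨ *-≥ 0<m (<-respʳ-≈ (n+1≈mt q≈r) 0<n+1) ⟩
            m * t   ≈⟨ n+1≈mt q≈r ⟨
            n + 1#  ∎) (<⇒≱ (<-trans n+1<k (x<x+1 _)))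

  -- Recursion, totality and the laws of 2ⁿ.

  opaque
    unfolding Exp

    exp-0 : Exp 1ᴹ 0ᴹ
    exp-0 k q Q q≈k+2 _ = 1ᴹ , powerOfTwo-1 ,
      (0ᴹ , solve 1 (λ m → :1 := :1 :+ :0 :* m :+ :0 :* (m :* m)) refl (proj₁ k + 1#)) ,
      (0ᴹ , solve 1 (λ k → :1 := :1 :+ :0 :* k) refl (proj₁ k)) ,
      λ R s R2 _ → at-least-1 (0<⇒1≤ (proj₁ R2))
      where
      at-least-1 : ∀ {x} → 1# ≤ x → x ≈ 1# ⊎ 1# < x
      at-least-1 (inj₁ 1<x) = inj₂ 1<x
      at-least-1 (inj₂ 1≈x) = inj₁ (sym 1≈x)

    -- The bound on 2p + n + 1 implies the one on p + n, so the code for the same k is available.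
    -- This is why `Exp` ranges over all large k: a fixed k would be outgrown by repeated doubling.
    exp-suc : ∀ {p n : M} → Exp p n → Exp (p +ᴹ p) (n +ᴹ 1ᴹ)
    exp-suc {p} {n} E k q Q q≈k+2 bound with E k q Q q≈k+2 (≤-<-trans
        (∙-mono-≤ (x≤x+y (proj₂ p)) (x≤x+y (inj₁ 0<1))) bound)
      where
      x≤x+y : ∀ {x y} → 0# ≤ y → x ≤ x + y
      x≤x+y {x} {y} 0≤y = begin
        x       ≈⟨ +-identityʳ x ⟨
        x + 0#  ≤⟨ ∙-monoʳ-≤ x 0≤y ⟩
        x + y   ∎
    ... | P , C = q *ᴹ P , code-suc k {p} {n} {P} q Q q≈k+2 (≤-<-trans (begin
        proj₁ n + 1#                        ≈⟨ +-identityˡ _ ⟨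
        0# + (proj₁ n + 1#)                 ≤⟨ ∙-monoˡ-≤ _ (+-nonneg (proj₂ p) (proj₂ p)) ⟩
        (proj₁ p + proj₁ p) + (proj₁ n + 1#)  ∎) bound) C

    exp-unique : ∀ {p p′ n : M} → Exp p n → Exp p′ n → proj₁ p ≈ proj₁ p′
    -- A power of two beyond p + p′ + n + 2 makes k = q - 2 large enough for both codes at once.
    exp-unique {p} {p′} {n} E E′ with powerOfTwo-unbounded ((p +ᴹ p′) +ᴹ n +ᴹ (1ᴹ +ᴹ 1ᴹ))
    ... | q@(q₁ , _) , Q , bound = unique (E k q Q q≈k+2 p+n<k) (E′ k q Q q≈k+2 p′+n<k)
      where
      total : Carrier
      total = (proj₁ p + proj₁ p′) + proj₁ n
      total<k : total < q₁ + - (1# + 1#)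
      total<k = begin-strict
        total                               ≈⟨ solve 1 (λ t → t := (t :+ (:1 :+ :1)) :+ :- (:1 :+ :1)) refl total ⟩
        (total + (1# + 1#)) + - (1# + 1#)   <⟨ +-monoˡ-< _ bound ⟩
        q₁ + - (1# + 1#)                    ∎
      k : M
      k = q₁ + - (1# + 1#) , ≤-trans (+-nonneg (+-nonneg (proj₂ p) (proj₂ p′)) (proj₂ n)) (inj₁ total<k)
      q≈k+2 : q₁ ≈ proj₁ k + 1# + 1#
      q≈k+2 = solve 1 (λ q → q := (q :+ :- (:1 :+ :1)) :+ :1 :+ :1) refl q₁
      p+n<k : proj₁ p + proj₁ n < proj₁ k
      p+n<k = ≤-<-trans (∙-monoˡ-≤ _ (≤-trans (inj₂ (sym (+-identityʳ _))) (∙-monoʳ-≤ _ (proj₂ p′)))) total<k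
      p′+n<k : proj₁ p′ + proj₁ n < proj₁ k
      p′+n<k = ≤-<-trans (∙-monoˡ-≤ _ (≤-trans (inj₂ (sym (+-identityˡ _))) (∙-monoˡ-≤ _ (proj₂ p)))) total<k
      +<⇒< : ∀ {x y z} → 0# ≤ y → x + y < z → x < z
      +<⇒< {x} 0≤y = ≤-<-trans (≤-trans (inj₂ (sym (+-identityʳ x))) (∙-monoʳ-≤ x 0≤y))
      unique : (∃ λ (P : M) → Code k p n P) → (∃ λ (P : M) → Code k p′ n P) → proj₁ p ≈ proj₁ p′
      unique (P , C) (P′ , C′) = code-unique k {p} {p′} {n} {P} {P′}
        (+<⇒< (proj₂ n) p+n<k) (+<⇒< (proj₂ n) p′+n<k) C C′
        (≤-antisym (≮⇒≥ (code-≮ k {p′} {p} {n} {P′} {P} C′ C)) (≮⇒≥ (code-≮ k {p} {p′} {n} {P} {P′} C C′)))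

    -- The clause n < 2ⁿ is carried along because it gives positivity here, and later the
    -- unboundedness of 2ⁿ for unbounded n.
    exp-total : ∀ (n : M) → ∃ λ (p : M) → Exp p n × proj₁ n < proj₁ p
    exp-total = induction (`∃ (exp zero (suc zero) `∧ (v1 `< v0))) []
      (1ᴹ , exp-0 , 0<1)
      λ n (p , E , n<p) → p +ᴹ p , exp-suc {p} {n} E , (begin-strict
        proj₁ n + 1#       <⟨ +-monoˡ-< 1# n<p ⟩
        proj₁ p + 1#       ≤⟨ ∙-monoʳ-≤ _ (0<⇒1≤ (≤-<-trans (proj₂ n) n<p)) ⟩
        proj₁ p + proj₁ p  ∎)

    exp-pos : ∀ {p n : M} → Exp p n → 0# < proj₁ p
    exp-pos {p} {n} E = positive (exp-total n)
      where
      positive : (∃ λ (p : M) → Exp p n × proj₁ n < proj₁ p) → 0# < proj₁ p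
      positive (p′ , E′ , n<p′) = <-respʳ-≈ (exp-unique {p′} {p} {n} E′ E) (≤-<-trans (proj₂ n) n<p′)

    -- `exp` takes variables rather than terms, so the induction formula names the product z and the
    -- sum w. It also asserts the existence of some p′, which uniqueness identifies with the given
    -- one afterwards.
    exp-+ : ∀ {p p′ n n′ : M} → Exp p n → Exp p′ n′ → Exp (p *ᴹ p′) (n +ᴹ n′)
    exp-+ {p} {p′} {n} {n′} E E′ = conclude (sums n′)
      where
      Sum : M → Set ℓ
      Sum n′ = ∃ λ (p′ : M) → Exp p′ n′ × ∃₂ λ (z w : M) →
        proj₁ z ≈ proj₁ p * proj₁ p′ × proj₁ w ≈ proj₁ n + proj₁ n′ × Exp z w
      sums : ∀ n′ → Sum n′
      sums = induction
        (`∃ (exp zero (suc zero) `∧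
          `∃ (`∃ ((v1 `≈ var (suc (suc (suc (suc zero)))) `* v2) `∧
                  (v0 `≈ var (suc (suc (suc (suc (suc zero))))) `+ var (suc (suc (suc zero)))) `∧
                  exp (suc zero) zero))))
        (p ∷ n ∷ [])
        (1ᴹ , exp-0 , p , n , sym (*-identityʳ _) , sym (+-identityʳ _) , E)
        (λ n′ (p′ , E′ , z , w , z≈pp′ , w≈n+n′ , Ez) →
          p′ +ᴹ p′ , exp-suc {p′} {n′} E′ , z +ᴹ z , w +ᴹ 1ᴹ ,
          trans (+-cong z≈pp′ z≈pp′) (sym (distribˡ _ _ _)) ,
          trans (+-congʳ w≈n+n′) (+-assoc _ _ _) ,
          exp-suc {z} {w} Ez)
      conclude : Sum n′ → Exp (p *ᴹ p′) (n +ᴹ n′)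
      conclude (p″ , E″ , z , w , z≈pp″ , w≈n+n′ , Ez) =
        exp-resp {z} {p *ᴹ p′} {w} {n +ᴹ n′}
          (trans z≈pp″ (*-congˡ (exp-unique {p″} {p′} {n′} E″ E′))) w≈n+n′ Ez

    -- By discreteness y + 1 is either still below 2p, where p remains valid, or equal to 2p, where
    -- the next power takes over. The value 0 is a separate case of the induction formula.
    exp-cover : ∀ (y : M) → 0# < proj₁ y →
      ∃₂ λ (p n : M) → Exp p n × proj₁ p ≤ proj₁ y × proj₁ y < proj₁ p + proj₁ p
    exp-cover y 0<y = positive (cover y)
      where
      Cover : M → Set ℓ
      Cover y = ∃₂ λ (p n : M) → Exp p n × proj₁ p ≤ proj₁ y × proj₁ y < proj₁ p + proj₁ p
      positive : proj₁ y ≈ 0# ⊎ Cover y → Cover y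
      positive (inj₁ y≈0) = contradiction 0<y (irrefl (sym y≈0))
      positive (inj₂ c)   = c
      0+1 : ∀ {x} → x ≈ 0# → x + 1# ≈ 1#
      0+1 x≈0 = trans (+-congʳ x≈0) (+-identityˡ 1#)
      next : ∀ (y p n : M) → Exp p n → proj₁ p ≤ proj₁ y → proj₁ y + 1# ≤ proj₁ p + proj₁ p →
             Cover (y +ᴹ 1ᴹ)
      next y p n E p≤y (inj₁ lt) = p , n , E , ≤-trans p≤y (inj₁ (x<x+1 _)) , lt
      next y p n E p≤y (inj₂ eq) = p +ᴹ p , n +ᴹ 1ᴹ , exp-suc {p} {n} E , inj₂ (sym eq) ,
        (begin-strict
          proj₁ y + 1#                             ≈⟨ eq ⟩
          proj₁ p + proj₁ p                        ≈⟨ +-identityʳ _ ⟨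
          proj₁ p + proj₁ p + 0#                   ≈⟨ +-congˡ (+-identityʳ 0#) ⟨
          proj₁ p + proj₁ p + (0# + 0#)            <⟨ ∙-monoʳ-< _ (∙-mono-<-≤ 0<p (inj₁ 0<p)) ⟩
          proj₁ p + proj₁ p + (proj₁ p + proj₁ p)  ∎)
        where
        0<p : 0# < proj₁ p
        0<p = exp-pos {p} {n} E
      cover : ∀ (y : M) → proj₁ y ≈ 0# ⊎ Cover y
      cover = induction ((v0 `≈ `0) `∨ `∃ (`∃ (exp (suc zero) zero `∧
          ((v1 `< v2) `∨ (v1 `≈ v2)) `∧ (v2 `< v1 `+ v1)))) []
        (inj₁ refl)
        λ { y (inj₁ y≈0) → inj₂ (1ᴹ , 0ᴹ , exp-0 , inj₂ (sym (0+1 y≈0)) , <-respˡ-≈ (sym (0+1 y≈0)) (x<x+1 1#))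
          ; y (inj₂ (p , n , E , p≤y , y<2p)) → inj₂ (next y p n E p≤y (<⇒+1≤ y<2p)) }

-- Multiples, and subgroups extended by one element.

module SubgroupLemmas {ℓ} (G : OrderedAbelianGroup ℓ) where
  open OrderedAbelianGroup G
  open OrderedGroupProperties G
    using (×-homo-+; ×-homo-1; ×-congʳ; ×-assocˡ; ∙-mono-<-≤; ·-mono-≤; ·-monoˡ-≤; ε≤·; ≤1·; ε≤∣∣;
           ∣∣-nonneg; ∣∣-cong; ∣⁻¹∣; <ε⇒ε<⁻¹; ⁻¹-∙-comm; ε⁻¹≈ε)
  open CommutativeMonoidMultiplication commutativeMonoid using (×-distrib-+) public
  open CommutativeSemigroupProperties commutativeSemigroup using (interchange)
  open AbelianGroupProperties abelianGroup using (∙-cancelʳ)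
  open import Relation.Binary.Reasoning.Setoid setoid

  ε-multiple : ∀ n → n · ε ≈ ε
  ε-multiple zero    = refl
  ε-multiple (suc n) = trans (identityˡ _) (ε-multiple n)

  torsion-free : ∀ n {x} → suc n · x ≈ ε → x ≈ ε
  torsion-free n {x} eq with compare x ε
  ... | tri≈ _ x≈ε _ = x≈ε
  ... | tri< x<ε _ _ = contradiction (∙-mono-<-≤ x<ε (·-mono-≤ n (inj₁ x<ε)))
          (irrefl (trans eq (sym (trans (identityˡ _) (ε-multiple n)))))
  ... | tri> _ _ ε<x = contradiction (∙-mono-<-≤ ε<x (·-mono-≤ n (inj₁ ε<x)))
          (irrefl (sym (trans eq (sym (trans (identityˡ _) (ε-multiple n))))))

  multiple-swap : ∀ m n x → m · (n · x) ≈ n · (m · x)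
  multiple-swap m n x = trans (×-assocˡ x m n)
    (trans (reflexive (≡.cong (_· x) (ℕₚ.*-comm m n))) (sym (×-assocˡ x n m)))

  multiple-⁻¹ : ∀ n x → n · (x ⁻¹) ≈ (n · x) ⁻¹
  multiple-⁻¹ zero    x = sym ε⁻¹≈ε
  multiple-⁻¹ (suc n) x = trans (∙-congˡ (multiple-⁻¹ n x)) (⁻¹-∙-comm x (n · x))

  ∣multiple∣ : ∀ n x → ∣ n · x ∣ ≈ n · ∣ x ∣
  ∣multiple∣ n x with ≤-total ε x
  ... | inj₁ ε≤x = trans (∣∣-nonneg (ε≤· n ε≤x)) (×-congʳ n (sym (∣∣-nonneg ε≤x)))
  ... | inj₂ x≤ε = begin
    ∣ n · x ∣         ≈⟨ ∣⁻¹∣ _ ⟨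
    ∣ (n · x) ⁻¹ ∣    ≈⟨ ∣∣-cong (multiple-⁻¹ n x) ⟨
    ∣ n · (x ⁻¹) ∣      ≈⟨ ∣∣-nonneg (ε≤· n ε≤x⁻¹) ⟩
    n · (x ⁻¹)          ≈⟨ ×-congʳ n (∣∣-nonneg ε≤x⁻¹) ⟨
    n · ∣ x ⁻¹ ∣      ≈⟨ ×-congʳ n (∣⁻¹∣ x) ⟩
    n · ∣ x ∣         ∎
    where
    ≤ε⇒ε≤⁻¹ : ∀ {x} → x ≤ ε → ε ≤ x ⁻¹
    ≤ε⇒ε≤⁻¹ (inj₁ x<ε) = inj₁ (<ε⇒ε<⁻¹ x<ε)
    ≤ε⇒ε≤⁻¹ (inj₂ x≈ε) = inj₂ (sym (trans (⁻¹-cong x≈ε) ε⁻¹≈ε))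
    ε≤x⁻¹ : ε ≤ x ⁻¹
    ε≤x⁻¹ = ≤ε⇒ε≤⁻¹ x≤ε

  x≤multiple : ∀ n {x} → ε ≤ x → x ≤ suc n · x
  x≤multiple n {x} ε≤x = ≤-trans (≤1· ≤-refl) (·-monoˡ-≤ {1} {suc n} (ℕ.s≤s ℕ.z≤n) ε≤x)

  ∣x∣≤∣multiple∣ : ∀ n x → ∣ x ∣ ≤ ∣ suc n · x ∣
  ∣x∣≤∣multiple∣ n x = ≤-trans (x≤multiple n (ε≤∣∣ x)) (≤-reflexive (sym (∣multiple∣ (suc n) x)))

  multiple-∼ : ∀ n x → suc n · x ∼ x
  multiple-∼ n x = suc n
    , ≤-trans (∣x∣≤∣multiple∣ n x) (x≤multiple n (ε≤∣∣ _))
    , ≤-reflexive (∣multiple∣ (suc n) x)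

  ⁻¹-∼ : ∀ x → x ⁻¹ ∼ x
  ⁻¹-∼ x = 1 , ≤1· (≤-reflexive (sym (∣⁻¹∣ x))) , ≤1· (≤-reflexive (∣⁻¹∣ x))

  multiple-suc-+ : ∀ n k x → suc (n ℕ.+ k) · x ≈ suc k · x ∙ n · x
  multiple-suc-+ n k x = trans (reflexive (≡.cong (λ j → suc j · x) (ℕₚ.+-comm n k))) (×-homo-+ x (suc k) n)

  x⁻¹∙xy : ∀ x y → x ⁻¹ ∙ (x ∙ y) ≈ y
  x⁻¹∙xy x y = trans (sym (assoc _ _ _)) (trans (∙-congʳ (inverseˡ x)) (identityˡ y))

  -- These are the elements s + (m - n) c in additive notation; moving n c to the left avoids
  -- integer multiples.
  adjoin : Pred Carrier ℓ → Carrier → Pred Carrier ℓ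
  adjoin S c x = ∃ λ s → S s × ∃₂ λ m n → x ∙ n · c ≈ s ∙ m · c

  minus≈ε : ∀ {x y} → x ∙ y ⁻¹ ≈ ε → x ≈ y
  minus≈ε {x} {y} eq = ∙-cancelʳ (y ⁻¹) x y (trans eq (sym (inverseʳ y)))

  record IsSubgroup (S : Pred Carrier ℓ) : Set ℓ where
    field
      resp      : ∀ {x y} → x ≈ y → S x → S y
      ε∈        : S ε
      ∙-closed  : ∀ {x y} → S x → S y → S (x ∙ y)
      ⁻¹-closed : ∀ {x} → S x → S (x ⁻¹)

    ·-closed : ∀ n {x} → S x → S (n · x)
    ·-closed zero    _   = ε∈
    ·-closed (suc n) x∈S = ∙-closed x∈S (·-closed n x∈S)

    ∙-cancelʳ-∈ : ∀ {x y z} → S y → S z → x ∙ y ≈ z → S x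
    ∙-cancelʳ-∈ {x} {y} {z} y∈S z∈S eq = resp (begin
      z ∙ y ⁻¹        ≈⟨ ∙-congʳ eq ⟨
      (x ∙ y) ∙ y ⁻¹  ≈⟨ assoc _ _ _ ⟩
      x ∙ (y ∙ y ⁻¹)  ≈⟨ ∙-congˡ (inverseʳ y) ⟩
      x ∙ ε           ≈⟨ identityʳ x ⟩
      x               ∎) (∙-closed z∈S (⁻¹-closed y∈S))

  adjoin-isSubgroup : ∀ {S} c → IsSubgroup S → IsSubgroup (adjoin S c)
  adjoin-isSubgroup {S} c isS = record
    { resp      = λ x≈y (s , s∈S , m , n , eq) → s , s∈S , m , n , trans (∙-congʳ (sym x≈y)) eq
    ; ε∈        = ε , ε∈ , 0 , 0 , refl
    ; ∙-closed  = λ {x} {y} (s , s∈S , m , n , eq) (t , t∈S , m′ , n′ , eq′) →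
        s ∙ t , ∙-closed s∈S t∈S , m ℕ.+ m′ , n ℕ.+ n′ , (begin
          (x ∙ y) ∙ (n ℕ.+ n′) · c          ≈⟨ ∙-congˡ (×-homo-+ c n n′) ⟩
          (x ∙ y) ∙ (n · c ∙ n′ · c)        ≈⟨ interchange _ _ _ _ ⟩
          (x ∙ n · c) ∙ (y ∙ n′ · c)        ≈⟨ ∙-cong eq eq′ ⟩
          (s ∙ m · c) ∙ (t ∙ m′ · c)        ≈⟨ interchange _ _ _ _ ⟩
          (s ∙ t) ∙ (m · c ∙ m′ · c)        ≈⟨ ∙-congˡ (×-homo-+ c m m′) ⟨
          (s ∙ t) ∙ (m ℕ.+ m′) · c          ∎)
    ; ⁻¹-closed = λ {x} (s , s∈S , m , n , eq) →
        s ⁻¹ , ⁻¹-closed s∈S , n , m , ∙-cancelʳ (x ∙ n · c) _ _ (begin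
          (x ⁻¹ ∙ m · c) ∙ (x ∙ n · c)      ≈⟨ interchange _ _ _ _ ⟩
          (x ⁻¹ ∙ x) ∙ (m · c ∙ n · c)      ≈⟨ ∙-cong (trans (inverseˡ x) (sym (inverseˡ s))) (comm _ _) ⟩
          (s ⁻¹ ∙ s) ∙ (n · c ∙ m · c)      ≈⟨ interchange _ _ _ _ ⟩
          (s ⁻¹ ∙ n · c) ∙ (s ∙ m · c)      ≈⟨ ∙-congˡ eq ⟨
          (s ⁻¹ ∙ n · c) ∙ (x ∙ n · c)      ∎)
    }
    where open IsSubgroup isS

  ⊆-adjoin : ∀ {S} c → S ⊆ adjoin S c
  ⊆-adjoin c {x} x∈S = x , x∈S , 0 , 0 , refl

  generator∈adjoin : ∀ {S} c → IsSubgroup S → c ∈ adjoin S c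
  generator∈adjoin c isS = ε , IsSubgroup.ε∈ isS , 1 , 0 , (begin
    c ∙ ε        ≈⟨ comm c ε ⟩
    ε ∙ c        ≈⟨ ∙-congˡ (×-homo-1 c) ⟨
    ε ∙ 1 · c    ∎)

  isSubgroup : (A : Subgroup G) → IsSubgroup (Subgroup.member A)
  isSubgroup A = record
    { resp = resp ; ε∈ = ε∈ ; ∙-closed = ∙-closed ; ⁻¹-closed = ⁻¹-closed }
    where open Subgroup A

  toSubgroup : ∀ {S} → IsSubgroup S → Subgroup G
  toSubgroup {S} isS = record
    { member = S ; resp = resp ; ε∈ = ε∈ ; ∙-closed = ∙-closed ; ⁻¹-closed = ⁻¹-closed }
    where open IsSubgroup isS

  -- The smaller of m and n cancels. Passing to the inverse when n is the larger one leaves a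
  -- positive multiple of c in every case outside S.
  adjoin-cases : ∀ {S c y} → IsSubgroup S → y ∈ adjoin S c →
    y ∈ S ⊎ ∃₂ λ s k → s ∈ S × ∃ λ z → (z ≈ y ⊎ z ≈ y ⁻¹) × z ≈ s ∙ suc k · c
  adjoin-cases {S} {c} {y} isS (s , s∈S , m , n , eq) with ℕₚ.<-cmp n m
  ... | tri≈ _ ≡.refl _ = inj₁ (IsSubgroup.resp isS (sym (∙-cancelʳ (n · c) y s eq)) s∈S)
  ... | tri< n<m _ _ with ℕₚ.m≤n⇒∃[o]m+o≡n n<m
  ...   | k , ≡.refl = inj₂ (s , k , s∈S , y , inj₁ refl , ∙-cancelʳ (n · c) _ _ (begin
    y ∙ n · c                 ≈⟨ eq ⟩
    s ∙ suc (n ℕ.+ k) · c     ≈⟨ ∙-congˡ (multiple-suc-+ n k c) ⟩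
    s ∙ (suc k · c ∙ n · c)   ≈⟨ assoc _ _ _ ⟨
    (s ∙ suc k · c) ∙ n · c   ∎))
  adjoin-cases {S} {c} {y} isS (s , s∈S , m , n , eq) | tri> _ _ m<n with ℕₚ.m≤n⇒∃[o]m+o≡n m<n
  ...   | k , ≡.refl = inj₂ (s ⁻¹ , k , IsSubgroup.⁻¹-closed isS s∈S , y ⁻¹ , inj₂ refl , (begin
    y ⁻¹                                ≈⟨ identityʳ _ ⟨
    y ⁻¹ ∙ ε                            ≈⟨ ∙-congˡ (inverseˡ s) ⟨
    y ⁻¹ ∙ (s ⁻¹ ∙ s)                   ≈⟨ ∙-congˡ (∙-congˡ s≈) ⟩
    y ⁻¹ ∙ (s ⁻¹ ∙ (y ∙ suc k · c))     ≈⟨ ∙-congˡ (comm _ _) ⟩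
    y ⁻¹ ∙ ((y ∙ suc k · c) ∙ s ⁻¹)     ≈⟨ ∙-congˡ (assoc _ _ _) ⟩
    y ⁻¹ ∙ (y ∙ (suc k · c ∙ s ⁻¹))     ≈⟨ x⁻¹∙xy _ _ ⟩
    suc k · c ∙ s ⁻¹                    ≈⟨ comm _ _ ⟩
    s ⁻¹ ∙ suc k · c                    ∎))
    where
    s≈ : s ≈ y ∙ suc k · c
    s≈ = ∙-cancelʳ (m · c) _ _ (begin
      s ∙ m · c                 ≈⟨ eq ⟨
      y ∙ suc (m ℕ.+ k) · c     ≈⟨ ∙-congˡ (multiple-suc-+ m k c) ⟩
      y ∙ (suc k · c ∙ m · c)   ≈⟨ assoc _ _ _ ⟨
      (y ∙ suc k · c) ∙ m · c   ∎)

  -- Multiplication by k + 1 sends S and c into S, hence all that they generate. This makes maximal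
  -- subgroups pure.
  adjoin-multiple : ∀ {S} k {c y} → IsSubgroup S → suc k · c ∈ S → y ∈ adjoin S c → suc k · y ∈ S
  adjoin-multiple k {c} {y} isS kc∈S (s , s∈S , m , n , eq) =
    ∙-cancelʳ-∈ (·-closed n kc∈S) (∙-closed (·-closed (suc k) s∈S) (·-closed m kc∈S)) (begin
      suc k · y ∙ n · suc k · c      ≈⟨ ∙-congˡ (multiple-swap n (suc k) c) ⟩
      suc k · y ∙ suc k · n · c      ≈⟨ ×-distrib-+ _ _ (suc k) ⟨
      suc k · (y ∙ n · c)            ≈⟨ ×-congʳ (suc k) eq ⟩
      suc k · (s ∙ m · c)            ≈⟨ ×-distrib-+ _ _ (suc k) ⟩
      suc k · s ∙ suc k · m · c      ≈⟨ ∙-congˡ (multiple-swap (suc k) m c) ⟩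
      suc k · s ∙ m · suc k · c      ∎)
    where open IsSubgroup isS

-- Maximal subgroups inside a given set.

module _ {ℓ} (G : OrderedAbelianGroup ℓ) where
  open OrderedAbelianGroup G

  -- Zorn's lemma for subgroups inside Q, by transfinite iteration: the tower
  -- is the least family containing {ε} and closed under adjoining a chosen
  -- admissible element and under unions.  Subsets are Bool-valued so that the
  -- power set stays in the same universe.
  module MaximalSubgroup (classical : Classical) (Q : Pred Carrier ℓ)
    (Q-resp : ∀ {x y} → x ≈ y → Q x → Q y) (Qε : Q ε) where
    open Classical classical renaming (excluded-middle to em)
    open SubgroupLemmas G

    private
      𝒫 : Set ℓ
      𝒫 = Carrier → Bool

      ⟪_⟫ : 𝒫 → Pred Carrier ℓ
      ⟪ S ⟫ x = Level.Lift ℓ (S x ≡ true)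

      ⌊_⌋ : ∀ {a} → Set a → Bool
      ⌊ P ⌋ with em {P = P}
      ... | yes _ = true
      ... | no _  = false

      ⌊⌋-true : ∀ {a} {P : Set a} → P → ⌊ P ⌋ ≡ true
      ⌊⌋-true {P = P} p with em {P = P}
      ... | yes _ = ≡.refl
      ... | no ¬p = contradiction p ¬p

      ⌊⌋-out : ∀ {a} {P : Set a} → ⌊ P ⌋ ≡ true → P
      ⌊⌋-out {P = P} eq with em {P = P} | eq
      ... | yes p | _ = p

      dne : ∀ {a} {P : Set a} → ¬ ¬ P → P
      dne {P = P} ¬¬p with em {P = P}
      ... | yes p = p
      ... | no ¬p = contradiction ¬p ¬¬p

      infix 4 _⊑_ _≐_
      _⊑_ _≐_ : Rel 𝒫 ℓ
      S ⊑ T = ⟪ S ⟫ ⊆ ⟪ T ⟫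
      S ≐ T = S ⊑ T × T ⊑ S

      Candidate : 𝒫 → Pred Carrier ℓ
      Candidate S c = ¬ ⟪ S ⟫ c × (adjoin ⟪ S ⟫ c ⊆ Q)

      adjoin-mono : ∀ {S T c} → S ⊑ T → adjoin ⟪ S ⟫ c ⊆ adjoin ⟪ T ⟫ c
      adjoin-mono S⊑T (s , s∈S , rest) = s , S⊑T s∈S , rest

      Choice : Set ℓ
      Choice = Σ 𝒫 λ S → ∃ (Candidate S)

      -- Subsets are compared only by extension, and the adjoined element may depend neither on the
      -- presentation of S nor on the proof that a candidate exists. So representatives are chosen
      -- for pairs of a subset and a candidate, compared by the subset alone.
      choose : ∃ λ (rep : Choice → Choice) →
               (∀ x → proj₁ (rep x) ≐ proj₁ x) × (∀ {x y} → proj₁ x ≐ proj₁ y → rep x ≡ rep y)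
      choose = choice {A = Choice} {_≈_ = λ x y → proj₁ x ≐ proj₁ y} record
        { refl  = (λ z → z) , (λ z → z)
        ; sym   = λ (p , q) → q , p
        ; trans = λ (p , q) (p′ , q′) → (λ z → p′ (p z)) , (λ z → q (q′ z))
        }

      chosen : ∀ S → ∃ (Candidate S) → Carrier
      chosen S w = proj₁ (proj₂ (proj₁ choose (S , w)))

      chosen-candidate : ∀ S w → Candidate S (chosen S w)
      chosen-candidate S w =
        let (T , c , c∉T , c∈Q) = proj₁ choose (S , w)
            (T⊑S , S⊑T)         = proj₁ (proj₂ choose) (S , w)
        in (λ c∈S → c∉T (S⊑T c∈S)) , (λ z → c∈Q (adjoin-mono {S} {T} S⊑T z))

      chosen-cong : ∀ {S T} w w′ → S ≐ T → chosen S w ≡ chosen T w′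
      chosen-cong {S} {T} w w′ S≐T = ≡.cong (proj₁ ∘ proj₂) (proj₂ (proj₂ choose) {S , w} {T , w′} S≐T)

      candidate-resp : ∀ {S T} → S ≐ T → ∃ (Candidate S) → ∃ (Candidate T)
      candidate-resp {S} {T} (S⊑T , T⊑S) (c , c∉S , c∈Q) =
        c , (λ c∈T → c∉S (T⊑S c∈T)) , (λ z → c∈Q (adjoin-mono {T} {S} T⊑S z))

      next : 𝒫 → 𝒫
      next S with em {P = ∃ (Candidate S)}
      ... | yes w = λ x → ⌊ adjoin ⟪ S ⟫ (chosen S w) x ⌋
      ... | no _  = S

      ⊑-next : ∀ S → S ⊑ next S
      ⊑-next S {x} x∈S with em {P = ∃ (Candidate S)}
      ... | yes w = Level.lift (⌊⌋-true (⊆-adjoin (chosen S w) x∈S))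
      ... | no _  = x∈S

      next-mono : ∀ {S T} → S ≐ T → next S ⊑ next T
      next-mono {S} {T} S≐T {x} (Level.lift x∈) with em {P = ∃ (Candidate S)} | em {P = ∃ (Candidate T)}
      ... | yes w | yes w′ = Level.lift (⌊⌋-true (≡.subst (λ c → adjoin ⟪ T ⟫ c x)
                               (chosen-cong w w′ S≐T) (adjoin-mono {S} {T} (proj₁ S≐T) (⌊⌋-out x∈))))
      ... | yes w | no ¬w  = contradiction (candidate-resp S≐T w) ¬w
      ... | no ¬w | yes w  = contradiction (candidate-resp {T} {S} (proj₂ S≐T , proj₁ S≐T) w) ¬w
      ... | no _  | no _   = proj₁ S≐T (Level.lift x∈)

      -- With the disjunct `x ≈ ε` the empty union is the trivial subgroup, so that `Tower` starts
      -- without a base case.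
      ⋃ : (𝒫 → Bool) → 𝒫
      ⋃ F x = ⌊ (x ≈ ε ⊎ ∃ λ S → F S ≡ true × ⟪ S ⟫ x) ⌋

      data Tower : 𝒫 → Set ℓ where
        step : ∀ {S} → Tower S → Tower (next S)
        sup  : ∀ F → (∀ S → F S ≡ true → Tower S) → Tower (⋃ F)

      ⋃-lub : ∀ {F T} → (∀ {x} → x ≈ ε → ⟪ T ⟫ x) → (∀ S → F S ≡ true → S ⊑ T) → ⋃ F ⊑ T
      ⋃-lub ε∈ S⊑T (Level.lift x∈) with ⌊⌋-out x∈
      ... | inj₁ x≈ε              = ε∈ x≈ε
      ... | inj₂ (S , S∈F , x∈S)  = S⊑T S S∈F x∈S

      ⊑-⋃ : ∀ {F S} → F S ≡ true → S ⊑ ⋃ F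
      ⊑-⋃ S∈F x∈S = Level.lift (⌊⌋-true (inj₂ (_ , S∈F , x∈S)))

      tower-ε : ∀ {S} → Tower S → ∀ {x} → x ≈ ε → ⟪ S ⟫ x
      tower-ε (step {S} t) x≈ε = ⊑-next S (tower-ε t x≈ε)
      tower-ε (sup F t)    x≈ε = Level.lift (⌊⌋-true (inj₁ x≈ε))

      -- No member of the tower lies strictly between an extreme S and next S.
      Extreme : 𝒫 → Set ℓ
      Extreme S = ∀ {U} → Tower U → U ⊑ S → ¬ S ⊑ U → next U ⊑ S

      -- Induction on U. A proper subset U of S has next U inside S by extremality, and if U and S
      -- have the same elements, then so do next U and next S.
      extreme-compare : ∀ {S} → Tower S → Extreme S → ∀ {U} → Tower U → U ⊑ S ⊎ next S ⊑ U
      extreme-compare {S} s e (step {U} u) with extreme-compare s e u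
      ... | inj₂ nS⊑U = inj₂ (λ z → ⊑-next U (nS⊑U z))
      ... | inj₁ U⊑S with em {P = S ⊑ U}
      ...   | yes S⊑U = inj₂ (next-mono {S} {U} (S⊑U , U⊑S))
      ...   | no  S⋢U = inj₁ (e u U⊑S S⋢U)
      extreme-compare {S} s e (sup F t) with em {P = ∃ λ U → F U ≡ true × next S ⊑ U}
      ... | yes (U , U∈F , nS⊑U) = inj₂ (λ z → ⊑-⋃ {F} {U} U∈F (nS⊑U z))
      ... | no  none = inj₁ (⋃-lub {F} {S} (tower-ε s) below)
        where
        below : ∀ U → F U ≡ true → U ⊑ S
        below U U∈F with extreme-compare s e (t U U∈F)
        ... | inj₁ U⊑S  = U⊑S
        ... | inj₂ nS⊑U = contradiction (U , U∈F , λ {x} → nS⊑U {x}) none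

      -- Extremality of all members makes the tower a chain, and only along a chain are unions
      -- closed under the group operation.
      extreme : ∀ {S} → Tower S → Extreme S
      extreme (step {S} s) {U} u U⊑nS nS⋢U with extreme-compare s (extreme s) u
      ... | inj₂ nS⊑U = contradiction (λ {x} → nS⊑U {x}) nS⋢U
      ... | inj₁ U⊑S with em {P = S ⊑ U}
      ...   | yes S⊑U = next-mono {U} {S} (U⊑S , S⊑U)
      ...   | no  S⋢U = λ z → ⊑-next S (extreme s u U⊑S S⋢U z)
      extreme (sup F t) {U} u U⊑⋃ ⋃⋢U with em {P = ∃ λ S → F S ≡ true × ¬ S ⊑ U}
      ... | no none = contradiction
            (λ {x} → ⋃-lub {F} {U} (tower-ε u) (λ S S∈F → dne (λ S⋢U → none (S , S∈F , λ p → S⋢U p))) {x}) ⋃⋢U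
      ... | yes (S , S∈F , S⋢U) with extreme-compare (t S S∈F) (extreme (t S S∈F)) u
      ...   | inj₂ nS⊑U = contradiction (λ {x} z → nS⊑U {x} (⊑-next S z)) S⋢U
      ...   | inj₁ U⊑S  = λ z → ⊑-⋃ {F} {S} S∈F (extreme (t S S∈F) u U⊑S S⋢U z)

      tower-total : ∀ {S T} → Tower S → Tower T → S ⊑ T ⊎ T ⊑ S
      tower-total {S} s t with extreme-compare s (extreme s) t
      ... | inj₁ T⊑S  = inj₂ T⊑S
      ... | inj₂ nS⊑T = inj₁ (λ z → nS⊑T (⊑-next S z))

      tower-isSubgroup : ∀ {S} → Tower S → IsSubgroup ⟪ S ⟫ × (⟪ S ⟫ ⊆ Q)
      tower-isSubgroup (step {S} s) with em {P = ∃ (Candidate S)}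
      ... | no _  = tower-isSubgroup s
      ... | yes w = record
        { resp      = λ x≈y (Level.lift x∈) → Level.lift (⌊⌋-true (resp x≈y (⌊⌋-out x∈)))
        ; ε∈        = Level.lift (⌊⌋-true ε∈)
        ; ∙-closed  = λ (Level.lift x∈) (Level.lift y∈) →
                        Level.lift (⌊⌋-true (∙-closed (⌊⌋-out x∈) (⌊⌋-out y∈)))
        ; ⁻¹-closed = λ (Level.lift x∈) → Level.lift (⌊⌋-true (⁻¹-closed (⌊⌋-out x∈)))
        } , λ (Level.lift x∈) → proj₂ (chosen-candidate S w) (⌊⌋-out x∈)
        where open IsSubgroup (adjoin-isSubgroup (chosen S w) (proj₁ (tower-isSubgroup s)))
      tower-isSubgroup (sup F t) = record
        { resp      = λ x≈y (Level.lift x∈) → Level.lift (⌊⌋-true (resp′ x≈y (⌊⌋-out x∈)))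
        ; ε∈        = Level.lift (⌊⌋-true (inj₁ refl))
        ; ∙-closed  = λ (Level.lift x∈) (Level.lift y∈) → ∙′ (⌊⌋-out x∈) (⌊⌋-out y∈)
        ; ⁻¹-closed = λ (Level.lift x∈) → Level.lift (⌊⌋-true (⁻¹′ (⌊⌋-out x∈)))
        } , λ (Level.lift x∈) → ⊆Q (⌊⌋-out x∈)
        where
        Member : Pred Carrier ℓ
        Member x = x ≈ ε ⊎ ∃ λ S → F S ≡ true × ⟪ S ⟫ x
        module _ {S} (S∈F : F S ≡ true) where
          open IsSubgroup (proj₁ (tower-isSubgroup (t S S∈F))) public
        resp′ : ∀ {x y} → x ≈ y → Member x → Member y
        resp′ x≈y (inj₁ x≈ε)             = inj₁ (trans (sym x≈y) x≈ε)
        resp′ x≈y (inj₂ (S , S∈F , x∈S)) = inj₂ (S , S∈F , resp S∈F x≈y x∈S)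
        ⁻¹′ : ∀ {x} → Member x → Member (x ⁻¹)
        ⁻¹′ (inj₁ x≈ε) = inj₁ (trans (⁻¹-cong x≈ε) (trans (sym (identityˡ _)) (inverseʳ ε)))
        ⁻¹′ (inj₂ (S , S∈F , x∈S)) = inj₂ (S , S∈F , ⁻¹-closed S∈F x∈S)
        ∙′ : ∀ {x y} → Member x → Member y → ⟪ ⋃ F ⟫ (x ∙ y)
        ∙′ (inj₁ x≈ε) y∈ = Level.lift (⌊⌋-true (resp′ (trans (sym (identityˡ _)) (∙-congʳ (sym x≈ε))) y∈))
        ∙′ x∈ (inj₁ y≈ε) = Level.lift (⌊⌋-true (resp′ (trans (sym (identityʳ _)) (∙-congˡ (sym y≈ε))) x∈))
        ∙′ (inj₂ (S , S∈F , x∈S)) (inj₂ (T , T∈F , y∈T)) with tower-total (t S S∈F) (t T T∈F)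
        ... | inj₁ S⊑T = ⊑-⋃ {F} {T} T∈F (∙-closed T∈F (S⊑T x∈S) y∈T)
        ... | inj₂ T⊑S = ⊑-⋃ {F} {S} S∈F (∙-closed S∈F x∈S (T⊑S y∈T))
        ⊆Q : Member ⊆ Q
        ⊆Q (inj₁ x≈ε)             = Q-resp (sym x≈ε) Qε
        ⊆Q (inj₂ (S , S∈F , x∈S)) = proj₂ (tower-isSubgroup (t S S∈F)) x∈S

      -- Excluded middle turns `Tower` into a Bool-valued family, so the union of the whole tower is
      -- itself a member of the tower.
      top : 𝒫
      top = ⋃ (λ S → ⌊ Tower S ⌋)

      top-tower : Tower top
      top-tower = sup _ (λ S → ⌊⌋-out)

      -- The set next top belongs to the tower and so lies in top, whereas any candidate would make
      -- it contain an element outside top.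
      top-maximal : ∀ c → adjoin ⟪ top ⟫ c ⊆ Q → ⟪ top ⟫ c
      top-maximal c c∈Q = dne λ c∉top → impossible (c , c∉top , c∈Q) (⊑-⋃ {λ S → ⌊ Tower S ⌋} {next top} (⌊⌋-true (step top-tower)))
        where
        impossible : ∃ (Candidate top) → ¬ next top ⊑ top
        impossible w next⊑top with em {P = ∃ (Candidate top)}
        ... | no none = none w
        ... | yes w′ = proj₁ (chosen-candidate top w′) (next⊑top (Level.lift (⌊⌋-true
              (generator∈adjoin (chosen top w′) (proj₁ (tower-isSubgroup top-tower))))))

    opaque
      maximal : Subgroup G
      maximal = toSubgroup (proj₁ (tower-isSubgroup top-tower))

    opaque
      unfolding maximal
      maximal⊆Q : Subgroup.member maximal ⊆ Q
      maximal⊆Q = proj₂ (tower-isSubgroup top-tower)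

      maximal-adjoin : ∀ c → adjoin (Subgroup.member maximal) c ⊆ Q → Subgroup.member maximal c
      maximal-adjoin = top-maximal

    -- If (n + 1) x lies in the subgroup, then so do the (n + 1)-fold multiples of everything
    -- generated by adjoining x. Root closure of Q keeps that extension inside Q, and maximality
    -- applies.
    maximal-pure : (∀ n {x} → Q (suc n · x) → Q x) →
      ∀ n {x} → Subgroup.member maximal (suc n · x) → Subgroup.member maximal x
    maximal-pure Q-pure n {x} nx∈ = maximal-adjoin x λ y∈ →
      Q-pure n (maximal⊆Q (adjoin-multiple n (isSubgroup maximal) nx∈ y∈))

-- Pure subgroups of divisible groups and their complements.

pure⇒isℚSubspace : ∀ {ℓ} (G : OrderedAbelianGroup ℓ) (A : Subgroup G) →
  let open OrderedAbelianGroup G in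
  (∀ n {x} → Subgroup.member A (suc n · x) → Subgroup.member A x) → IsℚSubspace G A
pure⇒isℚSubspace G A pure q x∈A qx≈y = pure (ℚ.denominator-1 q) (resp (sym qx≈y) (·ℤ-closed (↥ q) x∈A))
  where
  open OrderedAbelianGroup G
  open SubgroupLemmas G
  open IsSubgroup (isSubgroup A)
  ·ℤ-closed : ∀ z {x} → Subgroup.member A x → Subgroup.member A (_·ℤ_ G z x)
  ·ℤ-closed (+ n)    x∈A = ·-closed n x∈A
  ·ℤ-closed -[1+ n ] x∈A = ⁻¹-closed (·-closed (suc n) x∈A)

module _ (classical : Classical) {ℓ} (G : OrderedAbelianGroup ℓ) where
  open Classical classical renaming (excluded-middle to em)
  open OrderedAbelianGroup G
  open SubgroupLemmas G

  opaque
    -- Take A maximal with trivial intersection with S, a condition on single elements. If x is not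
    -- in A, then adjoining x produces a non-zero element of S, up to sign a + (k + 1) x with a in
    -- A. Divisibility and purity of A give a′ in A with (k + 1) a′ = a; then purity of S puts a′ +
    -- x into S, and x = - a′ + (a′ + x).
    pure-complement : {S : Pred Carrier ℓ} → IsSubgroup S → (∀ n {x} → S (suc n · x) → S x) →
      (∀ n x → ∃ λ y → suc n · y ≈ x) → Complement G S
    pure-complement {S} isS S-pure divide = record
      { subgroup    = maximal
      ; isℚSubspace = pure⇒isℚSubspace G maximal pure
      ; disjoint    = maximal⊆Q
      ; spanning    = spanning
      }
      where
      module S = IsSubgroup isS
      Q : Pred Carrier ℓ
      Q x = S x → x ≈ ε
      open MaximalSubgroup G classical Q
        (λ x≈y q y∈S → trans (sym x≈y) (q (S.resp (sym x≈y) y∈S))) (λ _ → refl)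
      A : Pred Carrier ℓ
      A = Subgroup.member maximal
      module A = IsSubgroup (isSubgroup maximal)
      pure : ∀ n {x} → A (suc n · x) → A x
      pure = maximal-pure (λ n q x∈S → torsion-free n (q (S.·-closed (suc n) x∈S)))
      spanning : ∀ x → ∃₂ λ a s → A a × S s × x ≈ a ∙ s
      spanning x with em {P = A x}
      ... | yes x∈A = x , ε , x∈A , S.ε∈ , sym (identityʳ x)
      ... | no  x∉A with em {P = ∃ λ y → adjoin A x y × S y × ¬ y ≈ ε}
      ...   | no none = contradiction (maximal-adjoin x λ {y} y∈ y∈S → trivial y y∈ y∈S) x∉A
        where
        trivial : ∀ y → adjoin A x y → S y → y ≈ ε
        trivial y y∈ y∈S with y ≟ ε
        ... | yes y≈ε = y≈ε
        ... | no  y≉ε = contradiction (y , y∈ , y∈S , y≉ε) none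
      ...   | yes (y , y∈ , y∈S , y≉ε) with adjoin-cases (isSubgroup maximal) y∈
      ...     | inj₁ y∈A = contradiction (maximal⊆Q y∈A y∈S) y≉ε
      ...     | inj₂ (a , k , a∈A , z , z≈y , z≈a∙kx) =
        a′ ⁻¹ , a′ ∙ x , A.⁻¹-closed (pure k (A.resp (sym (proj₂ (divide k a))) a∈A)) ,
        S-pure k (S.resp (sym (trans (×-distrib-+ _ _ (suc k)) (trans (∙-congʳ (proj₂ (divide k a))) (sym z≈a∙kx))))
          (z∈S z≈y)) , sym (x⁻¹∙xy a′ x)
        where
        a′ : Carrier
        a′ = proj₁ (divide k a)
        z∈S : z ≈ y ⊎ z ≈ y ⁻¹ → S z
        z∈S (inj₁ eq) = S.resp (sym eq) y∈S
        z∈S (inj₂ eq) = S.resp (sym eq) (S.⁻¹-closed y∈S)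

  archimedean : (∀ {x y} → ε < x → ε < y → ∃ λ n → y ≤ n · x) → IsArchimedean G
  archimedean f {x} {y} x≉ε y≉ε with f (ε<∣∣ x≉ε) (ε<∣∣ y≉ε) | f (ε<∣∣ y≉ε) (ε<∣∣ x≉ε)
    where open OrderedGroupProperties G
  ... | n , y≤nx | m , x≤my = n ℕ.+ m ,
    ≤-trans y≤nx (·-monoˡ-≤ (ℕₚ.m≤m+n n m) (ε≤∣∣ x)) ,
    ≤-trans x≤my (·-monoˡ-≤ (ℕₚ.m≤n+m m n) (ε≤∣∣ y))
    where open OrderedGroupProperties G

-- Strictly monotone homomorphisms and Archimedean classes.

module _ {ℓ} (G H : OrderedAbelianGroup ℓ) where
  open OrderedAbelianGroup G
  private module H = OrderedAbelianGroup H

  module Embedding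
    (f : Carrier → H.Carrier)
    (f-cong : ∀ {x y} → x ≈ y → f x H.≈ f y)
    (f-homo : ∀ x y → f (x ∙ y) H.≈ f x H.∙ f y)
    (f-mono : ∀ {x y} → x < y → f x H.< f y) where
    private
      module GP = OrderedGroupProperties G
      module HP = OrderedGroupProperties H
    open AbelianGroupProperties H.abelianGroup using (∙-cancelˡ; inverseʳ-unique)

    ε-homo : f ε H.≈ H.ε
    ε-homo = ∙-cancelˡ (f ε) _ _ (H.trans (H.sym (f-homo ε ε))
      (H.trans (f-cong (identityˡ ε)) (H.sym (H.identityʳ _))))

    ⁻¹-homo : ∀ x → f (x ⁻¹) H.≈ f x H.⁻¹
    ⁻¹-homo x = inverseʳ-unique _ _ (H.trans (H.sym (f-homo x (x ⁻¹)))
      (H.trans (f-cong (inverseʳ x)) ε-homo))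

    ·-homo : ∀ n x → f (n · x) H.≈ n H.· f x
    ·-homo zero    x = ε-homo
    ·-homo (suc n) x = H.trans (f-homo x (n · x)) (H.∙-congˡ (·-homo n x))

    cancel : ∀ {x y} → f x H.< f y → x < y
    cancel {x} {y} fx<fy with compare x y
    ... | tri< p _ _ = p
    ... | tri≈ _ p _ = contradiction fx<fy (H.irrefl (f-cong p))
    ... | tri> _ _ p = contradiction (f-mono p) (H.asym fx<fy)

    injective : ∀ {x y} → f x H.≈ f y → x ≈ y
    injective {x} {y} fx≈fy with compare x y
    ... | tri< p _ _ = contradiction (f-mono p) (H.irrefl fx≈fy)
    ... | tri≈ _ p _ = p
    ... | tri> _ _ p = contradiction (f-mono p) (H.irrefl (H.sym fx≈fy))

    nonZero : ∀ {x} → NonZero x → H.NonZero (f x)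
    nonZero x≉ε fx≈ε = x≉ε (injective (H.trans fx≈ε (H.sym ε-homo)))

    positive : ∀ {x} → ε < x → H.ε H.< f x
    positive p = H.<-respˡ-≈ ε-homo (f-mono p)

    ∣∣-homo : ∀ x → f ∣ x ∣ H.≈ H.∣ f x ∣
    ∣∣-homo x with compare x ε
    ... | tri< p _ _ = H.trans (⁻¹-homo x) (H.sym (HP.∣∣-neg (H.<-respʳ-≈ ε-homo (f-mono p))))
    ... | tri≈ _ p _ = H.sym (HP.∣∣-nonneg (inj₂ (H.sym (H.trans (f-cong p) ε-homo))))
    ... | tri> _ _ p = H.sym (HP.∣∣-nonneg (inj₁ (positive p)))

    private
      ·∣∣-homo : ∀ n x → f (n · ∣ x ∣) H.≈ n H.· H.∣ f x ∣
      ·∣∣-homo n x = H.trans (·-homo n ∣ x ∣) (HP.×-congʳ n (∣∣-homo x))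

      ≤-to : ∀ {x y x′ y′} → f x H.≈ x′ → f y H.≈ y′ → x ≤ y → x′ H.≤ y′
      ≤-to eq eq′ (inj₁ p) = inj₁ (H.<-respˡ-≈ eq (H.<-respʳ-≈ eq′ (f-mono p)))
      ≤-to eq eq′ (inj₂ p) = inj₂ (H.trans (H.sym eq) (H.trans (f-cong p) eq′))

      ≤-from : ∀ {x y x′ y′} → f x H.≈ x′ → f y H.≈ y′ → x′ H.≤ y′ → x ≤ y
      ≤-from eq eq′ (inj₁ p) = inj₁ (cancel (H.<-respˡ-≈ (H.sym eq) (H.<-respʳ-≈ (H.sym eq′) p)))
      ≤-from eq eq′ (inj₂ p) = inj₂ (injective (H.trans eq (H.trans p (H.sym eq′))))

    ∼-homo : ∀ {x y} → x ∼ y → f x H.∼ f y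
    ∼-homo {x} {y} (n , p , q) = n , ≤-to (∣∣-homo y) (·∣∣-homo n x) p , ≤-to (∣∣-homo x) (·∣∣-homo n y) q

    ∼-cancel : ∀ {x y} → f x H.∼ f y → x ∼ y
    ∼-cancel {x} {y} (n , p , q) = n , ≤-from (∣∣-homo y) (·∣∣-homo n x) p , ≤-from (∣∣-homo x) (·∣∣-homo n y) q

    ≪-homo : ∀ {x y} → x ≪ y → f x H.≪ f y
    ≪-homo {x} {y} p n = H.<-respˡ-≈ (·∣∣-homo n x) (H.<-respʳ-≈ (∣∣-homo y) (f-mono (p n)))

    ≪-cancel : ∀ {x y} → f x H.≪ f y → x ≪ y
    ≪-cancel {x} {y} p n = cancel (H.<-respˡ-≈ (H.sym (·∣∣-homo n x)) (H.<-respʳ-≈ (H.sym (∣∣-homo y)) (p n)))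

    isomorphism : (∀ y → ∃ λ x → f x H.≈ y) → G ≅ᵍ H
    isomorphism onto = record
      { to = f
      ; isGroupIsomorphism = record
        { isGroupMonomorphism = record
          { isGroupHomomorphism = record
            { isMonoidHomomorphism = record
              { isMagmaHomomorphism = record
                { isRelHomomorphism = record { cong = f-cong }
                ; homo              = f-homo
                }
              ; ε-homo = ε-homo
              }
            ; ⁻¹-homo = ⁻¹-homo
            }
          ; injective = injective
          }
        ; surjective = surjective
        }
      ; isOrderIsomorphism = record
        { isOrderMonomorphism = record
          { isOrderHomomorphism = record { cong = f-cong ; mono = f-mono }
          ; injective           = injective
          ; cancel              = cancel
          }
        ; surjective = surjective
        }
      }
      where
      surjective : ∀ y → ∃ λ x → ∀ {z} → z ≈ x → f z H.≈ y
      surjective y = proj₁ (onto y) , λ z≈x → H.trans (f-cong z≈x) (proj₂ (onto y))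

module Inclusion {ℓ} (G : OrderedAbelianGroup ℓ) (A : Subgroup G) =
  Embedding (Subgroup.orderedAbelianGroup A) G proj₁ (λ p → p)
    (λ _ _ → OrderedAbelianGroup.refl G) (λ p → p)

-- Roots of positive elements of a real closed field.

module RealClosedRoots {ℓ} (K : OrderedField ℓ) (isRealClosed : IsRealClosed K) where
  open OrderedField K
  open OrderedFieldProperties K
  open IsRealClosed isRealClosed
  open MonoidMultiplication *-monoid
    using () renaming (_×_ to pow; ×-homo-+ to pow-+)

  monomial : ∀ n → Vec Carrier (suc n)
  monomial zero    = 1# ∷ []
  monomial (suc n) = 0# ∷ monomial n

  eval-monomial : ∀ n x → eval (monomial n) x ≈ pow n x
  eval-monomial zero    x = trans (+-congˡ (zeroʳ x)) (+-identityʳ 1#)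
  eval-monomial (suc n) x = trans (+-identityˡ _) (*-congˡ (eval-monomial n x))

  last-monomial : ∀ n x → last (x ∷ monomial n) ≡ 1#
  last-monomial zero    x = ≡.refl
  last-monomial (suc n) x = last-monomial n 0#

  Root : ℕ → Set ℓ
  Root n = ∀ {x} → 0# < x → ∃ λ y → 0# < y × pow n y ≈ x

  -- The polynomial of degree 2k + 1 with constant term - x has a root y, and y is positive because
  -- it becomes x > 0 after multiplication by the square of its k-th power.
  odd-root-pos : ∀ k → Root (suc (2 ℕ.* k))
  odd-root-pos k {x} 0<x with odd-root k (- x ∷ monomial (2 ℕ.* k))
    (λ eq → 1≉0 (trans (sym (reflexive (last-monomial (2 ℕ.* k) (- x)))) eq))
  ... | y , eq = y , *-cancelʳ-pos 0<square (<-respʳ-≈ (trans (sym y*≈x) (*-comm _ _)) 0<x) , y*≈x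
    where
    y*≈x : y * pow (2 ℕ.* k) y ≈ x
    y*≈x = begin-equality
      y * pow (2 ℕ.* k) y                   ≈⟨ *-congˡ (eval-monomial (2 ℕ.* k) y) ⟨
      y * eval (monomial (2 ℕ.* k)) y       ≈⟨ +-identityʳ _ ⟨
      y * eval (monomial (2 ℕ.* k)) y + 0#  ≈⟨ +-congˡ (-‿inverseˡ x) ⟨
      y * eval (monomial (2 ℕ.* k)) y + (- x + x)  ≈⟨ +-assoc _ _ _ ⟨
      (y * eval (monomial (2 ℕ.* k)) y + - x) + x  ≈⟨ +-congʳ (trans (+-comm _ _) eq) ⟩
      0# + x                                ≈⟨ +-identityˡ x ⟩
      x                                     ∎
    pow≉0 : NonZero (pow (2 ℕ.* k) y)
    pow≉0 p≈0 = irrefl (trans (sym (trans (*-congˡ p≈0) (zeroʳ y))) y*≈x) 0<x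
    square-nonneg : ∀ z → 0# ≤ z * z
    square-nonneg z with compare z 0#
    ... | tri< z<0 _ _ = <⇒≤ (<-respʳ-≈ (trans (sym (-‿distribˡ-* z (- z)))
            (trans (-‿cong (sym (-‿distribʳ-* z z))) (-‿involutive _)))
            (*-pos (<ε⇒ε<⁻¹ z<0) (<ε⇒ε<⁻¹ z<0)))
    ... | tri≈ _ z≈0 _ = inj₂ (sym (trans (*-congˡ z≈0) (zeroʳ z)))
    ... | tri> _ _ 0<z = <⇒≤ (*-pos 0<z 0<z)
    square : pow k y * pow k y ≈ pow (2 ℕ.* k) y
    square = trans (sym (pow-+ y k k))
      (reflexive (≡.cong (λ j → pow (k ℕ.+ j) y) (≡.sym (ℕₚ.+-identityʳ k))))
    0<square : 0# < pow (2 ℕ.* k) y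
    0<square with square-nonneg (pow k y)
    ... | inj₁ p = <-respʳ-≈ square p
    ... | inj₂ p = contradiction (trans (sym square) (sym p)) pow≉0

  sqrt-pos : ∀ {x} → 0# < x → ∃ λ y → 0# < y × y * y ≈ x
  sqrt-pos {x} 0<x with sqrt 0<x
  ... | y , yy≈x = ∣ y ∣ , ε<∣∣ (λ y≈0 → irrefl (trans (sym (trans (*-congˡ y≈0) (zeroʳ y))) yy≈x) 0<x) ,
    trans (sym (∣*∣ y y)) (trans (∣∣-cong yy≈x) (∣∣-nonneg (inj₁ 0<x)))

  -- The exponent is n + 1. It is odd for n = 2k; for n = 2k + 1 it is 2 (k + 1), and the (k + 1)-th
  -- root of a positive square root is taken.
  root : ∀ n → Root (suc n)
  root = <-rec (λ n → Root (suc n)) λ n rec → by-parity n rec (parity n)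
    where
    parity : ∀ n → ∃ λ k → n ≡ 2 ℕ.* k ⊎ n ≡ suc (2 ℕ.* k)
    parity zero = 0 , inj₁ ≡.refl
    parity (suc n) with parity n
    ... | k , inj₁ ≡.refl = k , inj₂ ≡.refl
    ... | k , inj₂ ≡.refl = suc k , inj₁ (≡.sym (ℕₚ.*-suc 2 k))
    by-parity : ∀ n → (∀ {m} → m ℕ.< n → Root (suc m)) →
                (∃ λ k → n ≡ 2 ℕ.* k ⊎ n ≡ suc (2 ℕ.* k)) → Root (suc n)
    by-parity n rec (k , inj₁ ≡.refl) = odd-root-pos k
    by-parity n rec (k , inj₂ ≡.refl) 0<x with sqrt-pos 0<x
    ... | z , 0<z , zz≈x with rec (ℕ.s≤s (ℕₚ.m≤m+n k (k ℕ.+ 0))) 0<z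
    ...   | y , 0<y , yᵏ≈z = y , 0<y , trans
      (reflexive (≡.cong (λ j → pow j y) (≡.cong suc (≡.trans (≡.cong (λ j → suc (k ℕ.+ j)) (ℕₚ.+-identityʳ k)) (≡.sym (ℕₚ.+-suc k k))))))
      (trans (pow-+ y (suc k) (suc k)) (trans (*-cong yᵏ≈z yᵏ≈z) zz≈x))

  positiveGroup-divisible : (em : ExcludedMiddle ℓ) →
    let open OrderedAbelianGroup (positiveGroup em K) renaming (Carrier to P; _≈_ to _≈ᵖ_; _·_ to _·ᵖ_) in
    ∀ n (x : P) → ∃ λ y → (suc n ·ᵖ y) ≈ᵖ x
  positiveGroup-divisible em n (x , 0<x) with root n 0<x
  ... | y , 0<y , yⁿ≈x = (y , 0<y) , trans (pow-val (suc n)) yⁿ≈x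
    where
    open OrderedAbelianGroup (positiveGroup em K) renaming (_·_ to _·ᵖ_) using ()
    pow-val : ∀ n → proj₁ (n ·ᵖ (y , 0<y)) ≈ pow n y
    pow-val zero    = refl
    pow-val (suc n) = *-congˡ (pow-val n)

-- Bounded elements and Archimedean equivalence.

module BoundedLemmas {ℓ} (K : OrderedField ℓ) where
  open OrderedField K
  open OrderedFieldProperties K
  open OrderedRingLemmas orderedRing
  private module KL = SubgroupLemmas additiveGroup

  bounded-≤ : ∀ {x y} → ∣ x ∣ ≤ ∣ y ∣ → Bounded y → Bounded x
  bounded-≤ p (n , q) = n , ≤-trans p q

  bounded-resp : ∀ {x y} → x ≈ y → Bounded x → Bounded y
  bounded-resp x≈y = bounded-≤ (inj₂ (∣∣-cong (sym x≈y)))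

  ∼⇒bounded : ∀ {x} → x ∼ 1# → Bounded x
  ∼⇒bounded (n , _ , q) = n , q

  bounded-squeeze : ∀ {x y} → 0# ≤ x → x ≤ y → Bounded y → Bounded x
  bounded-squeeze {x} {y} 0≤x x≤y = bounded-≤ (begin
    ∣ x ∣  ≈⟨ ∣∣-nonneg 0≤x ⟩
    x      ≤⟨ x≤y ⟩
    y      ≤⟨ x≤∣x∣ y ⟩
    ∣ y ∣  ∎)

  ≥1-bounded⇒∼1 : ∀ {x} → 1# ≤ x → Bounded x → x ∼ 1#
  ≥1-bounded⇒∼1 {x} 1≤x (n , p) = 1 ℕ.+ n , (begin
      ∣ 1# ∣             ≈⟨ ∣1∣ ⟩
      1#                 ≤⟨ 1≤x ⟩
      x                  ≤⟨ x≤∣x∣ x ⟩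
      ∣ x ∣              ≤⟨ ≤1· ≤-refl ⟩
      1 · ∣ x ∣          ≤⟨ ·-monoˡ-≤ (ℕₚ.m≤m+n 1 n) (ε≤∣∣ x) ⟩
      (1 ℕ.+ n) · ∣ x ∣  ∎)
    , ≤-trans p (·-monoˡ-≤ (ℕₚ.m≤n+m n 1) (ε≤∣∣ 1#))

  unbounded⇒1≪ : ∀ {x} → ¬ Bounded x → 1# ≪ x
  unbounded⇒1≪ ¬b n = ≰⇒> (λ p → ¬b (n , p))

  1≪⇒unbounded : ∀ {x} → 1# ≪ x → ¬ Bounded x
  1≪⇒unbounded 1≪x (n , p) = <⇒≱ (1≪x n) p

  ∼-cancelʳ : ∀ {x y z} → NonZero z → x * z ∼ y * z → x ∼ y
  ∼-cancelʳ {x} {y} {z} z≉0 p = ∼-trans (≈⇒∼ (sym (cancel x)))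
    (∼-trans (*-cong-∼ p ∼-refl) (≈⇒∼ (cancel y)))
    where
    cancel : ∀ x → (x * z) * recip z≉0 ≈ x
    cancel x = trans (*-assoc _ _ _) (trans (*-congˡ (*-recipʳ z≉0)) (*-identityʳ x))

  divide : ∀ n x → ∃ λ y → suc n · y ≈ x
  divide n x = x * recip n≉0 , (begin-equality
    suc n · (x * recip n≉0)            ≈⟨ ×-comm-* (suc n) x _ ⟨
    x * (suc n · recip n≉0)            ≈⟨ *-congˡ (×-congʳ (suc n) (*-identityˡ _)) ⟨
    x * (suc n · (1# * recip n≉0))     ≈⟨ *-congˡ (×-assoc-* (suc n) 1# _) ⟨
    x * (suc n · 1# * recip n≉0)       ≈⟨ *-congˡ (*-recipʳ n≉0) ⟩
    x * 1#                             ≈⟨ *-identityʳ x ⟩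
    x                                  ∎)
    where
    n≉0 : NonZero (suc n · 1#)
    n≉0 eq = 1≉0 (KL.torsion-free n eq)

  multiple-bounded : ∀ n {x} → Bounded x → Bounded (n · x)
  multiple-bounded n {x} (m , x≤m) = n ℕ.* m , (begin
    ∣ n · x ∣             ≈⟨ KL.∣multiple∣ n x ⟩
    n · ∣ x ∣             ≤⟨ ·-mono-≤ n x≤m ⟩
    n · (m · ∣ 1# ∣)      ≈⟨ ×-assocˡ _ n m ⟩
    (n ℕ.* m) · ∣ 1# ∣    ∎)

-- The exponential correspondence on K.

-- x ↔ y says that y is 2ˣ up to bounded factors, where x may be replaced by
-- the integers n - n′ at bounded distance from x.
module Correspondence {ℓ} (K : OrderedField ℓ) (Z : IntegerPart K)
  (pa : ConeModelsPA (IntegerPart.orderedRing Z)) where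
  open OrderedField K
  open OrderedFieldProperties K
  open BoundedLemmas K
  open DifferenceSolver commutativeRing using (solve; _:=_; _:+_; _:*_; :-_; :1; :0)
  open IntegerPart Z using (floor) renaming (orderedRing to ℤₖ)
  private module Zₚ = IntegerPart Z
  open PeanoExponential ℤₖ pa
  private module ZL = OrderedRingLemmas.Discrete ℤₖ (ConeModelsPA.isDiscrete pa)

  val : M → Carrier
  val n = proj₁ (proj₁ n)

  infix 4 _↔_
  opaque
    _↔_ : Carrier → Carrier → Set ℓ
    x ↔ y = ∃₂ λ (n n′ : M) → ∃₂ λ (p p′ : M) → Exp p n × Exp p′ n′ ×
      Bounded (x + - (val n + - val n′)) × (y * val p′ ∼ val p)

  opaque
    unfolding _↔_

    ↔-resp : ∀ {x x′ y y′} → Bounded (x′ + - x) → y ∼ y′ → x ↔ y → x′ ↔ y′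
    ↔-resp {x} {x′} b y∼y′ (n , n′ , p , p′ , E , E′ , b′ , c) = n , n′ , p , p′ , E , E′ ,
      bounded-resp (minus-trans x′ x (val n + - val n′)) (+-bounded b b′) ,
      ∼-trans (*-cong-∼ (∼-sym y∼y′) ∼-refl) c

    ↔-+ : ∀ {x x′ y y′} → x ↔ y → x′ ↔ y′ → x + x′ ↔ y * y′
    ↔-+ {x} {x′} {y} {y′} (n₁ , n₁′ , p₁ , p₁′ , E₁ , E₁′ , b₁ , c₁) (n₂ , n₂′ , p₂ , p₂′ , E₂ , E₂′ , b₂ , c₂) =
      n₁ +ᴹ n₂ , n₁′ +ᴹ n₂′ , p₁ *ᴹ p₂ , p₁′ *ᴹ p₂′ ,
      exp-+ {p₁} {p₂} {n₁} {n₂} E₁ E₂ , exp-+ {p₁′} {p₂′} {n₁′} {n₂′} E₁′ E₂′ ,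
      bounded-resp (solve 6 (λ x x′ a a′ b b′ →
        (x :+ :- (a :+ :- a′)) :+ (x′ :+ :- (b :+ :- b′)) :=
        (x :+ x′) :+ :- ((a :+ b) :+ :- (a′ :+ b′))) refl x x′ (val n₁) (val n₁′) (val n₂) (val n₂′))
        (+-bounded b₁ b₂) ,
      ∼-trans (≈⇒∼ (solve 4 (λ y y′ p p′ → (y :* y′) :* (p :* p′) := (y :* p) :* (y′ :* p′))
        refl y y′ (val p₁′) (val p₂′))) (*-cong-∼ c₁ c₂)

    ↔-neg : ∀ {x y y′} → y * y′ ∼ 1# → x ↔ y → - x ↔ y′
    ↔-neg {x} {y} {y′} inv (n , n′ , p , p′ , E , E′ , b , c) = n′ , n , p′ , p , E′ , E ,
      bounded-resp (solve 3 (λ x a b → :- (x :+ :- (a :+ :- b)) := :- x :+ :- (b :+ :- a))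
        refl x (val n) (val n′)) (neg-bounded b) ,
      ∼-trans (*-cong-∼ ∼-refl (∼-sym c)) (∼-trans
        (≈⇒∼ (solve 3 (λ y y′ p → y′ :* (y :* p) := (y :* y′) :* p) refl y y′ (val p′)))
        (∼-trans (*-cong-∼ inv ∼-refl) (≈⇒∼ (*-identityˡ _))))

    floor-bounded : ∀ {x z} → z ≤ x → x < z + 1# → Bounded (x + - z)
    floor-bounded {x} {z} z≤x x<z+1 = bounded-squeeze
      (≤-trans (inj₂ (sym (-‿inverseʳ z))) (∙-monoˡ-≤ (- z) z≤x))
      (inj₁ (<-respʳ-≈ (solve 1 (λ z → z :+ :1 :+ :- z := :1) refl z) (+-monoˡ-< (- z) x<z+1)))
      1-bounded

    -- The integer part z of x is at bounded distance from x; for negative z the power of two with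
    -- exponent - z is inverted.
    ↔-totalˡ : ∀ x → ∃ λ y → 0# < y × x ↔ y
    ↔-totalˡ x with floor x
    ... | z , z∈Z , z≤x , x<z+1 = split (compare 0# z)
      where
      x-z : Bounded (x + - z)
      x-z = floor-bounded z≤x x<z+1
      split : Tri (0# < z) (0# ≈ z) (z < 0#) → ∃ λ y → 0# < y × x ↔ y
      split (tri> _ _ z<0) = from-negative (exp-total n)
        where
        n : M
        n = (- z , Zₚ.neg-closed z∈Z) , inj₁ (<ε⇒ε<⁻¹ z<0)
        from-negative : (∃ λ (p : M) → Exp p n × val n < val p) → ∃ λ y → 0# < y × x ↔ y
        from-negative (p , E , n<p) = recip (0<⇒nonZero 0<p) , recip-pos 0<p ,
          0ᴹ , n , 1ᴹ , p , exp-0 , E ,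
          bounded-resp (solve 2 (λ x z → x :+ :- z := x :+ :- (:0 :+ :- (:- z))) refl x z) x-z ,
          ≈⇒∼ (*-recipˡ _)
          where
          0<p : 0# < val p
          0<p = exp-pos {p} {n} E
      split (tri≈ _ 0≈z _) = 1# , 0<1 , 0ᴹ , 0ᴹ , 1ᴹ , 1ᴹ , exp-0 , exp-0 ,
        bounded-resp (trans (+-congˡ (-‿cong (sym 0≈z)))
          (solve 1 (λ x → x :+ :- :0 := x :+ :- (:0 :+ :- :0)) refl x)) x-z ,
        ≈⇒∼ (*-identityˡ 1#)
      split (tri< 0<z _ _) = from-positive (exp-total n)
        where
        n : M
        n = (z , z∈Z) , inj₁ 0<z
        from-positive : (∃ λ (p : M) → Exp p n × val n < val p) → ∃ λ y → 0# < y × x ↔ y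
        from-positive (p , E , n<p) = val p , exp-pos {p} {n} E ,
          n , 0ᴹ , p , 1ᴹ , E , exp-0 ,
          bounded-resp (solve 2 (λ x z → x :+ :- z := x :+ :- (z :+ :- :0)) refl x z) x-z ,
          ≈⇒∼ (*-identityʳ _)

    private
      ↔-totalʳ-≥1 : ∀ {y} → 1# ≤ ∣ y ∣ → ∃ λ x → x ↔ y
      ↔-totalʳ-≥1 {y} 1≤y with floor ∣ y ∣
      ... | z , z∈Z , z≤y , y<z+1 = cover (exp-cover n 0<z)
        where
        0<z : 0# < z
        0<z = <-respˡ-≈ (-‿inverseʳ 1#) (<-respʳ-≈ (solve 1 (λ z → z :+ :1 :+ :- :1 := z) refl z)
          (+-monoˡ-< (- 1#) (≤-<-trans 1≤y y<z+1)))
        n : M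
        n = (z , z∈Z) , inj₁ 0<z
        cover : (∃₂ λ (p m : M) → Exp p m × val p ≤ z × z < val p + val p) → ∃ λ x → x ↔ y
        cover (p , m , E , p≤z , z<2p) = val m , m , 0ᴹ , p , 1ᴹ , E , exp-0 ,
          bounded-resp (solve 1 (λ m → :0 := m :+ :- (m :+ :- :0)) refl (val m)) 0-bounded ,
          ∼-trans (≈⇒∼ (*-identityʳ y)) (2 ,
            (begin
              ∣ val p ∣    ≈⟨ ∣∣-nonneg (proj₂ p) ⟩
              val p        ≤⟨ p≤z ⟩
              z            ≤⟨ z≤y ⟩
              ∣ y ∣        ≤⟨ ≤1· ≤-refl ⟩
              1 · ∣ y ∣    ≤⟨ ·-monoˡ-≤ {1} {2} (ℕ.s≤s ℕ.z≤n) (ε≤∣∣ y) ⟩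
              2 · ∣ y ∣    ∎) ,
            (begin
              ∣ y ∣             ≤⟨ inj₁ y<z+1 ⟩
              -- Discreteness turns z < 2p into z + 1 ≤ 2p, so the bound 2 survives the rounding of
              -- the absolute value of y to z.
              z + 1#            ≤⟨ ZL.<⇒+1≤ {proj₁ n} {proj₁ (p +ᴹ p)} z<2p ⟩
              val p + val p     ≈⟨ +-congˡ (+-identityʳ _) ⟨
              2 · val p         ≈⟨ ×-congʳ 2 (∣∣-nonneg (proj₂ p)) ⟨
              2 · ∣ val p ∣     ∎))

    ↔-totalʳ : ∀ {y} → NonZero y → ∃ λ x → x ↔ y
    ↔-totalʳ {y} y≉0 with compare ∣ y ∣ 1#
    ... | tri> _ _ p = ↔-totalʳ-≥1 (inj₁ p)
    ... | tri≈ _ p _ = ↔-totalʳ-≥1 (inj₂ (sym p))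
    ... | tri< ∣y∣<1 _ _ = - x , ↔-neg (≈⇒∼ (*-recipˡ y≉0)) (proj₂ inverse)
      where
      1≤∣recip∣ : 1# ≤ ∣ recip y≉0 ∣
      1≤∣recip∣ = begin
        1#                       ≈⟨ ∣1∣ ⟨
        ∣ 1# ∣                   ≈⟨ ∣∣-cong (*-recipʳ y≉0) ⟨
        ∣ y * recip y≉0 ∣        ≈⟨ ∣*∣ y _ ⟩
        ∣ y ∣ * ∣ recip y≉0 ∣    ≤⟨ *-monoˡ-≤ (ε≤∣∣ _) (inj₁ ∣y∣<1) ⟩
        1# * ∣ recip y≉0 ∣       ≈⟨ *-identityˡ _ ⟩
        ∣ recip y≉0 ∣            ∎
      inverse : ∃ λ x → x ↔ recip y≉0
      inverse = ↔-totalʳ-≥1 1≤∣recip∣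
      x : Carrier
      x = proj₁ inverse

  exp-≥1 : ∀ {p n : M} → Exp p n → 1# ≤ val p
  exp-≥1 {p} {n} E = ZL.0<⇒1≤ {proj₁ p} (exp-pos {p} {n} E)

  -- Induction on the standard bound N: lowering n by 1 halves the power, and doubling preserves
  -- boundedness.
  exp-bounded : ∀ {p n : M} → Exp p n → Bounded (val n) → Bounded (val p)
  exp-bounded {p} {n} E (N , n≤N) = standard N n p E
    (≤-trans (x≤∣x∣ _) (≤-trans n≤N (inj₂ (×-congʳ N ∣1∣))))
    where
    standard : ∀ N (n p : M) → Exp p n → val n ≤ N · 1# → Bounded (val p)
    standard′ : ∀ N (n p : M) → Exp p n → val n ≤ N · 1# → 0# < val n → Bounded (val p)
    standard N n p E n≤N with proj₂ n
    ... | inj₂ 0≈n = bounded-resp (exp-unique {1ᴹ} {p} {n} (exp-resp {1ᴹ} {1ᴹ} {0ᴹ} {n} refl 0≈n exp-0) E) 1-bounded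
    ... | inj₁ 0<n = standard′ N n p E n≤N 0<n
    standard′ zero    n p E n≤N 0<n = contradiction n≤N (<⇒≱ 0<n)
    standard′ (suc N) n p E n≤N 0<n = double (exp-total m)
      where
      m : M
      m = OrderedRing._+_ ℤₖ (proj₁ n) (OrderedRing.-_ ℤₖ (OrderedRing.1# ℤₖ)) ,
        ≤-trans (inj₂ (sym (-‿inverseʳ 1#))) (∙-monoˡ-≤ (- 1#) (ZL.0<⇒1≤ {proj₁ n} 0<n))
      m≤N : val m ≤ N · 1#
      m≤N = ≤-trans (∙-monoˡ-≤ (- 1#) n≤N)
        (inj₂ (solve 1 (λ x → (:1 :+ x) :+ :- :1 := x) refl (N · 1#)))
      double : (∃ λ (q : M) → Exp q m × val m < val q) → Bounded (val p)
      double (q , E′ , _) = bounded-resp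
        (exp-unique {q +ᴹ q} {p} {n} (exp-resp {q +ᴹ q} {q +ᴹ q} {m +ᴹ 1ᴹ} {n} refl
          (solve 1 (λ x → (x :+ :- :1) :+ :1 := x) refl (val n)) (exp-suc {q} {m} E′)) E)
        (+-bounded bq bq)
        where
        bq : Bounded (val q)
        bq = standard N m q E′ m≤N

  -- Collapsing n - n′ to a single w with a sign allows the sizes of w and of its power to be
  -- compared directly.
  data Normal (x y : Carrier) : Set ℓ where
    nonnegative : (w p : M) → Exp p w → Bounded (x + - val w) → y ∼ val p → Normal x y
    nonpositive : (w p : M) → Exp p w → Bounded (x + val w) → y * val p ∼ 1# → Normal x y

  opaque
    unfolding _↔_

    normalise : ∀ {x y} → x ↔ y → Normal x y
    normalise {x} {y} (n , n′ , p , p′ , E , E′ , b , c) = split (OrderedAbelianGroup.≤-total additiveGroup (val n′) (val n))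
      where
      difference : ∀ (a b : M) → val a ≤ val b → M
      difference a b a≤b = OrderedRing._+_ ℤₖ (proj₁ b) (OrderedRing.-_ ℤₖ (proj₁ a)) ,
        ≤-trans (inj₂ (sym (-‿inverseʳ (val a)))) (∙-monoˡ-≤ (- val a) a≤b)
      -- The quotient is the power with exponent b - a, which exists by totality; the sum law and
      -- uniqueness give the factorisation.
      quotient : ∀ {a b r s : M} (a≤b : val a ≤ val b) → Exp r a → Exp s b →
                 ∃ λ (q : M) → Exp q (difference a b a≤b) × val s ≈ val r * val q
      quotient {a} {b} {r} {s} a≤b R S with exp-total (difference a b a≤b)
      ... | q , Q , _ = q , Q , exp-unique {s} {r *ᴹ q} {b} S
        (exp-resp {r *ᴹ q} {r *ᴹ q} {a +ᴹ difference a b a≤b} {b} refl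
          (solve 2 (λ a b → a :+ (b :+ :- a) := b) refl (val a) (val b))
          (exp-+ {r} {q} {a} {difference a b a≤b} R Q))
      split : val n′ ≤ val n ⊎ val n ≤ val n′ → Normal x y
      split (inj₁ n′≤n) with quotient {n′} {n} {p′} {p} n′≤n E′ E
      ... | q , Q , p≈p′q = nonnegative (difference n′ n n′≤n) q Q b
        (∼-cancelʳ (0<⇒nonZero (exp-pos {p′} {n′} E′)) (∼-trans c (≈⇒∼ (trans p≈p′q (*-comm _ _)))))
      split (inj₂ n≤n′) with quotient {n} {n′} {p} {p′} n≤n′ E E′
      ... | q , Q , p′≈pq = nonpositive (difference n n′ n≤n′) q Q
        (bounded-resp (solve 3 (λ x n n′ → x :+ :- (n :+ :- n′) := x :+ (n′ :+ :- n)) refl x (val n) (val n′)) b)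
        (∼-cancelʳ (0<⇒nonZero (exp-pos {p} {n} E)) (∼-trans
          (≈⇒∼ (trans (*-assoc _ _ _) (*-congˡ (trans (*-comm _ _) (sym p′≈pq)))))
          (∼-trans c (≈⇒∼ (sym (*-identityˡ _))))))

  -- The integer w is then bounded, so its power is bounded and at least 1, hence equivalent to 1.
  ↔-bounded : ∀ {x y} → x ↔ y → Bounded x → y ∼ 1#
  ↔-bounded {x} {y} x↔y bx with normalise x↔y
  ... | nonnegative w p E b y∼p = ∼-trans y∼p (≥1-bounded⇒∼1 (exp-≥1 {p} {w} E) (exp-bounded {p} {w} E
          (bounded-resp (solve 2 (λ x w → x :+ :- (x :+ :- w) := w) refl x (val w)) (+-bounded bx (neg-bounded b)))))
  ... | nonpositive w p E b yp∼1 = ∼-trans (≈⇒∼ (sym (*-identityʳ y))) (∼-trans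
          (*-cong-∼ ∼-refl (∼-sym (≥1-bounded⇒∼1 (exp-≥1 {p} {w} E) (exp-bounded {p} {w} E
            (bounded-resp (solve 2 (λ x w → (x :+ w) :+ :- x := w) refl x (val w)) (+-bounded b (neg-bounded bx)))))))
          yp∼1)

  -- In the nonpositive case 0 < x ≤ x + w would bound x. In the other case w is unbounded, and its
  -- power exceeds w.
  ↔-unbounded : ∀ {x y} → x ↔ y → 0# < x → ¬ Bounded x → 1# ≪ y
  ↔-unbounded {x} {y} x↔y 0<x ¬bx with normalise x↔y
  ... | nonpositive w p E b _ = contradiction (bounded-squeeze (inj₁ 0<x)
          (≤-trans (inj₂ (sym (+-identityʳ x))) (∙-monoʳ-≤ x (proj₂ w))) b) ¬bx
  ... | nonnegative w p E b y∼p = ≪-∼-trans (unbounded⇒1≪ ¬bp) (∼-sym y∼p)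
    where
    w<p : val w < val p
    w<p with exp-total w
    ... | q , Q , w<q = <-respʳ-≈ (exp-unique {q} {p} {w} Q E) w<q
    ¬bp : ¬ Bounded (val p)
    ¬bp bp = ¬bx (bounded-resp (-+-cancel (val w) x) (+-bounded b (bounded-squeeze (proj₂ w) (inj₁ w<p) bp)))

-- Left exponentiation.

module LeftExponential (classical : Classical) {ℓ} (em : ExcludedMiddle ℓ) (K : OrderedField ℓ) (isRealClosed : IsRealClosed K)
  (Z : IntegerPart K) (pa : ConeModelsPA (IntegerPart.orderedRing Z)) where
  open OrderedField K
  open OrderedFieldProperties K
  open BoundedLemmas K
  open Correspondence K Z pa

  private
    P : OrderedAbelianGroup ℓ
    P = positiveGroup em K
    module P = OrderedAbelianGroup P
    module KL = SubgroupLemmas additiveGroup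
    module G = OrderedAbelianGroup (valueGroup em K)
    module GL = SubgroupLemmas (valueGroup em K)

  unit⇒∼1 : ∀ {a} → positiveUnits em K a → proj₁ a ∼ 1#
  unit⇒∼1 {a , _} p with a ≟ 0# | p
  ... | no _ | SupremumEquality.[ a∼1 ] = a∼1

  ∼1⇒unit : ∀ {a} → proj₁ a ∼ 1# → positiveUnits em K a
  ∼1⇒unit {a , 0<a} a∼1 with a ≟ 0#
  ... | yes a≈0 = contradiction 0<a (irrefl (sym a≈0))
  ... | no _    = SupremumEquality.[ a∼1 ]

  ∼1-recip : ∀ {x} (x≉0 : NonZero x) → x ∼ 1# → recip x≉0 ∼ 1#
  ∼1-recip x≉0 x∼1 = ∼-trans (≈⇒∼ (sym (*-identityʳ _)))
    (∼-trans (*-cong-∼ ∼-refl (∼-sym x∼1)) (≈⇒∼ (*-recipˡ x≉0)))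

  opaque
    A : Complement additiveGroup (valuationRing em K)
    A = pure-complement classical additiveGroup
      (record
        { resp      = λ x≈y x∈ → in-R (bounded-resp x≈y (R-in x∈))
        ; ε∈        = in-R 0-bounded
        ; ∙-closed  = λ x∈ y∈ → in-R (+-bounded (R-in x∈) (R-in y∈))
        ; ⁻¹-closed = λ x∈ → in-R (neg-bounded (R-in x∈))
        })
      (λ n {x} nx∈ → in-R (bounded-≤ (KL.∣x∣≤∣multiple∣ n x) (R-in nx∈)))
      divide
      where
      in-R : ∀ {a} → Bounded a → a ∈ valuationRing em K
      in-R = bounded⇒valuationRing em K
      R-in : ∀ {a} → a ∈ valuationRing em K → Bounded a
      R-in = valuationRing⇒bounded em K

    B : Complement P (positiveUnits em K)
    B = pure-complement classical P {positiveUnits em K}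
      (record
        { resp      = λ {x} {y} x≈y x∈ → ∼1⇒unit {y} (∼-trans (≈⇒∼ (sym x≈y)) (unit⇒∼1 {x} x∈))
        ; ε∈        = ∼1⇒unit {P.ε} ∼-refl
        ; ∙-closed  = λ {x} {y} x∈ y∈ → ∼1⇒unit {x P.∙ y}
            (∼-trans (*-cong-∼ (unit⇒∼1 {x} x∈) (unit⇒∼1 {y} y∈)) (≈⇒∼ (*-identityˡ 1#)))
        ; ⁻¹-closed = λ {x} x∈ → ∼1⇒unit {x P.⁻¹} (∼1-recip (0<⇒nonZero (proj₂ x)) (unit⇒∼1 {x} x∈))
        })
      -- Purity of the positive units is torsion-freeness of the value group.
      (λ n {x} nx∈ → ∼1⇒unit {x} (GL.torsion-free n {proj₁ x , 0<⇒nonZero (proj₂ x)}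
        (∼-trans (≈⇒∼ (multiple-value (suc n) x)) (unit⇒∼1 {suc n P.· x} nx∈))))
      (RealClosedRoots.positiveGroup-divisible K isRealClosed em)
      where
      multiple-value : ∀ n x → proj₁ (n G.· (proj₁ x , 0<⇒nonZero (proj₂ x))) ≈ proj₁ (n P.· x)
      multiple-value zero    x = refl
      multiple-value (suc n) x = *-congˡ (multiple-value n x)

  private
    module A = Complement A
    module B = Complement B
    module Aᴸ = KL.IsSubgroup (KL.isSubgroup A.subgroup)

  A-bounded : ∀ {x} → A.member x → Bounded x → x ≈ 0#
  A-bounded x∈A bx = A.disjoint x∈A (bounded⇒valuationRing em K bx)

  -- For unbounded x, one of x and - x is positive and would force an infinite partner; but y is
  -- equivalent to 1, and - x corresponds to 1.
  ↔∼1⇒bounded : ∀ {x y} → x ↔ y → y ∼ 1# → Bounded x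
  ↔∼1⇒bounded {x} {y} x↔y y∼1 with em {P = Bounded x}
  ... | yes bx = bx
  ... | no ¬bx with compare 0# x
  ...   | tri< 0<x _ _ = contradiction (∼-sym y∼1) (≪⇒≁ (↔-unbounded x↔y 0<x ¬bx))
  ...   | tri≈ _ 0≈x _ = bounded-resp 0≈x 0-bounded
  ...   | tri> _ _ x<0 = contradiction ∼-refl (≪⇒≁ (↔-unbounded
          (↔-neg {y′ = 1#} (∼-trans (≈⇒∼ (*-identityʳ y)) y∼1) x↔y) (<ε⇒ε<⁻¹ x<0)
          (λ b → ¬bx (bounded-resp (-‿involutive x) (neg-bounded b)))))

  ↔-÷ : ∀ {x x′ y y′} (y′≉0 : NonZero y′) → x ↔ y → x′ ↔ y′ → x + - x′ ↔ y * recip y′≉0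
  ↔-÷ y′≉0 x↔y x′↔y′ = ↔-+ x↔y (↔-neg (≈⇒∼ (*-recipʳ y′≉0)) x′↔y′)

  minus≈0 : ∀ {x y} → x + - y ≈ 0# → x ≈ y
  minus≈0 {x} {y} eq = trans (sym (-+-cancel y x)) (trans (+-congʳ eq) (+-identityˡ y))

  ↔-injective : ∀ {a a′ y y′} → A.member a → A.member a′ → NonZero y′ → a ↔ y → a′ ↔ y′ →
                y ∼ y′ → a ≈ a′
  ↔-injective a∈A a′∈A y′≉0 a↔y a′↔y′ y∼y′ = minus≈0
    (A-bounded (Aᴸ.∙-closed a∈A (Aᴸ.⁻¹-closed a′∈A))
      (↔∼1⇒bounded (↔-÷ y′≉0 a↔y a′↔y′)
        (∼-trans (*-cong-∼ y∼y′ ∼-refl) (≈⇒∼ (*-recipʳ y′≉0)))))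

  -- The difference a′ - a is a positive element of A, hence unbounded, and it corresponds to y′ /
  -- y.
  ↔-≪ : ∀ {a a′ y y′} → A.member a → A.member a′ → NonZero y → a ↔ y → a′ ↔ y′ → a < a′ → y ≪ y′
  ↔-≪ {a} {a′} {y} {y′} a∈A a′∈A y≉0 a↔y a′↔y′ a<a′ = ∼-≪-trans (≈⇒∼ (sym (*-identityˡ y)))
    (≪-∼-trans (*-mono-≪ y≉0 1≪)
      (≈⇒∼ (trans (*-assoc _ _ _) (trans (*-congˡ (*-recipˡ y≉0)) (*-identityʳ y′)))))
    where
    1≪ : 1# ≪ y′ * recip y≉0
    1≪ = ↔-unbounded (↔-÷ y≉0 a′↔y′ a↔y) (x<y⇒0<y-x a<a′) λ b →
      irrefl (sym (minus≈0 (A-bounded (Aᴸ.∙-closed a′∈A (Aᴸ.⁻¹-closed a∈A)) b))) a<a′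

  A-approximate : ∀ x → ∃ λ a → A.member a × Bounded (a + - x)
  A-approximate x = approximate (A.spanning x)
    where
    approximate : (∃₂ λ a r → A.member a × r ∈ valuationRing em K × x ≈ a + r) →
                  ∃ λ a → A.member a × Bounded (a + - x)
    approximate (a , r , a∈A , r∈R , x≈a+r) = a , a∈A , bounded-resp (begin-equality
      - r                ≈⟨ +-identityˡ _ ⟨
      0# + - r           ≈⟨ +-congʳ (-‿inverseʳ a) ⟨
      (a + - a) + - r    ≈⟨ +-assoc _ _ _ ⟩
      a + (- a + - r)    ≈⟨ +-congˡ (⁻¹-∙-comm a r) ⟩
      a + - (a + r)      ≈⟨ +-congˡ (-‿cong x≈a+r) ⟨
      a + - x            ∎) (neg-bounded (valuationRing⇒bounded em K r∈R))

  A-totalʳ : ∀ {y} → NonZero y → ∃ λ a → A.member a × a ↔ y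
  A-totalʳ y≉0 =
    let (x , x↔y)      = ↔-totalʳ y≉0
        (a , a∈A , a-x) = A-approximate x
    in a , a∈A , ↔-resp a-x ∼-refl x↔y

  B-totalˡ : ∀ x → ∃ λ b → B.member b × x ↔ proj₁ b
  B-totalˡ x =
    let (y , 0<y , x↔y)              = ↔-totalˡ x
        (b , u , b∈B , u∈U , y≈bu)   = B.spanning (y , 0<y)
    in b , b∈B , ↔-resp (bounded-resp (sym (-‿inverseʳ x)) 0-bounded)
      (∼-trans (≈⇒∼ y≈bu) (∼-trans (*-cong-∼ ∼-refl (unit⇒∼1 {u} u∈U)) (≈⇒∼ (*-identityʳ _)))) x↔y

  ↔-functional : ∀ {x x′ b b′} → B.member b → B.member b′ → x ↔ proj₁ b → x′ ↔ proj₁ b′ →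
                 x ≈ x′ → proj₁ b ≈ proj₁ b′
  ↔-functional {x} {x′} {b} {b′} b∈B b′∈B x↔b x′↔b′ x≈x′ = begin-equality
    proj₁ b                                ≈⟨ *-identityʳ _ ⟨
    proj₁ b * 1#                           ≈⟨ *-congˡ (*-recipˡ b′≉0) ⟨
    proj₁ b * (recip b′≉0 * proj₁ b′)      ≈⟨ *-assoc _ _ _ ⟨
    (proj₁ b * recip b′≉0) * proj₁ b′      ≈⟨ *-congʳ ratio≈1 ⟩
    1# * proj₁ b′                          ≈⟨ *-identityˡ _ ⟩
    proj₁ b′                               ∎
    where
    b′≉0 : NonZero (proj₁ b′)
    b′≉0 = 0<⇒nonZero (proj₂ b′)
    ratio≈1 : proj₁ b * recip b′≉0 ≈ 1#
    ratio≈1 = B.disjoint {b P.∙ b′ P.⁻¹} (B.∙-closed {b} {b′ P.⁻¹} b∈B (B.⁻¹-closed {b′} b′∈B))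
      (∼1⇒unit {b P.∙ b′ P.⁻¹} (↔-bounded (↔-÷ b′≉0 x↔b x′↔b′)
        (bounded-resp (sym (trans (+-congʳ x≈x′) (-‿inverseʳ x′))) 0-bounded)))

  -- B contains just one element of each class modulo units, so the correspondence restricts to a
  -- function χ on A; totality on the right makes it onto.
  leftExponentiation : LeftExponentiation em K
  leftExponentiation = record
    { A   = A
    ; B   = B
    ; iso = Embedding.isomorphism A.orderedAbelianGroup B.orderedAbelianGroup χ
        (λ {a} {a′} → χ-cong {a} {a′}) χ-homo (λ {a} {a′} → χ-mono {a} {a′}) χ-onto
    }
    where
    χ : Σ Carrier A.member → Σ P.Carrier B.member
    χ (a , _) = proj₁ (B-totalˡ a) , proj₁ (proj₂ (B-totalˡ a))
    ↔χ : ∀ a → proj₁ a ↔ proj₁ (proj₁ (χ a))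
    ↔χ (a , _) = proj₂ (proj₂ (B-totalˡ a))
    χ-cong : ∀ {a a′} → proj₁ a ≈ proj₁ a′ → proj₁ (proj₁ (χ a)) ≈ proj₁ (proj₁ (χ a′))
    χ-cong {a} {a′} = ↔-functional {b = proj₁ (χ a)} {proj₁ (χ a′)} (proj₂ (χ a)) (proj₂ (χ a′)) (↔χ a) (↔χ a′)
    χ-homo : ∀ a a′ → proj₁ (proj₁ (χ (proj₁ a + proj₁ a′ , Aᴸ.∙-closed (proj₂ a) (proj₂ a′)))) ≈
                      proj₁ (proj₁ (χ a)) * proj₁ (proj₁ (χ a′))
    χ-homo a a′ = ↔-functional {b = proj₁ (χ a+a′)} {proj₁ (χ a) P.∙ proj₁ (χ a′)} (proj₂ (χ a+a′))
      (B.∙-closed {proj₁ (χ a)} {proj₁ (χ a′)} (proj₂ (χ a)) (proj₂ (χ a′)))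
      (↔χ a+a′) (↔-+ (↔χ a) (↔χ a′)) refl
      where
      a+a′ : Σ Carrier A.member
      a+a′ = proj₁ a + proj₁ a′ , Aᴸ.∙-closed (proj₂ a) (proj₂ a′)
    χ-mono : ∀ {a a′} → proj₁ a < proj₁ a′ → proj₁ (proj₁ (χ a)) < proj₁ (proj₁ (χ a′))
    -- Both images are positive, so `≪` between them yields a strict inequality.
    χ-mono {a} {a′} a<a′ = <-respˡ-≈ (∣∣-nonneg (inj₁ (proj₂ (proj₁ (χ a)))))
      (<-respʳ-≈ (∣∣-nonneg (inj₁ (proj₂ (proj₁ (χ a′)))))
        (≪⇒∣∣<∣∣ (↔-≪ (proj₂ a) (proj₂ a′) (0<⇒nonZero (proj₂ (proj₁ (χ a)))) (↔χ a) (↔χ a′) a<a′)))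
    χ-onto : ∀ b → ∃ λ a → proj₁ (proj₁ (χ a)) ≈ proj₁ (proj₁ b)
    χ-onto (b , b∈B) =
      let (a , a∈A , a↔b) = A-totalʳ (0<⇒nonZero (proj₂ b))
      in (a , a∈A) , ↔-functional {b = proj₁ (χ (a , a∈A))} {b} (proj₂ (χ (a , a∈A))) b∈B (↔χ (a , a∈A)) a↔b refl

-- Archimedean components of an ordered abelian group.

module ArchimedeanComponents (classical : Classical) {ℓ} (em : ExcludedMiddle ℓ)
  (G : OrderedAbelianGroup ℓ) where
  open OrderedAbelianGroup G
  open OrderedGroupProperties G
  open SubgroupLemmas G

  -- Containment in this set is an elementwise form of being Archimedean, so that the construction
  -- of maximal subgroups applies to it.
  InClass : Carrier → Pred Carrier ℓ
  InClass x₀ x = x ≈ ε ⊎ x ∼ x₀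

  inClass-resp : ∀ {x₀ x y} → x ≈ y → InClass x₀ x → InClass x₀ y
  inClass-resp x≈y (inj₁ x≈ε)  = inj₁ (trans (sym x≈y) x≈ε)
  inClass-resp x≈y (inj₂ x∼x₀) = inj₂ (∼-trans (≈⇒∼ (sym x≈y)) x∼x₀)

  inClass-pure : ∀ {x₀} n {x} → InClass x₀ (suc n · x) → InClass x₀ x
  inClass-pure n (inj₁ nx≈ε)  = inj₁ (torsion-free n nx≈ε)
  inClass-pure n (inj₂ nx∼x₀) = inj₂ (∼-trans (∼-sym (multiple-∼ n _)) nx∼x₀)

  inClass-cases : ∀ {x₀ y z} → z ≈ y ⊎ z ≈ y ⁻¹ → InClass x₀ z → InClass x₀ y
  inClass-cases (inj₁ z≈y)   z∈ = inClass-resp z≈y z∈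
  inClass-cases (inj₂ z≈y⁻¹) (inj₁ z≈ε) = inj₁ (trans (sym (⁻¹-involutive _))
    (trans (⁻¹-cong (trans (sym z≈y⁻¹) z≈ε)) ε⁻¹≈ε))
  inClass-cases (inj₂ z≈y⁻¹) (inj₂ z∼x₀) = inj₂ (∼-trans (∼-sym (⁻¹-∼ _)) (∼-trans (≈⇒∼ (sym z≈y⁻¹)) z∼x₀))

  inClass⇒archimedean : ∀ {x₀} (A : Subgroup G) → (∀ {x} → Subgroup.member A x → InClass x₀ x) →
                        IsArchimedean (Subgroup.orderedAbelianGroup A)
  inClass⇒archimedean A A⊆ {x , x∈A} {y , y∈A} x≉ε y≉ε with A⊆ x∈A | A⊆ y∈A
  ... | inj₁ x≈ε | _ = contradiction x≈ε x≉ε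
  ... | inj₂ _ | inj₁ y≈ε = contradiction y≈ε y≉ε
  ... | inj₂ x∼x₀ | inj₂ y∼x₀ = Inclusion.∼-cancel G A {x , x∈A} {y , y∈A} (∼-trans x∼x₀ (∼-sym y∼x₀))

  archimedean⇒inClass : ∀ {x₀} (A : Subgroup G) → IsArchimedean (Subgroup.orderedAbelianGroup A) →
    Subgroup.member A x₀ → NonZero x₀ → ∀ {x} → Subgroup.member A x → InClass x₀ x
  archimedean⇒inClass {x₀} A arch x₀∈A x₀≉ε {x} x∈A with x ≟ ε
  ... | yes x≈ε = inj₁ x≈ε
  ... | no x≉ε  = inj₂ (Inclusion.∼-homo G A {x , x∈A} {x₀ , x₀∈A} (arch x≉ε x₀≉ε))

  -- The maximal subgroup is not guaranteed to contain x₀, so any non-zero e in it represents the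
  -- class. It is not trivial, as otherwise x₀ could be adjoined.
  archimedeanComponent : ∀ γ → ArchimedeanComponent em G γ
  archimedeanComponent (x₀ , x₀≉ε) with em {P = ∃ λ e → A e × NonZero e}
    where
    open MaximalSubgroup G classical (InClass x₀) inClass-resp (inj₁ refl)
    A : Pred Carrier ℓ
    A = Subgroup.member maximal
  ... | yes (e , e∈A , e≉ε) = record
    { subgroup      = maximal
    ; isArchimedean = inClass⇒archimedean maximal maximal⊆Q
    ; maximal       = λ B arch A⊆B {c} c∈B → maximal-adjoin c λ y∈ →
        extend (archimedean⇒inClass B arch (A⊆B e∈A) e≉ε (adjoin⊆B B A⊆B c∈B y∈))
    ; element       = e , e≉ε
    ; element∈γ     = e∼x₀ (maximal⊆Q e∈A)
    ; element∈B     = e∈A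
    }
    where
    open MaximalSubgroup G classical (InClass x₀) inClass-resp (inj₁ refl)
    e∼x₀ : InClass x₀ e → e ∼ x₀
    e∼x₀ (inj₁ e≈ε)  = contradiction e≈ε e≉ε
    e∼x₀ (inj₂ e∼x₀) = e∼x₀
    extend : ∀ {y} → InClass e y → InClass x₀ y
    extend (inj₁ y≈ε) = inj₁ y≈ε
    extend (inj₂ y∼e) = inj₂ (∼-trans y∼e (e∼x₀ (maximal⊆Q e∈A)))
    adjoin⊆B : ∀ B → Subgroup.member maximal ⊆ Subgroup.member B → ∀ {c} → Subgroup.member B c →
               adjoin (Subgroup.member maximal) c ⊆ Subgroup.member B
    adjoin⊆B B A⊆B c∈B (s , s∈A , m , n , eq) = ∙-cancelʳ-∈ (·-closed n c∈B)
      (∙-closed (A⊆B s∈A) (·-closed m c∈B)) eq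
      where open IsSubgroup (isSubgroup B)
  ... | no none = contradiction
    (x₀ , maximal-adjoin x₀ x₀-multiples , x₀≉ε) none
    where
    open MaximalSubgroup G classical (InClass x₀) inClass-resp (inj₁ refl)
    A-trivial : ∀ {s} → Subgroup.member maximal s → s ≈ ε
    A-trivial {s} s∈A with s ≟ ε
    ... | yes s≈ε = s≈ε
    ... | no s≉ε  = contradiction (s , s∈A , s≉ε) none
    x₀-multiples : adjoin (Subgroup.member maximal) x₀ ⊆ InClass x₀
    x₀-multiples y∈ with adjoin-cases (isSubgroup maximal) y∈
    ... | inj₁ y∈A = inj₁ (A-trivial y∈A)
    ... | inj₂ (s , k , s∈A , z , z≈±y , z≈) = inClass-cases z≈±y (inj₂ (∼-trans
      (≈⇒∼ (trans z≈ (trans (∙-congʳ (A-trivial s∈A)) (identityˡ _)))) (multiple-∼ k x₀)))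

  module _ {γ} (B : ArchimedeanComponent em G γ) where
    private
      module B = ArchimedeanComponent B
      e : Carrier
      e = proj₁ B.element

    component-inClass : ∀ {x} → Subgroup.member B.subgroup x → InClass e x
    component-inClass = archimedean⇒inClass B.subgroup B.isArchimedean B.element∈B (proj₂ B.element)

    component-adjoin : ∀ c → adjoin (Subgroup.member B.subgroup) c ⊆ InClass e →
                       Subgroup.member B.subgroup c
    component-adjoin c c⊆ = B.maximal C (inClass⇒archimedean C c⊆) (⊆-adjoin c)
      (generator∈adjoin c (isSubgroup B.subgroup))
      where
      C : Subgroup G
      C = toSubgroup (adjoin-isSubgroup c (isSubgroup B.subgroup))

    component-pure : ∀ n {x} → Subgroup.member B.subgroup (suc n · x) → Subgroup.member B.subgroup x
    component-pure n {x} nx∈B = component-adjoin x λ y∈ →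
      inClass-pure n (component-inClass (adjoin-multiple n (isSubgroup B.subgroup) nx∈B y∈))

-- Groups that are copies of a complement of the valuation ring.

module _ (classical : Classical) {ℓ} (em : ExcludedMiddle ℓ) (K : OrderedField ℓ)
  (G : OrderedAbelianGroup ℓ) where
  private module G = OrderedAbelianGroup G
  open OrderedField K
  open OrderedFieldProperties K

  module ComplementOfValuationRing
    (f : G.Carrier → Carrier)
    (f-cong : ∀ {x y} → x G.≈ y → f x ≈ f y)
    (f-homo : ∀ x y → f (x G.∙ y) ≈ f x + f y)
    (f-mono : ∀ {x y} → x G.< y → f x < f y)
    (f-disjoint : ∀ {x} → Bounded (f x) → x G.≈ G.ε)
    (f-spanning : ∀ k → ∃ λ x → Bounded (k + - f x)) where
    open BoundedLemmas K
    open CommutativeMonoidMultiplication +-commutativeMonoid using (×-distrib-+)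
    open DifferenceSolver commutativeRing using (solve; _:=_; _:+_; :-_)
    open Embedding G additiveGroup f f-cong f-homo f-mono
    open ArchimedeanComponents classical em G
    private
      module GL = SubgroupLemmas G
      module GP = OrderedGroupProperties G
      module KL = SubgroupLemmas additiveGroup

    unbounded : ∀ {x} → G.NonZero x → ¬ Bounded (f x)
    unbounded x≉ε b = x≉ε (f-disjoint b)

    -- An unbounded element exceeds its bounded distance from another one. Applied to k and to f x,
    -- this shows that they differ in size by a factor of at most 2.
    f-approximate : ∀ {k} → ¬ Bounded k → ∃ λ x → G.NonZero x × f x ∼ k
    f-approximate {k} ¬bk with f-spanning k
    ... | x , b = x ,
      (λ x≈ε → ¬bfx (bounded-resp (sym (trans (f-cong x≈ε) ε-homo)) 0-bounded)) ,
      2 , half ¬bfx (bounded-resp (neg-minus k (f x)) (neg-bounded b)) , half ¬bk b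
      where
      ¬bfx : ¬ Bounded (f x)
      ¬bfx bfx = ¬bk (bounded-resp (-+-cancel (f x) k) (+-bounded b bfx))
      half : ∀ {k l} → ¬ Bounded k → Bounded (k + - l) → ∣ l ∣ ≤ 2 · ∣ k ∣
      half {k} {l} ¬bk (n , k-l≤n) = begin
        ∣ l ∣                      ≈⟨ ∣∣-cong (solve 2 (λ k l → l := k :+ :- (k :+ :- l)) refl k l) ⟩
        ∣ k + - (k + - l) ∣        ≤⟨ ∣∣-triangle _ _ ⟩
        ∣ k ∣ + ∣ - (k + - l) ∣    ≈⟨ +-congˡ (∣⁻¹∣ _) ⟩
        ∣ k ∣ + ∣ k + - l ∣        ≤⟨ ∙-monoʳ-≤ _ (≤-trans k-l≤n (inj₁ (unbounded⇒1≪ ¬bk n))) ⟩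
        ∣ k ∣ + ∣ k ∣              ≈⟨ +-congˡ (+-identityʳ _) ⟨
        2 · ∣ k ∣                  ∎

    -- Non-zero elements of G go to unbounded elements of K, which are those of negative value.
    -- Archimedean equivalence agrees on both sides, and `f-approximate` reaches every negative
    -- value.
    rank≅ : rank em G ≅ᵒ negativeCone em (valueGroup em K)
    rank≅ = record
      { to = λ (x , x≉ε) → (f x , nonZero x≉ε) , unbounded⇒1≪ (unbounded x≉ε)
      ; isOrderIsomorphism = record
        { isOrderMonomorphism = record
          { isOrderHomomorphism = record { cong = ∼-homo ; mono = ≪-homo }
          ; injective = ∼-cancel
          ; cancel    = ≪-cancel
          }
        ; surjective = λ ((k , _) , 1≪k) →
            let (x , x≉ε , fx∼k) = f-approximate (1≪⇒unbounded 1≪k)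
            in (x , x≉ε) , λ z∼x → ∼-trans (∼-homo z∼x) fx∼k
        }
      }

    private
      C : OrderedAbelianGroup ℓ
      C = OrderedField.additiveGroup (residueField em K)
      module C = OrderedAbelianGroup C

    -- A bounded y is at most some n, and a positive x that is not infinitesimal has a multiple m x
    -- ≥ 1, so y ≤ n m x.
    residueField-archimedean : IsArchimedean C
    residueField-archimedean = archimedean classical C λ {x} {y} → bound x y
      where
      module CP = OrderedGroupProperties C
      multiple-value : ∀ n x → proj₁ (n C.· x) ≈ n · proj₁ x
      multiple-value zero    x = refl
      multiple-value (suc n) x = +-congˡ (multiple-value n x)
      bound : ∀ x y → C.ε C.< x → C.ε C.< y → ∃ λ n → y C.≤ n C.· x
      bound X@(x , _) Y@(y , y∈R) (0<x , 0≉x) _ with valuationRing⇒bounded em K y∈R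
        | ¬≪⇒≤ em (λ x≪1 → 0≉x (infinitesimal⇒maximalIdeal em K (≈ᵣ-sym (infinitesimal⇒≈ᵣ0 x≪1))))
      ... | n , y≤n | m , 1≤mx = n ℕ.* m , CP.≮⇒≥ {(n ℕ.* m) C.· X} {Y} λ nmx<y → <⇒≱ (proj₁ nmx<y) (begin
        y                          ≤⟨ x≤∣x∣ y ⟩
        ∣ y ∣                      ≤⟨ ≤··-trans n m y≤n 1≤mx ⟩
        (n ℕ.* m) · ∣ x ∣          ≈⟨ ×-congʳ (n ℕ.* m) (∣∣-nonneg (inj₁ 0<x)) ⟩
        (n ℕ.* m) · x              ≈⟨ multiple-value (n ℕ.* m) X ⟨
        proj₁ ((n ℕ.* m) C.· X)    ∎)

    -- If f y approximates f x divided by n + 1, then the image of (n + 1) y - x is bounded, hence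
    -- zero.
    divide-G : ∀ n x → ∃ λ y → suc n G.· y G.≈ x
    divide-G n x = y , GL.minus≈ε (f-disjoint (bounded-resp (begin-equality
        - (suc n · (k + - f y))                  ≈⟨ KL.multiple-⁻¹ (suc n) _ ⟨
        suc n · - (k + - f y)                    ≈⟨ ×-congʳ (suc n) (neg-minus k (f y)) ⟩
        suc n · (f y + - k)                      ≈⟨ ×-distrib-+ _ _ (suc n) ⟩
        suc n · f y + suc n · - k                ≈⟨ +-cong (·-homo (suc n) y) (sym (KL.multiple-⁻¹ (suc n) k)) ⟨
        f (suc n G.· y) + - (suc n · k)          ≈⟨ +-congˡ (-‿cong (proj₂ (divide n (f x)))) ⟩
        f (suc n G.· y) + - f x                  ≈⟨ +-congˡ (⁻¹-homo x) ⟨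
        f (suc n G.· y) + f (x G.⁻¹)             ≈⟨ f-homo _ _ ⟨
        f (suc n G.· y G.∙ x G.⁻¹)               ∎)
      (neg-bounded (multiple-bounded (suc n) (proj₂ (f-spanning k))))))
      where
      k : Carrier
      k = proj₁ (divide n (f x))
      y : G.Carrier
      y = proj₁ (f-spanning k)

    bounded-≁1⇒infinitesimal : ∀ {x} → Bounded x → ¬ x ∼ 1# → Infinitesimal x
    bounded-≁1⇒infinitesimal {x} (m , x≤m) x≁1 with em {P = Infinitesimal x}
    ... | yes i = i
    ... | no ¬i = contradiction (n ℕ.+ m
        , ≤-trans (proj₂ (¬≪⇒≤ em ¬i)) (·-monoˡ-≤ (ℕₚ.m≤m+n n m) (ε≤∣∣ x))
        , ≤-trans x≤m (·-monoˡ-≤ (ℕₚ.m≤n+m m n) (ε≤∣∣ 1#))) x≁1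
      where
      n : ℕ
      n = proj₁ (¬≪⇒≤ em ¬i)

    module _ {γ} (B : ArchimedeanComponent em G γ) where
      private
        module B = ArchimedeanComponent B
        member : Pred G.Carrier ℓ
        member = Subgroup.member B.subgroup
        open GL.IsSubgroup (GL.isSubgroup B.subgroup)
        e : G.Carrier
        e = proj₁ B.element
        u : Carrier
        -- The absolute value keeps the scaling order preserving when f e is negative.
        u = ∣ f e ∣
        0<u : 0# < u
        0<u = ε<∣∣ (nonZero (proj₂ B.element))
        u≉0 : NonZero u
        u≉0 = 0<⇒nonZero 0<u
        u⁻¹ : Carrier
        u⁻¹ = recip u≉0

        fe∼u : f e ∼ u
        fe∼u = 1 , ≤1· (inj₂ ∣u∣≈u) , ≤1· (inj₂ (sym ∣u∣≈u))
          where
          ∣u∣≈u : ∣ u ∣ ≈ u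
          ∣u∣≈u = ∣∣-nonneg (inj₁ 0<u)

        u⁻¹-infinitesimal : Infinitesimal u⁻¹
        u⁻¹-infinitesimal = ∼-≪-trans (≈⇒∼ (sym (*-identityˡ u⁻¹))) (≪-∼-trans
          (*-mono-≪ (recip-nonZero u≉0) (≪-∼-trans (unbounded⇒1≪ (unbounded (proj₂ B.element))) fe∼u))
          (≈⇒∼ (*-recipʳ u≉0)))

        scaled : G.Carrier → Carrier
        scaled x = f x * u⁻¹

        scaled-cong : ∀ {x y} → x G.≈ y → scaled x ≈ scaled y
        scaled-cong x≈y = *-congʳ (f-cong x≈y)

        scaled-homo : ∀ x y → scaled (x G.∙ y) ≈ scaled x + scaled y
        scaled-homo x y = trans (*-congʳ (f-homo x y)) (distribʳ u⁻¹ (f x) (f y))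

        scaled-mono : ∀ {x y} → x G.< y → scaled x < scaled y
        scaled-mono x<y = *-monoˡ-< (recip-pos 0<u) (f-mono x<y)

        module Scaled = Embedding G additiveGroup scaled scaled-cong scaled-homo scaled-mono

        scaled-∼ : ∀ {x} → x G.∼ e → scaled x ∼ 1#
        scaled-∼ x∼e = ∼-trans (*-cong-∼ (∼-trans (∼-homo x∼e) fe∼u) ∼-refl) (≈⇒∼ (*-recipʳ u≉0))

        scaled-∼-cancel : ∀ {x} → scaled x ∼ 1# → x G.∼ e
        scaled-∼-cancel p = ∼-cancel (∼-cancelʳ (recip-nonZero u≉0) (∼-trans p (∼-sym (scaled-∼ GP.∼-refl))))

        scaled-bounded : ∀ {x} → member x → Bounded (scaled x)
        scaled-bounded x∈B with component-inClass B x∈B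
        ... | inj₁ x≈ε = bounded-resp (sym (trans (scaled-cong x≈ε) Scaled.ε-homo)) 0-bounded
        ... | inj₂ x∼e = ∼⇒bounded (scaled-∼ x∼e)

        scaled-minus : ∀ x y → scaled (x G.∙ y G.⁻¹) ≈ scaled x + - scaled y
        scaled-minus x y = trans (scaled-homo x (y G.⁻¹)) (+-congˡ (Scaled.⁻¹-homo y))

        -- Non-zero elements of B lie in the class of e and scale to units; taking residues is
        -- therefore injective on B.
        scaled-reflects : ∀ {x} → member x → G.NonZero x → ¬ Infinitesimal (scaled x)
        scaled-reflects x∈B x≉ε i with component-inClass B x∈B
        ... | inj₁ x≈ε = x≉ε x≈ε
        ... | inj₂ x∼e = ≪⇒≁ i (scaled-∼ x∼e)

        -- If h is not in B, then by maximality some s ∙ (k + 1) · h is not in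
        -- the class of e, so that h has the same residue as - s / (k + 1).
        same-residue : ∀ h → Bounded (scaled h) → ∃ λ b → member b × scaled h ≈ᵣ scaled b
        same-residue h bh with em {P = member h} | em {P = ∃ λ y → GL.adjoin member h y × ¬ InClass e y}
        ... | yes h∈B | _      = h , h∈B , ≈ᵣ-refl
        ... | no h∉B | no none = contradiction (component-adjoin B h λ {y} y∈ → dne λ ¬c → none (y , y∈ , ¬c)) h∉B
          where
          dne : ∀ {P : Set ℓ} → ¬ ¬ P → P
          dne {P = P} ¬¬p with em {P = P}
          ... | yes p = p
          ... | no ¬p = contradiction ¬p ¬¬p
        ... | no _ | yes (y , y∈ , y∉) = residue (GL.adjoin-cases (GL.isSubgroup B.subgroup) y∈)
          where
          residue : (member y ⊎ ∃₂ λ s k → member s × ∃ λ z → (z G.≈ y ⊎ z G.≈ y G.⁻¹) × z G.≈ s G.∙ suc k G.· h) →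
                    ∃ λ b → member b × scaled h ≈ᵣ scaled b
          residue (inj₁ y∈B) = contradiction (component-inClass B y∈B) y∉
          residue (inj₂ (s , k , s∈B , z , z≈±y , z≈s∙kh)) = b , b∈B ,
            infinitesimal-resp-≈ (scaled-minus h b)
              (infinitesimal-convex (KL.∣x∣≤∣multiple∣ k _)
                (infinitesimal-resp-≈ (trans (scaled-cong z≈kd) (Scaled.·-homo (suc k) d)) z-infinitesimal))
            where
            b d : G.Carrier
            b = proj₁ (divide-G k (s G.⁻¹))
            d = h G.∙ b G.⁻¹
            kb≈s⁻¹ : suc k G.· b G.≈ s G.⁻¹
            kb≈s⁻¹ = proj₂ (divide-G k (s G.⁻¹))
            b∈B : member b
            b∈B = component-pure B k (resp (G.sym kb≈s⁻¹) (⁻¹-closed s∈B))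
            z≈kd : z G.≈ suc k G.· d
            z≈kd = G.trans z≈s∙kh (G.trans (G.comm _ _) (G.sym (G.trans
              (GL.×-distrib-+ h (b G.⁻¹) (suc k)) (G.∙-congˡ (G.trans (GL.multiple-⁻¹ (suc k) b)
                (G.trans (G.⁻¹-cong kb≈s⁻¹) (GP.⁻¹-involutive s)))))))
            z-infinitesimal : Infinitesimal (scaled z)
            z-infinitesimal = bounded-≁1⇒infinitesimal
              (bounded-resp (sym (trans (scaled-cong z≈s∙kh) (trans (scaled-homo s _) (+-congˡ (Scaled.·-homo (suc k) h)))))
                (+-bounded (scaled-bounded s∈B) (multiple-bounded (suc k) bh)))
              (λ z∼1 → y∉ (inClass-cases z≈±y (inj₂ (scaled-∼-cancel z∼1))))

        in-R : ∀ {a} → Bounded a → a ∈ valuationRing em K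
        in-R = bounded⇒valuationRing em K
        in-μ : ∀ {a} → Infinitesimal a → a ∈ maximalIdeal em K
        in-μ = infinitesimal⇒maximalIdeal em K

        -- Choose h with f h at bounded distance from r u. Division by the infinite u makes the
        -- error infinitesimal, and `same-residue` replaces h by an element of B.
        onto : ∀ r → Bounded r → ∃ λ b → member b × scaled b ≈ᵣ r
        onto r br = b , b∈B , ≈ᵣ-trans (≈ᵣ-sym h≈b) h≈r
          where
          h : G.Carrier
          h = proj₁ (f-spanning (r * u))
          h≈r : scaled h ≈ᵣ r
          h≈r = ≈ᵣ-sym (infinitesimal-resp-≈
            (trans (minus-*ʳ (r * u) (f h) u⁻¹) (+-congʳ (trans (*-assoc _ _ _)
              (trans (*-congˡ (*-recipʳ u≉0)) (*-identityʳ r)))))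
            (*-infinitesimalʳ (proj₂ (f-spanning (r * u))) u⁻¹-infinitesimal))
          bh : Bounded (scaled h)
          bh = bounded-resp (-+-cancel r (scaled h)) (+-bounded
            (bounded-≤ (inj₁ (≪⇒∣∣<∣∣ h≈r)) 1-bounded) br)
          b : G.Carrier
          b = proj₁ (same-residue h bh)
          b∈B : member b
          b∈B = proj₁ (proj₂ (same-residue h bh))
          h≈b : scaled h ≈ᵣ scaled b
          h≈b = proj₂ (proj₂ (same-residue h bh))

      component≅ : ArchimedeanComponent.orderedAbelianGroup B ≅ᵍ C
      component≅ = Embedding.isomorphism B.orderedAbelianGroup C
        (λ (x , x∈B) → scaled x , in-R (scaled-bounded x∈B))
        (λ x≈y → in-μ (≈⇒≈ᵣ (scaled-cong x≈y)))
        (λ (x , _) (y , _) → in-μ (≈⇒≈ᵣ (scaled-homo x y)))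
        (λ {x} {y} x<y → scaled-mono x<y , λ i →
          scaled-reflects (∙-closed (proj₂ x) (⁻¹-closed (proj₂ y)))
            (λ eq → G.irrefl (GL.minus≈ε eq) x<y)
            (infinitesimal-resp-≈ (sym (scaled-minus (proj₁ x) (proj₁ y))) (maximalIdeal⇒infinitesimal em K i)))
        λ (r , r∈R) →
          let (b , b∈B , b≈r) = onto r (valuationRing⇒bounded em K r∈R)
          in (b , b∈B) , in-μ b≈r

    -- `rank≅` ends in the negative cone of the value group of K. It has the type of this argument
    -- once G is that value group itself.
    isExponentialGroup : rank em G ≅ᵒ negativeCone em G → IsExponentialGroupIn em G C
    isExponentialGroup rank≅G<0 = record
      { C-isArchimedean = residueField-archimedean
      ; rank≅G<0        = rank≅G<0
      ; component       = archimedeanComponent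
      ; component≅C     = component≅
      }

-- The value group as a copy of a complement of its valuation ring.

module ExponentialValueGroup (classical : Classical) {ℓ} (em : ExcludedMiddle ℓ) (K : OrderedField ℓ) (isRealClosed : IsRealClosed K)
  (Z : IntegerPart K) (pa : ConeModelsPA (IntegerPart.orderedRing Z)) where
  open OrderedField K
  open OrderedFieldProperties K
  open BoundedLemmas K
  open Correspondence K Z pa
  open LeftExponential classical em K isRealClosed Z pa
  private
    module A = Complement A
    module G = OrderedAbelianGroup (valueGroup em K)

  opaque
    log : ∀ (x : G.Carrier) → ∃ λ a → A.member a × a ↔ proj₁ x
    log (x , x≉0) = A-totalʳ x≉0

  -- The sign compensates for the reversed order of the values: larger classes of K have smaller
  -- value.
  embed : G.Carrier → Carrier
  embed x = - proj₁ (log x)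

  private
    log∈A : ∀ x → A.member (proj₁ (log x))
    log∈A x = proj₁ (proj₂ (log x))
    log↔ : ∀ x → proj₁ (log x) ↔ proj₁ x
    log↔ x = proj₂ (proj₂ (log x))

  embed-cong : ∀ {x y} → x G.≈ y → embed x ≈ embed y
  embed-cong {x} {y} x∼y = -‿cong (↔-injective (log∈A x) (log∈A y) (proj₂ y) (log↔ x) (log↔ y) x∼y)

  embed-homo : ∀ x y → embed (x G.∙ y) ≈ embed x + embed y
  embed-homo x y = trans (-‿cong (↔-injective (log∈A (x G.∙ y)) (A.∙-closed (log∈A x) (log∈A y))
    (proj₂ (x G.∙ y)) (log↔ (x G.∙ y)) (↔-+ (log↔ x) (log↔ y)) ∼-refl)) (sym (⁻¹-∙-comm _ _))

  embed-mono : ∀ {x y} → x G.< y → embed x < embed y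
  embed-mono {x} {y} y≪x with compare (proj₁ (log x)) (proj₁ (log y))
  ... | tri> _ _ b<a = ⁻¹-anti-< b<a
  ... | tri≈ _ a≈b _ = contradiction
          (↔-bounded (↔-÷ (proj₂ y) (log↔ x) (log↔ y)) (bounded-resp (sym (trans (+-congʳ a≈b) (-‿inverseʳ _))) 0-bounded))
          (λ xy⁻¹∼1 → ≪⇒≁ y≪x (∼-sym (∼-cancelʳ (recip-nonZero (proj₂ y)) (∼-trans xy⁻¹∼1 (≈⇒∼ (sym (*-recipʳ (proj₂ y))))))))
  ... | tri< a<b _ _ = contradiction
          (≪-trans y≪x (↔-≪ (log∈A x) (log∈A y) (proj₂ x) (log↔ x) (log↔ y) a<b)) ≪-irrefl

  embed-disjoint : ∀ {x} → Bounded (embed x) → x G.≈ G.ε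
  embed-disjoint {x} b = ↔-bounded (log↔ x) (bounded-resp (-‿involutive _) (neg-bounded b))

  -- Both - k and the logarithm of y correspond to elements of the class of y, so they differ by a
  -- bounded element.
  embed-spanning : ∀ k → ∃ λ x → Bounded (k + - embed x)
  embed-spanning k =
    let (y , 0<y , -k↔y) = ↔-totalˡ (- k)
        x = y , 0<⇒nonZero 0<y
        b = ↔∼1⇒bounded (↔-÷ (proj₂ x) (log↔ x) -k↔y) (≈⇒∼ (*-recipʳ (proj₂ x)))
    in x , bounded-resp (trans (+-comm _ _) (+-cong (-‿involutive k) (sym (-‿involutive _)))) b

  open ComplementOfValuationRing classical em K (valueGroup em K) embed embed-cong embed-homo embed-mono
    embed-disjoint embed-spanning

  -- No signature: comparing two elaborations of this type unfolds the value group.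
  isExponentialValueGroup = isExponentialGroup rank≅

theorem3 : (classical : Classical) →
    let open Classical classical renaming (excluded-middle to em) in
    ∀ {ℓ} (K : OrderedField ℓ) →
    IsRealClosed K →
    IsNonArchimedean K →
    (∃ λ (Z : IntegerPart K) → ConeModelsPA (IntegerPart.orderedRing Z)) →
    LeftExponentiation em K ×
    IsExponentialGroupIn em (valueGroup em K) (OrderedField.additiveGroup (residueField em K))
theorem3 classical K isRealClosed _ (Z , pa) =
  LeftExponential.leftExponentiation classical (Classical.excluded-middle classical) K isRealClosed Z pa ,
  ExponentialValueGroup.isExponentialValueGroup classical (Classical.excluded-middle classical) K isRealClosed Z pa
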